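{- There exists a randomized semi-streaming algorithm for the set cover problem in the dynamic set streaming model that with high probability computes an $O(\log n)$-approximation in $O(\log m\cdot\log n)$ passes over the stream.
   Context: Set cover: given a collection of $m$ sets over $[n]$ (whose union is $[n]$), find a smallest subcollection whose union is $[n]$; an $\alpha$-approximation is a cover of size at most $\alpha$ times the minimum. Dynamic (set) streaming model: the input is a stream $\langle a_1,\dots,a_t\rangle$ with $a_i=(S_i,\Delta_i)$, $S_i\subseteq[n]$, $\Delta_i\in\{ -1,+1\}$ (insertion or deletion of a set). The multiplicity of a set $S$ is $\sum_{i:S_i=S}\Delta_i$ and is required to be non-negative at all times; the collection of sets is that defined by the multiplicities at the end of the stream (at most $m$ sets). A semi-streaming algorithm uses $O(n\cdot\mathrm{poly}\{\log m,\log n\})$ space. -}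

module Defs where

open import Data.Bool using (Bool)
import Data.Bool.Properties as Bool
open import Data.Fin using (Fin)
open import Data.Fin.Subset using (Subset; ⋃; ⊤)
open import Data.Integer as ℤ using (ℤ; 0ℤ; +_; _◃_)
open import Data.List using (List; length; filter; filterᵇ; foldl; take; map; foldr; deduplicate; allFin)
import Data.List.Relation.Binary.Subset.DecPropositional as DecSubset
open import Data.List.Relation.Binary.Subset.Propositional using (_⊆_)
open import Data.Nat using (ℕ; _*_; _^_; _≤_; _≤?_)
open import Data.Nat.GeneralisedArithmetic using (fold)
open import Data.Product using (_×_; _,_)
open import Data.Sign using (Sign)
open import Data.Vec.Properties using (≡-dec)
open import Function using (_∘_)
open import Level using (0ℓ)
open import Relation.Binary.Definitions using (DecidableEquality)
open import Relation.Binary.PropositionalEquality using (_≡_)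
open import Relation.Nullary using (Dec; ¬?)
open import Relation.Nullary.Decidable using (_×-dec_)
open import Relation.Unary using (Pred; Decidable)

_≟ₛ_ : ∀ {n} → DecidableEquality (Subset n)
_≟ₛ_ = ≡-dec Bool._≟_

-- A collection of sets over [n] is a list, so that it may contain several
-- copies of a set; its length counts the copies.
Collection : ℕ → Set
Collection n = List (Subset n)

count : ∀ {n} → Subset n → Collection n → ℕ
count S 𝒞 = length (filter (_≟ₛ S) 𝒞)

IsCover : ∀ {n} → Collection n → Collection n → Set
IsCover 𝒞 𝒯 = 𝒯 ⊆ 𝒞 × ⋃ 𝒯 ≡ ⊤

IsMinimumCover : ∀ {n} → Collection n → Collection n → Set
IsMinimumCover 𝒞 𝒪 = IsCover 𝒞 𝒪 × (∀ 𝒯 → IsCover 𝒞 𝒯 → length 𝒪 ≤ length 𝒯)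

-- 𝒪 is meant to be a minimum cover of 𝒞. Taking it as an argument keeps the
-- relation decidable.
IsApproximation : ∀ {n} → ℕ → (𝒞 𝒪 𝒯 : Collection n) → Set
IsApproximation α 𝒞 𝒪 𝒯 = IsCover 𝒞 𝒯 × length 𝒯 ≤ α * length 𝒪

isApproximation? : ∀ {n} α (𝒞 𝒪 𝒯 : Collection n) → Dec (IsApproximation α 𝒞 𝒪 𝒯)
isApproximation? α 𝒞 𝒪 𝒯 =
  (𝒯 ⊆? 𝒞 ×-dec (⋃ 𝒯 ≟ₛ ⊤)) ×-dec (length 𝒯 ≤? α * length 𝒪)
  where open DecSubset _≟ₛ_ using (_⊆?_)

Update : ℕ → Set
Update n = Subset n × Sign

Stream : ℕ → Set
Stream n = List (Update n)

multiplicity : ∀ {n} → Stream n → Subset n → ℤ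
multiplicity a S = foldr ℤ._+_ 0ℤ (map (λ (_ , Δ) → Δ ◃ 1) (filter (λ (T , _) → T ≟ₛ S) a))

IsDynamic : ∀ {n} → Stream n → Set
IsDynamic a = ∀ i S → 0ℤ ℤ.≤ multiplicity (take i a) S

_Defines_ : ∀ {n} → Stream n → Collection n → Set
a Defines 𝒞 = ∀ S → multiplicity a S ≡ + count S 𝒞

Bits : ℕ → Set
Bits k = Fin (2 ^ k)

-- The coins are tossed before the first pass. What the algorithm needs of them
-- later has to be kept in its memory, and so counts towards the space; the same
-- holds for the number of the current pass.
--
-- n sets over [n] can take n² bits to write down, more than a semi-streaming
-- algorithm can hold. The computed subcollection is therefore represented by
-- the final memory content through `selects`, which says for each set of the
-- collection whether it is chosen, and sees nothing of the stream beyond the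
-- memory.
record StreamingAlgorithm (n : ℕ) : Set where
  field
    space passes coins : ℕ
    init    : Bits coins → Bits space
    update  : Bits space → Update n → Bits space
    endPass : Bits space → Bits space
    selects : Bits space → Subset n → Bool

  pass : Stream n → Bits space → Bits space
  pass a μ = endPass (foldl update μ a)

  finalMemory : Stream n → Bits coins → Bits space
  finalMemory a ω = fold (init ω) (pass a) passes

  -- Several copies of a chosen set are chosen once.
  solution : Stream n → Collection n → Bits coins → Collection n
  solution a 𝒞 ω = deduplicate _≟ₛ_ (filterᵇ (selects (finalMemory a ω)) 𝒞)

  -- The event P has probability at least 1 - 1/q, the coins being fair.
  Pr[_]≥1-1/_ : {P : Pred (Bits coins) 0ℓ} → Decidable P → ℕ → Set
  Pr[ P? ]≥1-1/ q = length (filter (¬? ∘ P?) (allFin (2 ^ coins))) * q ≤ 2 ^ coins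

{-# OPTIONS --safe #-}

-- Every pass maintains the set U of uncovered elements. Let 2ⁱ be the largest
-- power of two such that some set covers at least 2ⁱ elements of U, and call
-- those sets large. Sample the sets at all rates 2⁻ʲ at once, with pairwise
-- independent linear hashing. An element that sees exactly one distinct large
-- set at some rate learns a hashed identifier of it from polylogarithmically
-- many counters, and follows that set; sets with at least 2ⁱ/4 followers are
-- chosen, and their followers leave U.
--
-- Cost: each chosen set charges at most 4/2ⁱ to each of its followers. A set of the
-- optimum has fewer than 2ⁱ⁺¹ elements in U during phase i, so it is charged
-- O(1) in each of the O(log n) phases.
--
-- Progress: take an incidence (S, e) where e has degree d among the large sets
-- and at least half of the elements of S in U have degree at most d. At the rate
-- between 1/(8d) and 1/(4d), by Markov's inequality, S is sampled, alone at e,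
-- and alone at half of those elements with probability at least 1/(32d). At
-- least half of the incidences are of this kind, so a constant fraction of all
-- incidences disappears in expectation. The incidences of phase i are weighted
-- by (2m + 1)ⁱ to form a potential of logarithm O(log m · log n); after that many
-- rounds its expectation is below any inverse polynomial, and Markov's
-- inequality shows that U is empty.
module Submission where

open import Defs
open import Data.Bool using (Bool; T; true; false; if_then_else_; not; _∧_; _∨_; _xor_)
open import Data.Fin as Fin using (Fin; zero; suc; toℕ; fromℕ<; combine; remQuot; cast; _↑ˡ_; _↑ʳ_)
open import Data.Fin.Properties as Fin using (remQuot-combine; cast-involutive; toℕ-fromℕ<; toℕ<n)
open import Data.Fin.Subset using (Subset; ⋃; ⊤)
open import Data.Integer as ℤ using () renaming (+_ to pos)
import Data.Integer.Properties as ℤ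
open import Data.List using (List; []; _∷_; _++_; map; length; filter; filterᵇ; foldl; allFin; deduplicate; mapMaybe; cartesianProductWith)
import Data.List.Properties as List
open import Data.List.Membership.Propositional using (_∈_)
import Data.List.Membership.Propositional.Properties as ∈
import Data.List.Relation.Unary.All as All
open import Data.List.Relation.Unary.Any using (here; there)
open import Data.List.Relation.Unary.Unique.DecPropositional.Properties using (deduplicate-!)
open import Data.List.Relation.Unary.Unique.Propositional using (Unique; []; _∷_)
import Data.List.Relation.Unary.Unique.Propositional.Properties as Unique
open import Data.Maybe using (Maybe; just; nothing; _<∣>_; is-nothing)
open import Data.Maybe.Properties using (just-injective)
open import Data.Nat hiding (_≡ᵇ_)
open import Data.Nat.DivMod using (_%_; _mod_; m%n%n≡m%n; [m+kn]%n≡m%n; m<n⇒m%n≡m; %-distribˡ-+)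
open import Data.Nat.GeneralisedArithmetic using (fold)
open import Data.Nat.Induction using (<-rec)
open import Data.Nat.Logarithm using (⌈log₂_⌉; ⌈log₂⌉-mono-≤; ⌈log₂⌈n/2⌉⌉≡⌈log₂n⌉∸1)
open import Data.Nat.Properties hiding (_≟_)
open import Data.Nat.Tactic.RingSolver using (solve-∀)
open import Data.Product using (_×_; _,_; proj₁; proj₂; ∃-syntax; Σ-syntax)
open import Data.Sign as Sign using (Sign)
open import Data.Sum as Sum using (_⊎_; inj₁; inj₂)
open import Data.Vec as Vec using (Vec; []; _∷_; lookup; tabulate; head; tail)
open import Data.Vec.Properties using (lookup-zipWith; lookup-replicate; lookup∘tabulate; tabulate-cong; tabulate∘lookup; lookup-map)
open import Function using (_∘_; id)
open import Relation.Binary.PropositionalEquality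
open import Relation.Nullary using (¬_; Dec; yes; no; does; contradiction; ¬?)
open import Relation.Nullary.Decidable using (_⊎-dec_)

-- Sums over lists

-- A chosen set may take n bits to write down, so n of them do not fit in memory. An element
-- therefore keeps only a hashed identifier, and a set counts as chosen if its identifier is carried
-- by some element. The price is that identifiers have to be injective on the collection, which a
-- union bound over pairs provides.
--
-- The length of a phase is random. All thresholds 2ⁱ are counted in parallel, so the phase is read
-- off from the counters of the pass that uses it. Instead of controlling each phase by
-- concentration, the weights (2m + 1)ⁱ let the current phase outweigh all lower ones together. The
-- same expected contraction then holds in every round, from every state, and can be iterated.
--
-- The right sampling rate for an element depends on its degree, which is unknown. Since the samples
-- are nested, the densest sample with a unanimous vote names the same identifier as any sparser one
-- in which a single set votes. One owner per element is thus enough, and this makes the followers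
-- of different identifiers disjoint, as the cost bound requires.

⟦_⟧ : Bool → ℕ
⟦ true  ⟧ = 1
⟦ false ⟧ = 0

⟦⟧≤1 : ∀ b → ⟦ b ⟧ ≤ 1
⟦⟧≤1 true  = ≤-refl
⟦⟧≤1 false = z≤n

⟦⟧-∧ : ∀ a b → ⟦ a ∧ b ⟧ ≡ ⟦ a ⟧ * ⟦ b ⟧
⟦⟧-∧ true  b = sym (+-identityʳ ⟦ b ⟧)
⟦⟧-∧ false b = refl

⟦⟧-mono : ∀ {a b} → (a ≡ true → b ≡ true) → ⟦ a ⟧ ≤ ⟦ b ⟧
⟦⟧-mono {false} h = z≤n
⟦⟧-mono {true}  h rewrite h refl = ≤-refl

∧-trueˡ : ∀ {a b} → a ∧ b ≡ true → a ≡ true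
∧-trueˡ {true} _ = refl

∧-trueʳ : ∀ {a b} → a ∧ b ≡ true → b ≡ true
∧-trueʳ {true} h = h

∧-true : ∀ {a b} → a ≡ true → b ≡ true → a ∧ b ≡ true
∧-true refl refl = refl

∑ : {A : Set} → List A → (A → ℕ) → ℕ
∑ []       f = 0
∑ (x ∷ xs) f = f x + ∑ xs f

module _ {A : Set} where

  ∑-cong : ∀ (xs : List A) {f g} → (∀ x → f x ≡ g x) → ∑ xs f ≡ ∑ xs g
  ∑-cong []       h = refl
  ∑-cong (x ∷ xs) h = cong₂ _+_ (h x) (∑-cong xs h)

  ∑-mono-∈ : ∀ (xs : List A) {f g} → (∀ x → x ∈ xs → f x ≤ g x) → ∑ xs f ≤ ∑ xs g
  ∑-mono-∈ []       h = z≤n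
  ∑-mono-∈ (x ∷ xs) h = +-mono-≤ (h x (here refl)) (∑-mono-∈ xs λ y → h y ∘ there)

  ∑-mono : ∀ (xs : List A) {f g} → (∀ x → f x ≤ g x) → ∑ xs f ≤ ∑ xs g
  ∑-mono xs h = ∑-mono-∈ xs λ x _ → h x

  ∑-+ : ∀ (xs : List A) f g → ∑ xs (λ x → f x + g x) ≡ ∑ xs f + ∑ xs g
  ∑-+ []       f g = refl
  ∑-+ (x ∷ xs) f g rewrite ∑-+ xs f g = interchange (f x) (g x) (∑ xs f) (∑ xs g)
    where
    interchange : ∀ a b c d → a + b + (c + d) ≡ a + c + (b + d)
    interchange = solve-∀

  ∑-* : ∀ (xs : List A) k f → ∑ xs (λ x → k * f x) ≡ k * ∑ xs f
  ∑-* []       k f = sym (*-zeroʳ k)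
  ∑-* (x ∷ xs) k f rewrite ∑-* xs k f = sym (*-distribˡ-+ k (f x) (∑ xs f))

  ∑-const : ∀ (xs : List A) k → ∑ xs (λ _ → k) ≡ length xs * k
  ∑-const []       k = refl
  ∑-const (x ∷ xs) k = cong (k +_) (∑-const xs k)

  ∑-++ : ∀ (xs ys : List A) f → ∑ (xs ++ ys) f ≡ ∑ xs f + ∑ ys f
  ∑-++ []       ys f = refl
  ∑-++ (x ∷ xs) ys f rewrite ∑-++ xs ys f = sym (+-assoc (f x) (∑ xs f) (∑ ys f))

  ∑-∈ : ∀ {xs : List A} {x} f → x ∈ xs → f x ≤ ∑ xs f
  ∑-∈ f (here refl) = m≤m+n _ _
  ∑-∈ f (there x∈)  = ≤-trans (∑-∈ f x∈) (m≤n+m _ _)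

  ∑≡0⇒ : ∀ {xs : List A} {x} f → ∑ xs f ≡ 0 → x ∈ xs → f x ≡ 0
  ∑≡0⇒ f h x∈ = n≤0⇒n≡0 (subst (_ ≤_) h (∑-∈ f x∈))

  ∑-zero : ∀ (xs : List A) {f} → (∀ x → x ∈ xs → f x ≡ 0) → ∑ xs f ≡ 0
  ∑-zero []       h = refl
  ∑-zero (x ∷ xs) h rewrite h x (here refl) = ∑-zero xs λ y → h y ∘ there

  ∑>0⇒ : ∀ (xs : List A) f → 0 < ∑ xs f → ∃[ x ] x ∈ xs × 0 < f x
  ∑>0⇒ (x ∷ xs) f h with f x in eq
  ... | suc k = x , here refl , subst (0 <_) (sym eq) z<s
  ... | zero  = let y , y∈ , p = ∑>0⇒ xs f h in y , there y∈ , p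

  length-filterᵇ : ∀ p (xs : List A) → length (filterᵇ p xs) ≡ ∑ xs (⟦_⟧ ∘ p)
  length-filterᵇ p []       = refl
  length-filterᵇ p (x ∷ xs) with p x
  ... | true  = cong suc (length-filterᵇ p xs)
  ... | false = length-filterᵇ p xs

  ∑-filterᵇ : ∀ p (xs : List A) f → ∑ (filterᵇ p xs) f ≡ ∑ xs (λ x → ⟦ p x ⟧ * f x)
  ∑-filterᵇ p []       f = refl
  ∑-filterᵇ p (x ∷ xs) f with p x
  ... | true  = cong₂ _+_ (sym (+-identityʳ (f x))) (∑-filterᵇ p xs f)
  ... | false = ∑-filterᵇ p xs f

  ∈-filterᵇ⁺ : ∀ p {x} {xs : List A} → x ∈ xs → p x ≡ true → x ∈ filterᵇ p xs
  ∈-filterᵇ⁺ p {x} {y ∷ xs} (here refl) h rewrite h = here refl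
  ∈-filterᵇ⁺ p {x} {y ∷ xs} (there x∈)  h with p y
  ... | true  = there (∈-filterᵇ⁺ p x∈ h)
  ... | false = ∈-filterᵇ⁺ p x∈ h

  ∈-filterᵇ⁻ : ∀ p {x} (xs : List A) → x ∈ filterᵇ p xs → x ∈ xs × p x ≡ true
  ∈-filterᵇ⁻ p (y ∷ xs) x∈ with p y in eq
  ∈-filterᵇ⁻ p (y ∷ xs) (here refl) | true = here refl , eq
  ∈-filterᵇ⁻ p (y ∷ xs) (there x∈)  | true = let a , b = ∈-filterᵇ⁻ p xs x∈ in there a , b
  ∈-filterᵇ⁻ p (y ∷ xs) x∈ | false = let a , b = ∈-filterᵇ⁻ p xs x∈ in there a , b

module _ {A B : Set} where

  ∑-swap : ∀ (xs : List A) (ys : List B) (f : A → B → ℕ) →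
           ∑ xs (λ x → ∑ ys (f x)) ≡ ∑ ys (λ y → ∑ xs (λ x → f x y))
  ∑-swap []       ys f = sym (trans (∑-const ys 0) (*-zeroʳ (length ys)))
  ∑-swap (x ∷ xs) ys f = trans (cong (∑ ys (f x) +_) (∑-swap xs ys f))
                               (sym (∑-+ ys (f x) (λ y → ∑ xs (λ x → f x y))))

  ∑-map : ∀ (g : A → B) xs f → ∑ (map g xs) f ≡ ∑ xs (f ∘ g)
  ∑-map g []       f = refl
  ∑-map g (x ∷ xs) f = cong (f (g x) +_) (∑-map g xs f)

∑-cartesian : ∀ {A B C : Set} (g : A → B → C) xs ys f →
              ∑ (cartesianProductWith g xs ys) f ≡ ∑ xs (λ x → ∑ ys (λ y → f (g x y)))
∑-cartesian g []       ys f = refl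
∑-cartesian g (x ∷ xs) ys f =
  trans (∑-++ (map (g x) ys) _ f) (cong₂ _+_ (∑-map (g x) ys f) (∑-cartesian g xs ys f))

-- The probability space of n independent uniform draws. Probabilities and expectations appear
-- throughout as sums over such lists, with denominators multiplied out.
vecs : ∀ {A : Set} → List A → ∀ n → List (Vec A n)
vecs xs zero    = [] ∷ []
vecs xs (suc n) = cartesianProductWith _∷_ xs (vecs xs n)

∑-vecs : ∀ {A : Set} (xs : List A) n f →
         ∑ (vecs xs (suc n)) f ≡ ∑ xs (λ x → ∑ (vecs xs n) (λ v → f (x ∷ v)))
∑-vecs xs n = ∑-cartesian _∷_ xs (vecs xs n)

-- Independence of the first draw from the remaining ones, in unnormalised form.
∑-vecs-* : ∀ {A : Set} (xs : List A) n f g →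
           ∑ (vecs xs (suc n)) (λ v → f (head v) * g (tail v)) ≡ ∑ xs f * ∑ (vecs xs n) g
∑-vecs-* xs n f g = trans (∑-vecs xs n _)
  (trans (∑-cong xs λ x → trans (∑-* (vecs xs n) (f x) g) (*-comm (f x) (∑ (vecs xs n) g)))
  (trans (∑-* xs (∑ (vecs xs n) g) f) (*-comm (∑ (vecs xs n) g) (∑ xs f))))

length-∑ : ∀ {A : Set} (xs : List A) → length xs ≡ ∑ xs (λ _ → 1)
length-∑ xs = sym (trans (∑-const xs 1) (*-identityʳ (length xs)))

length-vecs : ∀ {A : Set} (xs : List A) n → length (vecs xs n) ≡ length xs ^ n
length-vecs xs zero    = refl
length-vecs xs (suc n) = begin
  length (vecs xs (suc n))                          ≡⟨ length-∑ (vecs xs (suc n)) ⟩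
  ∑ (vecs xs (suc n)) (λ _ → 1)                     ≡⟨ ∑-vecs-* xs n (λ _ → 1) (λ _ → 1) ⟩
  ∑ xs (λ _ → 1) * ∑ (vecs xs n) (λ _ → 1)          ≡⟨ cong₂ _*_ (length-∑ xs) (length-∑ (vecs xs n)) ⟨
  length xs * length (vecs xs n)                    ≡⟨ cong (length xs *_) (length-vecs xs n) ⟩
  length xs * length xs ^ n                         ∎
  where open ≡-Reasoning

-- Pairwise independent hashing

bools : List Bool
bools = true ∷ false ∷ []

_==_ : Bool → Bool → Bool
a == b = not (a xor b)

==-refl : ∀ a → a == a ≡ true
==-refl true  = refl
==-refl false = refl

dot : ∀ {n} → Vec Bool n → Subset n → Bool
dot []       []      = false
dot (r ∷ rs) (s ∷ S) = (r ∧ s) xor dot rs S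

-- If S and T differ in their first element, then for every choice of the
-- remaining coordinates exactly one value of the first one is a collision.
dot-collision : ∀ {n} {S T : Subset n} → S ≢ T →
                2 * ∑ (vecs bools n) (λ r → ⟦ dot r S == dot r T ⟧) ≡ 2 ^ n
dot-collision {zero}  {[]}    {[]}    S≢T = contradiction refl S≢T
dot-collision {suc n} {s ∷ S} {t ∷ T} S≢T = cong (2 *_) (trans (∑-vecs bools n _) (main s t S≢T))
  where
  V = vecs bools n
  f : Bool → Bool → Bool → Vec Bool n → ℕ
  f s t r v = ⟦ ((r ∧ s) xor dot v S) == ((r ∧ t) xor dot v T) ⟧
  |V| : ∑ V (λ _ → 1) ≡ 2 ^ n
  |V| = trans (sym (length-∑ V)) (length-vecs bools n)
  not-not : ∀ a b → ⟦ not a == not b ⟧ ≡ ⟦ a == b ⟧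
  not-not true  true  = refl
  not-not true  false = refl
  not-not false true  = refl
  not-not false false = refl
  one-of : ∀ a b → ⟦ not a == b ⟧ + ⟦ a == b ⟧ ≡ 1
  one-of true  true  = refl
  one-of true  false = refl
  one-of false true  = refl
  one-of false false = refl
  one-of′ : ∀ a b → ⟦ a == not b ⟧ + ⟦ a == b ⟧ ≡ 1
  one-of′ true  true  = refl
  one-of′ true  false = refl
  one-of′ false true  = refl
  one-of′ false false = refl
  exactly-one : ∀ g h → (∀ v → g v + h v ≡ 1) → ∑ V g + (∑ V h + 0) ≡ 2 ^ n
  exactly-one g h eq = trans (cong (∑ V g +_) (+-identityʳ (∑ V h)))
    (trans (sym (∑-+ V g h)) (trans (∑-cong V eq) |V|))
  main : ∀ s t → s ∷ S ≢ t ∷ T → ∑ V (f s t true) + (∑ V (f s t false) + 0) ≡ 2 ^ n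
  main true  true  ne = trans (cong (_+ (∑ V (f true true false) + 0)) (∑-cong V λ v → not-not (dot v S) (dot v T)))
                              (dot-collision (ne ∘ cong (true ∷_)))
  main false false ne = dot-collision (ne ∘ cong (false ∷_))
  main true  false ne = exactly-one (f true false true) (f true false false) λ v → one-of (dot v S) (dot v T)
  main false true  ne = exactly-one (f false true true) (f false true false) λ v → one-of′ (dot v S) (dot v T)

ident : ∀ {n b} → Vec (Vec Bool n) b → Subset n → Vec Bool b
ident ρ S = Vec.map (λ r → dot r S) ρ

-- Equality of identifiers in the form of a conjunction over the rows, because the count in
-- `ident-collision` factors along it.
sameIdent : ∀ {n b} → Subset n → Subset n → Vec (Vec Bool n) b → Bool
sameIdent S T []      = true
sameIdent S T (r ∷ ρ) = (dot r S == dot r T) ∧ sameIdent S T ρ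

ident-≡⇒sameIdent : ∀ {n b} {S T : Subset n} (ρ : Vec (Vec Bool n) b) →
                    ident ρ S ≡ ident ρ T → sameIdent S T ρ ≡ true
ident-≡⇒sameIdent         []      _  = refl
ident-≡⇒sameIdent {T = T} (r ∷ ρ) eq =
  ∧-true (trans (cong (_== dot r T) (cong head eq)) (==-refl (dot r T)))
         (ident-≡⇒sameIdent ρ (cong tail eq))

-- The rows are independent, and each of them fails to separate `S` from `T` with probability
-- exactly 1/2.
ident-collision : ∀ {n} b {S T : Subset n} → S ≢ T →
  2 ^ b * ∑ (vecs (vecs bools n) b) (λ ρ → ⟦ sameIdent S T ρ ⟧) ≡ (2 ^ n) ^ b
ident-collision zero              S≢T = refl
ident-collision {n} (suc b) {S} {T} S≢T = begin
  2 * 2 ^ b * ∑ (vecs V (suc b)) (λ ρ → ⟦ sameIdent S T ρ ⟧)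
    ≡⟨ cong (2 * 2 ^ b *_) (trans (∑-vecs V b _) (trans
         (∑-cong V λ r → ∑-cong (vecs V b) λ ρ → ⟦⟧-∧ (dot r S == dot r T) (sameIdent S T ρ))
         (sym (∑-vecs V b _)))) ⟩
  2 * 2 ^ b * ∑ (vecs V (suc b)) (λ ρ → one (head ρ) * rest (tail ρ))
    ≡⟨ cong (2 * 2 ^ b *_) (∑-vecs-* V b one rest) ⟩
  2 * 2 ^ b * (∑ V one * ∑ (vecs V b) rest)
    ≡⟨ regroup (2 ^ b) (∑ V one) (∑ (vecs V b) rest) ⟩
  2 * ∑ V one * (2 ^ b * ∑ (vecs V b) rest)
    ≡⟨ cong₂ _*_ (dot-collision S≢T) (ident-collision b S≢T) ⟩
  2 ^ n * (2 ^ n) ^ b ∎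
  where
  open ≡-Reasoning
  V = vecs bools n
  one : Vec Bool n → ℕ
  one r = ⟦ dot r S == dot r T ⟧
  rest : Vec (Vec Bool n) b → ℕ
  rest ρ = ⟦ sameIdent S T ρ ⟧
  regroup : ∀ x y z → 2 * x * (y * z) ≡ 2 * y * (x * z)
  regroup = solve-∀

-- A row is a random affine form over the field with two elements. The constant term `c` gives every
-- set, even the empty one, probability exactly 1/2, and turns the collision count of `dot` into
-- independence of pairs.
vanishes : ∀ {n} → Subset n → Vec Bool (suc n) → Bool
vanishes S (c ∷ r) = c == dot r S

rows : ∀ n → List (Vec Bool (suc n))
rows n = vecs bools (suc n)

∑-vanishes : ∀ {n} (S : Subset n) → 2 * ∑ (rows n) (λ r → ⟦ vanishes S r ⟧) ≡ 2 ^ suc n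
∑-vanishes {n} S = cong (2 *_) (begin
  ∑ (rows n) (λ r → ⟦ vanishes S r ⟧)                            ≡⟨ ∑-vecs bools n _ ⟩
  ∑ bools (λ c → ∑ V (λ r → ⟦ c == dot r S ⟧))                   ≡⟨ ∑-swap bools V (λ c r → ⟦ c == dot r S ⟧) ⟩
  ∑ V (λ r → ∑ bools (λ c → ⟦ c == dot r S ⟧))                   ≡⟨ ∑-cong V (λ r → one (dot r S)) ⟩
  ∑ V (λ _ → 1)                                                  ≡⟨ length-∑ V ⟨
  length V                                                       ≡⟨ length-vecs bools n ⟩
  2 ^ n                                                          ∎)
  where
  open ≡-Reasoning
  V = vecs bools n
  one : ∀ d → ∑ bools (λ c → ⟦ c == d ⟧) ≡ 1
  one true  = refl
  one false = refl

-- Both sets vanish only if the linear part does not separate them, and then for one of the two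
-- values of `c`: 1/2 · 1/2.
∑-vanishes₂ : ∀ {n} {S T : Subset n} → S ≢ T →
              4 * ∑ (rows n) (λ r → ⟦ vanishes S r ∧ vanishes T r ⟧) ≡ 2 ^ suc n
∑-vanishes₂ {n} {S} {T} S≢T = begin
  4 * ∑ (rows n) (λ r → ⟦ vanishes S r ∧ vanishes T r ⟧)
    ≡⟨ cong (4 *_) (trans (∑-vecs bools n _) (∑-swap bools V (λ c r → ⟦ (c == dot r S) ∧ (c == dot r T) ⟧))) ⟩
  4 * ∑ V (λ r → ∑ bools (λ c → ⟦ (c == dot r S) ∧ (c == dot r T) ⟧))
    ≡⟨ cong (4 *_) (∑-cong V λ r → one (dot r S) (dot r T)) ⟩
  4 * ∑ V (λ r → ⟦ dot r S == dot r T ⟧)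
    ≡⟨ *-assoc 2 2 (∑ V (λ r → ⟦ dot r S == dot r T ⟧)) ⟩
  2 * (2 * ∑ V (λ r → ⟦ dot r S == dot r T ⟧))
    ≡⟨ cong (2 *_) (dot-collision S≢T) ⟩
  2 ^ suc n ∎
  where
  open ≡-Reasoning
  V = vecs bools n
  one : ∀ a b → ∑ bools (λ c → ⟦ (c == a) ∧ (c == b) ⟧) ≡ ⟦ a == b ⟧
  one true  true  = refl
  one true  false = refl
  one false true  = refl
  one false false = refl

-- A set survives to level j with probability 2⁻ʲ, and two sets do so
-- independently.
level : ∀ {n J} → Vec (Vec Bool (suc n)) J → Subset n → ℕ → Bool
level σ       S zero    = true
level []      S (suc j) = false
level (r ∷ σ) S (suc j) = vanishes S r ∧ level σ S j

level-antitone : ∀ {n J} (σ : Vec (Vec Bool (suc n)) J) S {i j} → i ≤ j →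
                 level σ S j ≡ true → level σ S i ≡ true
level-antitone σ       S z≤n     h = refl
level-antitone (r ∷ σ) S (s≤s p) h = ∧-true (∧-trueˡ h) (level-antitone σ S p (∧-trueʳ {vanishes S r} h))

seeds : ∀ n J → List (Vec (Vec Bool (suc n)) J)
seeds n = vecs (rows n)

length-seeds : ∀ n J → length (seeds n J) ≡ (2 ^ suc n) ^ J
length-seeds n J = trans (length-vecs (rows n) J) (cong (_^ J) (length-vecs bools (suc n)))

∑-level : ∀ {n} J (S : Subset n) {j} → j ≤ J →
          2 ^ j * ∑ (seeds n J) (λ σ → ⟦ level σ S j ⟧) ≡ length (seeds n J)
∑-level {n} J S z≤n = trans (+-identityʳ _) (sym (length-∑ (seeds n J)))
∑-level {n} (suc J) S {suc j} (s≤s p) = begin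
  2 * 2 ^ j * ∑ (seeds n (suc J)) (λ σ → ⟦ level σ S (suc j) ⟧)
    ≡⟨ cong (2 * 2 ^ j *_) (trans (∑-vecs (rows n) J _) (trans
         (∑-cong (rows n) λ r → ∑-cong (seeds n J) λ σ → ⟦⟧-∧ (vanishes S r) (level σ S j))
         (sym (∑-vecs (rows n) J _)))) ⟩
  2 * 2 ^ j * ∑ (seeds n (suc J)) (λ σ → f (head σ) * g (tail σ))
    ≡⟨ cong (2 * 2 ^ j *_) (∑-vecs-* (rows n) J f g) ⟩
  2 * 2 ^ j * (∑ (rows n) f * ∑ (seeds n J) g)
    ≡⟨ regroup (2 ^ j) (∑ (rows n) f) (∑ (seeds n J) g) ⟩
  2 * ∑ (rows n) f * (2 ^ j * ∑ (seeds n J) g)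
    ≡⟨ cong₂ _*_ (∑-vanishes S) (∑-level J S p) ⟩
  2 ^ suc n * length (seeds n J)
    ≡⟨ cong (2 ^ suc n *_) (length-seeds n J) ⟩
  2 ^ suc n * (2 ^ suc n) ^ J
    ≡⟨ length-seeds n (suc J) ⟨
  length (seeds n (suc J)) ∎
  where
  open ≡-Reasoning
  f : Vec Bool (suc n) → ℕ
  f r = ⟦ vanishes S r ⟧
  g : Vec (Vec Bool (suc n)) J → ℕ
  g σ = ⟦ level σ S j ⟧
  regroup : ∀ x y z → 2 * x * (y * z) ≡ 2 * y * (x * z)
  regroup = solve-∀

∑-level₂ : ∀ {n} J {S T : Subset n} → S ≢ T → ∀ {j} → j ≤ J →
           4 ^ j * ∑ (seeds n J) (λ σ → ⟦ level σ S j ∧ level σ T j ⟧) ≡ length (seeds n J)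
∑-level₂ {n} J S≢T z≤n = trans (+-identityʳ _) (sym (length-∑ (seeds n J)))
∑-level₂ {n} (suc J) {S} {T} S≢T {suc j} (s≤s p) = begin
  4 * 4 ^ j * ∑ (seeds n (suc J)) (λ σ → ⟦ level σ S (suc j) ∧ level σ T (suc j) ⟧)
    ≡⟨ cong (4 * 4 ^ j *_) (trans (∑-vecs (rows n) J _) (trans
         (∑-cong (rows n) λ r → ∑-cong (seeds n J) λ σ →
            trans (cong ⟦_⟧ (∧-interchange (vanishes S r) (level σ S j) (vanishes T r) (level σ T j)))
                  (⟦⟧-∧ (vanishes S r ∧ vanishes T r) (level σ S j ∧ level σ T j)))
         (sym (∑-vecs (rows n) J _)))) ⟩
  4 * 4 ^ j * ∑ (seeds n (suc J)) (λ σ → f (head σ) * g (tail σ))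
    ≡⟨ cong (4 * 4 ^ j *_) (∑-vecs-* (rows n) J f g) ⟩
  4 * 4 ^ j * (∑ (rows n) f * ∑ (seeds n J) g)
    ≡⟨ regroup (4 ^ j) (∑ (rows n) f) (∑ (seeds n J) g) ⟩
  4 * ∑ (rows n) f * (4 ^ j * ∑ (seeds n J) g)
    ≡⟨ cong₂ _*_ (∑-vanishes₂ S≢T) (∑-level₂ J S≢T p) ⟩
  2 ^ suc n * length (seeds n J)
    ≡⟨ cong (2 ^ suc n *_) (length-seeds n J) ⟩
  2 ^ suc n * (2 ^ suc n) ^ J
    ≡⟨ length-seeds n (suc J) ⟨
  length (seeds n (suc J)) ∎
  where
  open ≡-Reasoning
  f : Vec Bool (suc n) → ℕ
  f r = ⟦ vanishes S r ∧ vanishes T r ⟧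
  g : Vec (Vec Bool (suc n)) J → ℕ
  g σ = ⟦ level σ S j ∧ level σ T j ⟧
  regroup : ∀ x y z → 4 * x * (y * z) ≡ 4 * y * (x * z)
  regroup = solve-∀
  ∧-interchange : ∀ a b c d → (a ∧ b) ∧ (c ∧ d) ≡ (a ∧ c) ∧ (b ∧ d)
  ∧-interchange true  true  c d = refl
  ∧-interchange true  false true  d = refl
  ∧-interchange true  false false d = refl
  ∧-interchange false b     c     d = refl

-- Expected progress of a round

isZero : ℕ → Bool
isZero zero    = true
isZero (suc _) = false

T⇒≡ : ∀ {b} → T b → b ≡ true
T⇒≡ {true} _ = refl

≡⇒T : ∀ {b} → b ≡ true → T b
≡⇒T refl = _

≤ᵇ-sound : ∀ {m n} → (m ≤ᵇ n) ≡ true → m ≤ n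
≤ᵇ-sound {m} {n} h = ≤ᵇ⇒≤ m n (≡⇒T h)

≤ᵇ-complete : ∀ {m n} → m ≤ n → (m ≤ᵇ n) ≡ true
≤ᵇ-complete h = T⇒≡ (≤⇒≤ᵇ h)

≤ᵇ-false : ∀ {m n} → (m ≤ᵇ n) ≡ false → n < m
≤ᵇ-false {m} {n} h with m ≤? n
... | no  m≰n = ≰⇒> m≰n
... | yes m≤n = contradiction (trans (sym (≤ᵇ-complete m≤n)) h) λ ()

module _ {A : Set} where

  ∑-at-most-one : ∀ {xs : List A} (p : A → Bool) → Unique xs →
                  (∀ {x y} → x ∈ xs → y ∈ xs → p x ≡ true → p y ≡ true → x ≡ y) →
                  ∑ xs (⟦_⟧ ∘ p) ≤ 1
  ∑-at-most-one {[]}     p []       h = z≤n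
  ∑-at-most-one {x ∷ xs} p (u ∷ us) h with p x in px
  ... | false = ∑-at-most-one p us λ a b → h (there a) (there b)
  ... | true  = s≤s (≤-reflexive (∑-zero xs none))
    where
    none : ∀ y → y ∈ xs → ⟦ p y ⟧ ≡ 0
    none y y∈ with p y in py
    ... | false = refl
    ... | true  = contradiction (h (here refl) (there y∈) px py) (All.lookup u y∈)

  maximal : ∀ (xs : List A) (p : A → Bool) (d : A → ℕ) →
            (∀ y → y ∈ xs → p y ≡ false) ⊎
            (∃[ x ] p x ≡ true × (∀ y → y ∈ xs → p y ≡ true → d y ≤ d x))
  maximal [] p d = inj₁ λ _ ()
  maximal (x ∷ xs) p d with p x in px | maximal xs p d
  ... | false | inj₁ none = inj₁ λ { y (here refl) → px ; y (there y∈) → none y y∈ }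
  ... | false | inj₂ (m , pm , mx) = inj₂ (m , pm , λ
    { y (here refl) py → contradiction (trans (sym py) px) λ () ; y (there y∈) py → mx y y∈ py })
  ... | true  | inj₁ none = inj₂ (x , px , λ
    { y (here refl) py → ≤-refl ; y (there y∈) py → contradiction (trans (sym py) (none y y∈)) λ () })
  ... | true  | inj₂ (m , pm , mx) with ≤-total (d x) (d m)
  ...   | inj₁ dx≤dm = inj₂ (m , pm , λ { y (here refl) py → dx≤dm ; y (there y∈) py → mx y y∈ py })
  ...   | inj₂ dm≤dx = inj₂ (x , px , λ { y (here refl) py → ≤-refl ; y (there y∈) py → ≤-trans (mx y y∈ py) dm≤dx })

  -- The members of xs of smaller weight than a bad one are less than half of
  -- xs; taking the heaviest bad one, these include all bad ones.
  half-above-median : ∀ (xs : List A) (p : A → Bool) (d : A → ℕ) →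
    let size = ∑ xs (⟦_⟧ ∘ p)
        low e f = p f ∧ (d f ≤ᵇ d e)
        good e  = size ≤ᵇ 2 * ∑ xs (⟦_⟧ ∘ low e)
    in size ≤ 2 * ∑ xs (λ e → ⟦ p e ∧ good e ⟧)
  half-above-median xs p d = +-cancelˡ-≤ size size _ (begin
    size + size                    ≡⟨ cong (size +_) split ⟩
    size + (∑ xs (λ e → ⟦ p e ∧ good e ⟧) + ∑ xs (⟦_⟧ ∘ bad))
      ≡⟨ cong (_+ (∑ xs (λ e → ⟦ p e ∧ good e ⟧) + ∑ xs (⟦_⟧ ∘ bad))) split ⟩
    (g + b) + (g + b)              ≡⟨ regroup g b ⟩
    2 * b + 2 * g                  ≤⟨ +-monoˡ-≤ (2 * g) few-bad ⟩
    size + 2 * g                   ∎)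
    where
    open ≤-Reasoning
    size = ∑ xs (⟦_⟧ ∘ p)
    low : A → A → Bool
    low e f = p f ∧ (d f ≤ᵇ d e)
    good bad : A → Bool
    good e  = size ≤ᵇ 2 * ∑ xs (⟦_⟧ ∘ low e)
    bad e   = p e ∧ not (good e)
    g = ∑ xs (λ e → ⟦ p e ∧ good e ⟧)
    b = ∑ xs (⟦_⟧ ∘ bad)
    regroup : ∀ g b → (g + b) + (g + b) ≡ 2 * b + 2 * g
    regroup = solve-∀
    cases : ∀ a c → ⟦ a ⟧ ≡ ⟦ a ∧ c ⟧ + ⟦ a ∧ not c ⟧
    cases true  true  = refl
    cases true  false = refl
    cases false c     = refl
    split : size ≡ g + b
    split = trans (∑-cong xs λ e → cases (p e) (good e)) (∑-+ xs _ _)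
    few-bad : 2 * b ≤ size
    few-bad with maximal xs bad d
    ... | inj₁ none = subst (λ z → 2 * z ≤ size) (sym (∑-zero xs λ y y∈ → cong ⟦_⟧ (none y y∈))) z≤n
    ... | inj₂ (m , bm , mx) = begin
      2 * b                        ≤⟨ *-monoʳ-≤ 2 (∑-mono-∈ xs λ y y∈ → ⟦⟧-mono λ by → ∧-true (∧-trueˡ by) (≤ᵇ-complete (mx y y∈ by))) ⟩
      2 * ∑ xs (⟦_⟧ ∘ low m)       ≤⟨ <⇒≤ (≤ᵇ-false (not-true (∧-trueʳ {p m} bm))) ⟩
      size                         ∎
      where
      not-true : ∀ {a} → not a ≡ true → a ≡ false
      not-true {false} _ = refl

power-between : ∀ d → 1 ≤ d → ∃[ j ] d ≤ 2 ^ j × 2 ^ j ≤ 2 * d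
power-between (suc zero)        _ = 0 , ≤-refl , s≤s z≤n
power-between (suc d@(suc _))   _ with power-between d (s≤s z≤n)
... | j , lo , hi with suc d ≤? 2 ^ j
...   | yes lo′ = j , lo′ , ≤-trans hi (*-monoʳ-≤ 2 (n≤1+n d))
...   | no  lo′ = suc j , ≤-trans (+-mono-≤ (≤-trans (s≤s z≤n) lo) lo) (≤-reflexive (cong (2 ^ j +_) (sym (+-identityʳ _))))
                        , *-monoʳ-≤ 2 (<⇒≤ (≰⇒> lo′))

module Survivors {A : Set} (xs : List A) where

  -- Either e is hit by a competitor, or at least half of the low elements are,
  -- or the set is alone on more than half of them and wins.
  survive-or-hit : ∀ (l : Bool) (inc low : A → Bool) (h : A → ℕ) (τ : ℕ) (e : A) →
    (∀ f → low f ≡ true → inc f ≡ true) → inc e ≡ true → τ ≤ 2 * ∑ xs (⟦_⟧ ∘ low) →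
    let al f = l ∧ (inc f ∧ isZero (h f)) in
    ∑ xs (⟦_⟧ ∘ low) * ⟦ l ⟧ ≤
    ∑ xs (⟦_⟧ ∘ low) * ⟦ al e ∧ (τ ≤ᵇ 4 * ∑ xs (⟦_⟧ ∘ al)) ⟧ +
    (∑ xs (⟦_⟧ ∘ low) * (⟦ l ⟧ * h e) + 2 * ∑ xs (λ f → ⟦ low f ⟧ * (⟦ l ⟧ * h f)))
  survive-or-hit false inc low h τ e low⊆ inc-e τ≤ = ≤-trans (≤-reflexive (*-zeroʳ (∑ xs (⟦_⟧ ∘ low)))) z≤n
  survive-or-hit true  inc low h τ e low⊆ inc-e τ≤ = cases (h e) refl
    where
    open ≤-Reasoning
    ℓ = ∑ xs (⟦_⟧ ∘ low)
    alone : A → Bool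
    alone f = inc f ∧ isZero (h f)
    a = ∑ xs (⟦_⟧ ∘ alone)
    win = τ ≤ᵇ 4 * a
    H = ∑ xs (λ f → ⟦ low f ⟧ * (1 * h f))
    pointwise : ∀ f → ⟦ low f ⟧ ≤ ⟦ alone f ⟧ + ⟦ low f ⟧ * (1 * h f)
    pointwise f with low f in low-f
    ... | false = z≤n
    ... | true rewrite low⊆ f low-f with h f
    ...   | zero  = ≤-refl
    ...   | suc _ = s≤s z≤n
    -- A low element that is not alone contributes at least one hit to `H`. This is Markov's
    -- inequality before expectations are taken.
    ℓ≤ : ℓ ≤ a + H
    ℓ≤ = ≤-trans (∑-mono xs pointwise) (≤-reflexive (∑-+ xs (⟦_⟧ ∘ alone) _))
    few : win ≡ false → 2 * a ≤ ℓ
    few lost = *-cancelˡ-≤ {2 * a} {ℓ} 2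
      (≤-trans (≤-reflexive (sym (*-assoc 2 2 a))) (≤-trans (<⇒≤ (≤ᵇ-false lost)) τ≤))
    mostly-hit : win ≡ false → ℓ ≤ 2 * H
    mostly-hit lost = +-cancelˡ-≤ ℓ ℓ (2 * H) (begin
      ℓ + ℓ          ≡⟨ cong (ℓ +_) (sym (+-identityʳ ℓ)) ⟩
      2 * ℓ          ≤⟨ *-monoʳ-≤ 2 ℓ≤ ⟩
      2 * (a + H)    ≡⟨ *-distribˡ-+ 2 a H ⟩
      2 * a + 2 * H  ≤⟨ +-monoˡ-≤ (2 * H) (few lost) ⟩
      ℓ + 2 * H      ∎)
    cases′ : ∀ b → win ≡ b → h e ≡ 0 → ℓ ≤ ℓ * ⟦ alone e ∧ win ⟧ + 2 * H
    cases′ true  won  he≡0 = ≤-trans (≤-reflexive (trans (sym (*-identityʳ ℓ))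
      (cong (λ c → ℓ * ⟦ c ⟧) (sym (∧-true {alone e} (∧-true inc-e (cong isZero he≡0)) won)))))
      (m≤m+n (ℓ * ⟦ alone e ∧ win ⟧) (2 * H))
    cases′ false lost _    = ≤-trans (mostly-hit lost) (m≤n+m (2 * H) (ℓ * ⟦ alone e ∧ win ⟧))
    cases : ∀ k → h e ≡ k → ℓ * 1 ≤ ℓ * ⟦ alone e ∧ win ⟧ + (ℓ * (1 * h e) + 2 * H)
    cases zero    eq = begin
      ℓ * 1                                               ≡⟨ *-identityʳ ℓ ⟩
      ℓ                                                   ≤⟨ cases′ win refl eq ⟩
      ℓ * ⟦ alone e ∧ win ⟧ + 2 * H
        ≤⟨ +-monoʳ-≤ (ℓ * ⟦ alone e ∧ win ⟧) (m≤n+m (2 * H) (ℓ * (1 * h e))) ⟩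
      ℓ * ⟦ alone e ∧ win ⟧ + (ℓ * (1 * h e) + 2 * H) ∎
    cases (suc k) eq = begin
      ℓ * 1                  ≤⟨ *-monoʳ-≤ ℓ (subst (λ z → 1 ≤ 1 * z) (sym eq) (s≤s z≤n)) ⟩
      ℓ * (1 * h e)          ≤⟨ m≤m+n (ℓ * (1 * h e)) (2 * H) ⟩
      ℓ * (1 * h e) + 2 * H  ≤⟨ m≤n+m (ℓ * (1 * h e) + 2 * H) (ℓ * ⟦ alone e ∧ win ⟧) ⟩
      ℓ * ⟦ alone e ∧ win ⟧ + (ℓ * (1 * h e) + 2 * H) ∎

distinct : ∀ {n} → Subset n → Subset n → Bool
distinct S T = not (does (S ≟ₛ T))

distinct-≢ : ∀ {n} {S T : Subset n} → S ≢ T → distinct S T ≡ true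
distinct-≢ {S = S} {T} S≢T with S ≟ₛ T
... | yes S≡T = contradiction S≡T S≢T
... | no  _   = refl

distinct-≡ : ∀ {n} {S T : Subset n} → S ≡ T → distinct S T ≡ false
distinct-≡ {S = S} {T} S≡T with S ≟ₛ T
... | yes _   = refl
... | no  S≢T = contradiction S≡T S≢T

-- Probability of progress, separated from marks and counters. It is applied to the large sets of
-- the current phase, their incidences with uncovered elements, and τ = 2ⁱ.
module Contraction {n : ℕ} (J : ℕ) (F : List (Subset n)) (F! : Unique F)
                   (inc : Subset n → Fin n → Bool) (τ : ℕ) where

  E = allFin n
  Ω = seeds n J
  N = length Ω

  deg : Fin n → ℕ
  deg e = ∑ F λ S → ⟦ inc S e ⟧

  size : Subset n → ℕ
  size S = ∑ E λ e → ⟦ inc S e ⟧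

  competes : Vec (Vec Bool (suc n)) J → Subset n → ℕ → Fin n → Subset n → Bool
  competes σ S j e T = distinct T S ∧ (level σ T j ∧ inc T e)

  hits : Vec (Vec Bool (suc n)) J → Subset n → ℕ → Fin n → ℕ
  hits σ S j e = ∑ F λ T → ⟦ competes σ S j e T ⟧

  alone : Vec (Vec Bool (suc n)) J → Subset n → ℕ → Fin n → Bool
  alone σ S j e = level σ S j ∧ (inc S e ∧ isZero (hits σ S j e))

  wins : Vec (Vec Bool (suc n)) J → Subset n → ℕ → Bool
  wins σ S j = τ ≤ᵇ 4 * ∑ E λ f → ⟦ alone σ S j f ⟧

  alone-unique : ∀ σ j e {S T} → T ∈ F → alone σ S j e ≡ true →
                 level σ T j ≡ true → inc T e ≡ true → T ≡ S
  alone-unique σ j e {S} {T} T∈ aS lT iT with T ≟ₛ S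
  ... | yes T≡S = T≡S
  ... | no  T≢S = contradiction (trans (sym competes-T) (cong is-one (∑≡0⇒ _ (zero-true (∧-trueʳ {inc S e} (∧-trueʳ {level σ S j} aS))) T∈))) λ ()
    where
    zero-true : ∀ {k} → isZero k ≡ true → k ≡ 0
    zero-true {zero} _ = refl
    is-one : ℕ → Bool
    is-one zero    = false
    is-one (suc _) = true
    competes-T : is-one ⟦ competes σ S j e T ⟧ ≡ true
    competes-T = cong (is-one ∘ ⟦_⟧) (∧-true (distinct-≢ T≢S) (∧-true lT iT))

  -- By pairwise independence a competitor through `f` reaches level `j` together with `S` with
  -- probability 4⁻ʲ, and at most `deg f` sets can compete.
  ∑-hits : ∀ S {j} f → j ≤ J → 4 ^ j * ∑ Ω (λ σ → ⟦ level σ S j ⟧ * hits σ S j f) ≤ deg f * N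
  ∑-hits S {j} f j≤J = begin
    4 ^ j * ∑ Ω (λ σ → ⟦ level σ S j ⟧ * hits σ S j f)
      ≡⟨ cong (4 ^ j *_) (∑-cong Ω λ σ → sym (∑-* F ⟦ level σ S j ⟧ _)) ⟩
    4 ^ j * ∑ Ω (λ σ → ∑ F (λ T → g σ T))
      ≡⟨ cong (4 ^ j *_) (∑-swap Ω F g) ⟩
    4 ^ j * ∑ F (λ T → ∑ Ω (λ σ → g σ T))
      ≡⟨ ∑-* F (4 ^ j) _ ⟨
    ∑ F (λ T → 4 ^ j * ∑ Ω (λ σ → g σ T))
      ≤⟨ ∑-mono F bound ⟩
    ∑ F (λ T → N * ⟦ inc T f ⟧)
      ≡⟨ trans (∑-* F N _) (*-comm N (deg f)) ⟩
    deg f * N ∎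
    where
    open ≤-Reasoning
    g : Vec (Vec Bool (suc n)) J → Subset n → ℕ
    g σ T = ⟦ level σ S j ⟧ * ⟦ competes σ S j f T ⟧
    nothing-left : ∀ T → (∀ σ → competes σ S j f T ≡ false) → 4 ^ j * ∑ Ω (λ σ → g σ T) ≤ N * ⟦ inc T f ⟧
    nothing-left T h = ≤-trans (≤-reflexive (trans
      (cong (4 ^ j *_) (∑-zero Ω λ σ _ → trans (cong (λ b → ⟦ level σ S j ⟧ * ⟦ b ⟧) (h σ)) (*-zeroʳ ⟦ level σ S j ⟧)))
      (*-zeroʳ (4 ^ j)))) z≤n
    Goal : Subset n → Bool → Set
    Goal T b = 4 ^ j * ∑ Ω (λ σ → g σ T) ≤ N * ⟦ b ⟧
    ∧-false : ∀ a → a ∧ false ≡ false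
    ∧-false true  = refl
    ∧-false false = refl
    ∧-id : ∀ a → a ∧ true ≡ a
    ∧-id true  = refl
    ∧-id false = refl
    cases : ∀ T b → inc T f ≡ b → Dec (T ≡ S) → Goal T b
    cases T b eq (yes T≡S) = subst (Goal T) eq
      (nothing-left T λ σ → cong (_∧ (level σ T j ∧ inc T f)) (distinct-≡ T≡S))
    cases T false eq (no T≢S) = subst (Goal T) eq (nothing-left T λ σ →
      trans (cong₂ (λ d b → d ∧ (level σ T j ∧ b)) (distinct-≢ T≢S) eq) (∧-false (level σ T j)))
    cases T true eq (no T≢S) = ≤-reflexive (begin-equality
      4 ^ j * ∑ Ω (λ σ → g σ T)
        ≡⟨ cong (4 ^ j *_) (∑-cong Ω λ σ → trans
             (cong (λ b → ⟦ level σ S j ⟧ * ⟦ b ⟧) (trans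
               (cong₂ (λ d b → d ∧ (level σ T j ∧ b)) (distinct-≢ T≢S) eq) (∧-id (level σ T j))))
             (sym (⟦⟧-∧ (level σ S j) (level σ T j)))) ⟩
      4 ^ j * ∑ Ω (λ σ → ⟦ level σ S j ∧ level σ T j ⟧)
        ≡⟨ ∑-level₂ J (T≢S ∘ sym) j≤J ⟩
      N ≡⟨ *-identityʳ N ⟨
      N * 1 ∎)
    bound : ∀ T → Goal T (inc T f)
    bound T = cases T (inc T f) refl (T ≟ₛ S)

  module _ (size≥τ : ∀ {S} → S ∈ F → τ ≤ size S)
           (deg≤ : ∀ e → 8 * deg e ≤ 2 ^ J) where

    low : Fin n → Subset n → Fin n → Bool
    low e S f = inc S f ∧ (deg f ≤ᵇ deg e)

    good : Subset n → Fin n → Bool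
    good S e = size S ≤ᵇ 2 * ∑ E λ f → ⟦ low e S f ⟧

    -- Let p = 2⁻ʲ and d = `deg e`. From the probability p that `S` is sampled, a hit at `e` takes
    -- away at most p²d. Hits on half of the low elements take away at most 2p²d, their degrees
    -- being at most d. As 4pd ≤ 1, at least p - 3p²d ≥ p/4 is left, and p ≥ 1/(8d).
    good-pair : ∀ {S e j} → S ∈ F → inc S e ≡ true → good S e ≡ true →
                j ≤ J → 4 * deg e ≤ 2 ^ j → 2 ^ j ≤ 8 * deg e →
                N ≤ 32 * (deg e * ∑ Ω (λ σ → ⟦ alone σ S j e ∧ wins σ S j ⟧))
    good-pair {S} {e} {j} S∈ inc-e good-e j≤J lo hi = begin
      N                              ≤⟨ *-cancelˡ-≤ (2 ^ j) ⦃ m^n≢0 2 j ⦄ (≤-trans x≤4a (≤-reflexive (trans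
                                          (cong (λ z → 4 * (z * K)) 4^j) (regroup₁ (2 ^ j) K)))) ⟩
      2 ^ j * (4 * K)                ≤⟨ *-monoˡ-≤ (4 * K) hi ⟩
      8 * deg e * (4 * K)            ≡⟨ regroup₂ (deg e) K ⟩
      32 * (deg e * K)               ∎
      where
      open ≤-Reasoning
      K = ∑ Ω (λ σ → ⟦ alone σ S j e ∧ wins σ S j ⟧)
      ℓ = ∑ E (λ f → ⟦ low e S f ⟧)
      y = deg e * N
      regroup₁ : ∀ p k → 4 * (p * p * k) ≡ p * (p * (4 * k))
      regroup₁ = solve-∀
      regroup₂ : ∀ d k → 8 * d * (4 * k) ≡ 32 * (d * k)
      regroup₂ = solve-∀
      4^j : 4 ^ j ≡ 2 ^ j * 2 ^ j
      4^j = trans (^-*-assoc 2 2 j) (trans (cong (2 ^_) (cong (j +_) (+-identityʳ j))) (^-distribˡ-+-* 2 j j))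
      L : Vec (Vec Bool (suc n)) J → ℕ
      L σ = ⟦ level σ S j ⟧
      lH : Fin n → Vec (Vec Bool (suc n)) J → ℕ
      lH f σ = ⟦ level σ S j ⟧ * hits σ S j f
      W : Vec (Vec Bool (suc n)) J → ℕ
      W σ = ⟦ alone σ S j e ∧ wins σ S j ⟧
      τ≤2ℓ : τ ≤ 2 * ℓ
      τ≤2ℓ = ≤-trans (size≥τ S∈) (≤ᵇ-sound good-e)
      pointwise : ∀ σ → ℓ * L σ ≤ ℓ * W σ + (ℓ * lH e σ + 2 * ∑ E (λ f → ⟦ low e S f ⟧ * lH f σ))
      pointwise σ = Survivors.survive-or-hit E (level σ S j) (inc S) (low e S) (hits σ S j) τ e
                      (λ f → ∧-trueˡ) inc-e τ≤2ℓ
      low-hits : ∀ f → ⟦ low e S f ⟧ * (4 ^ j * ∑ Ω (lH f)) ≤ y * ⟦ low e S f ⟧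
      low-hits f with low e S f in low-f
      ... | false = z≤n
      ... | true  = ≤-trans (≤-reflexive (+-identityʳ _)) (≤-trans (∑-hits S f j≤J)
                      (≤-trans (*-monoˡ-≤ N (≤ᵇ-sound {deg f} {deg e} (∧-trueʳ {inc S f} low-f))) (≤-reflexive (sym (*-identityʳ y)))))
      swap-low : ∑ Ω (λ σ → ∑ E (λ f → ⟦ low e S f ⟧ * lH f σ)) ≡ ∑ E (λ f → ⟦ low e S f ⟧ * ∑ Ω (lH f))
      swap-low = trans (∑-swap Ω E (λ σ f → ⟦ low e S f ⟧ * lH f σ)) (∑-cong E λ f → ∑-* Ω ⟦ low e S f ⟧ (lH f))
      summed : ℓ * ∑ Ω L ≤ ℓ * K + (ℓ * ∑ Ω (lH e) + 2 * ∑ E (λ f → ⟦ low e S f ⟧ * ∑ Ω (lH f)))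
      summed = begin
        ℓ * ∑ Ω L               ≡⟨ ∑-* Ω ℓ L ⟨
        ∑ Ω (λ σ → ℓ * L σ)     ≤⟨ ∑-mono Ω pointwise ⟩
        ∑ Ω (λ σ → ℓ * W σ + (ℓ * lH e σ + 2 * ∑ E (λ f → ⟦ low e S f ⟧ * lH f σ)))
          ≡⟨ trans (∑-+ Ω _ _) (cong₂ _+_ (∑-* Ω ℓ W) (trans (∑-+ Ω _ _) (cong₂ _+_ (∑-* Ω ℓ (lH e))
               (trans (∑-* Ω 2 _) (cong (2 *_) swap-low))))) ⟩
        ℓ * K + (ℓ * ∑ Ω (lH e) + 2 * ∑ E (λ f → ⟦ low e S f ⟧ * ∑ Ω (lH f))) ∎
      regroup₃ : ∀ q ℓ k h s → q * (ℓ * k + (ℓ * h + 2 * s)) ≡ ℓ * (q * k) + (ℓ * (q * h) + 2 * (q * s))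
      regroup₃ = solve-∀
      regroup₄ : ∀ ℓ a y → ℓ * a + (ℓ * y + 2 * (y * ℓ)) ≡ ℓ * (a + 3 * y)
      regroup₄ = solve-∀
      a = 4 ^ j * K
      x = 2 ^ j * N
      scaled : ℓ * x ≤ ℓ * (a + 3 * y)
      scaled = begin
        ℓ * x
          ≡⟨ cong (λ z → ℓ * (2 ^ j * z)) (∑-level J S j≤J) ⟨
        ℓ * (2 ^ j * (2 ^ j * ∑ Ω L))
          ≡⟨ cong (ℓ *_) (trans (sym (*-assoc (2 ^ j) (2 ^ j) (∑ Ω L))) (cong (_* ∑ Ω L) (sym 4^j))) ⟩
        ℓ * (4 ^ j * ∑ Ω L)
          ≡⟨ trans (sym (*-assoc ℓ (4 ^ j) _)) (trans (cong (_* ∑ Ω L) (*-comm ℓ (4 ^ j))) (*-assoc (4 ^ j) ℓ _)) ⟩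
        4 ^ j * (ℓ * ∑ Ω L)
          ≤⟨ *-monoʳ-≤ (4 ^ j) summed ⟩
        4 ^ j * (ℓ * K + (ℓ * ∑ Ω (lH e) + 2 * ∑ E (λ f → ⟦ low e S f ⟧ * ∑ Ω (lH f))))
          ≡⟨ regroup₃ (4 ^ j) ℓ K (∑ Ω (lH e)) (∑ E (λ f → ⟦ low e S f ⟧ * ∑ Ω (lH f))) ⟩
        ℓ * a + (ℓ * (4 ^ j * ∑ Ω (lH e)) + 2 * (4 ^ j * ∑ E (λ f → ⟦ low e S f ⟧ * ∑ Ω (lH f))))
          ≤⟨ +-monoʳ-≤ (ℓ * a) (+-mono-≤ (*-monoʳ-≤ ℓ (∑-hits S e j≤J)) (*-monoʳ-≤ 2 low-part)) ⟩
        ℓ * a + (ℓ * y + 2 * (y * ℓ))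
          ≡⟨ regroup₄ ℓ a y ⟩
        ℓ * (a + 3 * y) ∎
        where
        low-part : 4 ^ j * ∑ E (λ f → ⟦ low e S f ⟧ * ∑ Ω (lH f)) ≤ y * ℓ
        low-part = begin
          4 ^ j * ∑ E (λ f → ⟦ low e S f ⟧ * ∑ Ω (lH f))     ≡⟨ ∑-* E (4 ^ j) _ ⟨
          ∑ E (λ f → 4 ^ j * (⟦ low e S f ⟧ * ∑ Ω (lH f)))
            ≡⟨ ∑-cong E (λ f → comm₃ (4 ^ j) ⟦ low e S f ⟧ (∑ Ω (lH f))) ⟩
          ∑ E (λ f → ⟦ low e S f ⟧ * (4 ^ j * ∑ Ω (lH f)))   ≤⟨ ∑-mono E low-hits ⟩
          ∑ E (λ f → y * ⟦ low e S f ⟧)                      ≡⟨ ∑-* E y _ ⟩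
          y * ℓ                                              ∎
          where
          comm₃ : ∀ a b c → a * (b * c) ≡ b * (a * c)
          comm₃ = solve-∀
      -- The element `e` is low relative to itself, so the common factor ℓ can be cancelled.
      ℓ>0 : 0 < ℓ
      ℓ>0 = ≤-trans (≤-reflexive (cong ⟦_⟧ (sym (∧-true {inc S e} inc-e (≤ᵇ-complete (≤-refl {deg e}))))))
                    (∑-∈ (λ f → ⟦ low e S f ⟧) (∈.∈-allFin e))
      x≤ : x ≤ a + 3 * y
      x≤ = *-cancelˡ-≤ ℓ ⦃ >-nonZero ℓ>0 ⦄ scaled
      4y≤x : 4 * y ≤ x
      4y≤x = ≤-trans (≤-reflexive (sym (*-assoc 4 (deg e) N))) (*-monoˡ-≤ N lo)
      x≤4a : x ≤ 4 * a
      x≤4a = +-cancelʳ-≤ (3 * x) x (4 * a) (begin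
        x + 3 * x            ≡⟨⟩
        4 * x                ≤⟨ *-monoʳ-≤ 4 x≤ ⟩
        4 * (a + 3 * y)      ≡⟨ regroup₅ a y ⟩
        4 * a + 3 * (4 * y)  ≤⟨ +-monoʳ-≤ (4 * a) (*-monoʳ-≤ 3 4y≤x) ⟩
        4 * a + 3 * x        ∎)
        where
        regroup₅ : ∀ a y → 4 * (a + 3 * y) ≡ 4 * a + 3 * (4 * y)
        regroup₅ = solve-∀

    -- Rounding 4d up to a power of two at most doubles it. The result is at most 8d ≤ 2ᴶ, so the
    -- wanted level is among those that are sampled.
    levelOf : ∀ d → 8 * d ≤ 2 ^ J → 1 ≤ d → ∃[ j ] j ≤ J × 4 * d ≤ 2 ^ j × 2 ^ j ≤ 8 * d
    levelOf d 8d≤ 1≤d with power-between (4 * d) (≤-trans 1≤d (m≤n*m d 4))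
    ... | j , lo , hi = j , ≮⇒≥ (λ J<j → <⇒≱ (^-monoʳ-< 2 (s≤s (s≤s z≤n)) J<j) (≤-trans hi′ 8d≤)) , lo , hi′
      where hi′ = ≤-trans hi (≤-reflexive (sym (*-assoc 2 4 d)))

    -- The level depends on the element and not on the set. For a fixed seed at most one set can
    -- then be alone at `e` on that level, which `one-removes` exploits. Elements without incidences
    -- get the filler 0.
    levelAt : Fin n → ℕ
    levelAt e with 1 ≤? deg e
    ... | yes d≥1 = proj₁ (levelOf (deg e) (deg≤ e) d≥1)
    ... | no  _   = 0

    removes : Vec (Vec Bool (suc n)) J → Fin n → Subset n → Bool
    removes σ e S = alone σ S (levelAt e) e ∧ wins σ S (levelAt e)

    levelAt≤J : ∀ e → levelAt e ≤ J
    levelAt≤J e with 1 ≤? deg e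
    ... | yes d≥1 = proj₁ (proj₂ (levelOf (deg e) (deg≤ e) d≥1))
    ... | no  _   = z≤n

    levelAt-spec : ∀ e → 1 ≤ deg e → 4 * deg e ≤ 2 ^ levelAt e × 2 ^ levelAt e ≤ 8 * deg e
    levelAt-spec e d≥1′ with 1 ≤? deg e
    ... | yes d≥1 = proj₂ (proj₂ (levelOf (deg e) (deg≤ e) d≥1))
    ... | no  d≱1 = contradiction d≥1′ d≱1

    pair : ∀ S e → S ∈ F → N * ⟦ inc S e ∧ good S e ⟧ ≤ 32 * (deg e * ∑ Ω (λ σ → ⟦ removes σ e S ⟧))
    pair S e S∈ = cases (inc S e) (good S e) refl refl
      where
      cases : ∀ a b → inc S e ≡ a → good S e ≡ b →
              N * ⟦ a ∧ b ⟧ ≤ 32 * (deg e * ∑ Ω (λ σ → ⟦ removes σ e S ⟧))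
      cases false _     _     _      = ≤-trans (≤-reflexive (*-zeroʳ N)) z≤n
      cases true  false _     _      = ≤-trans (≤-reflexive (*-zeroʳ N)) z≤n
      cases true  true  inc-e good-e =
        let d≥1 = ≤-trans (≤-reflexive (cong ⟦_⟧ (sym inc-e))) (∑-∈ (λ T → ⟦ inc T e ⟧) S∈)
            lo , hi = levelAt-spec e d≥1
        in ≤-trans (≤-reflexive (*-identityʳ N)) (good-pair S∈ inc-e good-e (levelAt≤J e) lo hi)

    -- Removing `e` destroys `deg e` incidences, which offsets the probability 1/(32 `deg e`) of a
    -- good pair: each good pair accounts for 1/32 of an incidence in expectation. Half of the pairs
    -- are good, hence 64. Nothing is counted twice, since at most one set removes `e`.
    contraction : (removed : Vec (Vec Bool (suc n)) J → Fin n → Bool) →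
      (∀ σ {S} j e → S ∈ F → j ≤ J → alone σ S j e ≡ true → wins σ S j ≡ true → removed σ e ≡ true) →
      N * ∑ E deg ≤ 64 * ∑ Ω (λ σ → ∑ E (λ e → deg e * ⟦ removed σ e ⟧))
    contraction removed removed-if = begin
      N * ∑ E deg
        ≡⟨ cong (N *_) (∑-swap E F (λ e S → ⟦ inc S e ⟧)) ⟩
      N * ∑ F size
        ≤⟨ *-monoʳ-≤ N (∑-mono F λ S → half-above-median E (inc S) deg) ⟩
      N * ∑ F (λ S → 2 * ∑ E (λ e → ⟦ inc S e ∧ good S e ⟧))
        ≡⟨ trans (cong (N *_) (∑-* F 2 _)) (comm₃ N 2 _) ⟩
      2 * (N * ∑ F (λ S → ∑ E (λ e → ⟦ inc S e ∧ good S e ⟧)))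
        ≡⟨ cong (2 *_) (trans (sym (∑-* F N _)) (∑-cong F λ S → sym (∑-* E N _))) ⟩
      2 * ∑ F (λ S → ∑ E (λ e → N * ⟦ inc S e ∧ good S e ⟧))
        ≤⟨ *-monoʳ-≤ 2 (∑-mono-∈ F λ S S∈ → ∑-mono E λ e → pair S e S∈) ⟩
      2 * ∑ F (λ S → ∑ E (λ e → 32 * (deg e * ∑ Ω (λ σ → ⟦ removes σ e S ⟧))))
        ≡⟨ cong (2 *_) (trans (∑-cong F λ S → ∑-* E 32 _) (∑-* F 32 _)) ⟩
      2 * (32 * ∑ F (λ S → ∑ E (λ e → deg e * ∑ Ω (λ σ → ⟦ removes σ e S ⟧))))
        ≡⟨ *-assoc 2 32 (∑ F (λ S → ∑ E (λ e → deg e * ∑ Ω (λ σ → ⟦ removes σ e S ⟧)))) ⟨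
      64 * ∑ F (λ S → ∑ E (λ e → deg e * ∑ Ω (λ σ → ⟦ removes σ e S ⟧)))
        ≡⟨ cong (64 *_) rearrange ⟩
      64 * ∑ Ω (λ σ → ∑ E (λ e → deg e * ∑ F (λ S → ⟦ removes σ e S ⟧)))
        ≤⟨ *-monoʳ-≤ 64 (∑-mono Ω λ σ → ∑-mono E λ e → *-monoʳ-≤ (deg e) (one-removes σ e)) ⟩
      64 * ∑ Ω (λ σ → ∑ E (λ e → deg e * ⟦ removed σ e ⟧)) ∎
      where
      open ≤-Reasoning
      comm₃ : ∀ a b c → a * (b * c) ≡ b * (a * c)
      comm₃ = solve-∀
      rearrange : ∑ F (λ S → ∑ E (λ e → deg e * ∑ Ω (λ σ → ⟦ removes σ e S ⟧))) ≡
                  ∑ Ω (λ σ → ∑ E (λ e → deg e * ∑ F (λ S → ⟦ removes σ e S ⟧)))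
      rearrange = begin-equality
        ∑ F (λ S → ∑ E (λ e → deg e * ∑ Ω (λ σ → ⟦ removes σ e S ⟧)))
          ≡⟨ ∑-swap F E (λ S e → deg e * ∑ Ω (λ σ → ⟦ removes σ e S ⟧)) ⟩
        ∑ E (λ e → ∑ F (λ S → deg e * ∑ Ω (λ σ → ⟦ removes σ e S ⟧)))
          ≡⟨ ∑-cong E (λ e → trans (∑-* F (deg e) _) (trans
               (cong (deg e *_) (∑-swap F Ω (λ S σ → ⟦ removes σ e S ⟧)))
               (sym (∑-* Ω (deg e) _)))) ⟩
        ∑ E (λ e → ∑ Ω (λ σ → deg e * ∑ F (λ S → ⟦ removes σ e S ⟧)))
          ≡⟨ ∑-swap E Ω (λ e σ → deg e * ∑ F (λ S → ⟦ removes σ e S ⟧)) ⟩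
        ∑ Ω (λ σ → ∑ E (λ e → deg e * ∑ F (λ S → ⟦ removes σ e S ⟧))) ∎
      one-removes : ∀ σ e → ∑ F (λ S → ⟦ removes σ e S ⟧) ≤ ⟦ removed σ e ⟧
      one-removes σ e = cases (removed σ e) refl
        where
        none : removed σ e ≡ false → ∀ S → S ∈ F → ⟦ removes σ e S ⟧ ≡ 0
        none rem S S∈ with removes σ e S in rS
        ... | false = refl
        ... | true  = contradiction (trans (sym (removed-if σ (levelAt e) e S∈ (levelAt≤J e) (∧-trueˡ rS)
                                                   (∧-trueʳ {alone σ S (levelAt e) e} rS))) rem) λ ()
        cases : ∀ b → removed σ e ≡ b → ∑ F (λ S → ⟦ removes σ e S ⟧) ≤ ⟦ b ⟧
        cases true  _   = ∑-at-most-one (removes σ e) F! λ {S} {T} S∈ T∈ rS rT →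
          sym (alone-unique σ (levelAt e) e T∈ (∧-trueˡ rS)
            (∧-trueˡ (∧-trueˡ rT)) (∧-trueˡ (∧-trueʳ {level σ T (levelAt e)} (∧-trueˡ rT))))
        cases false rem = ≤-reflexive (∑-zero F (none rem))

-- Memory contents and linear counters

-- Only a retraction is asked for, since codes such as `maybeᶜ` leave some bit strings idle. The
-- codes of the coins are in addition shown to be `Uniform`.
record Code (A : Set) (b : ℕ) : Set where
  field
    enc     : A → Bits b
    dec     : Bits b → A
    dec-enc : ∀ a → dec (enc a) ≡ a

open Code

bitsᶜ : ∀ {b} → Code (Bits b) b
bitsᶜ = record { enc = id ; dec = id ; dec-enc = λ _ → refl }

boolᶜ : Code Bool 1
boolᶜ .enc false      = zero
boolᶜ .enc true       = suc zero
boolᶜ .dec zero       = false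
boolᶜ .dec (suc zero) = true
boolᶜ .dec-enc false  = refl
boolᶜ .dec-enc true   = refl

maybeᶜ : ∀ {A b} → Code A b → Code (Maybe A) (suc b)
maybeᶜ {A} {b} c = record { enc = e ; dec = d ∘ remQuot {2} (2 ^ b) ; dec-enc = d-e }
  where
  e : Maybe A → Bits (suc b)
  e nothing  = combine {2} zero (fromℕ< (m^n>0 2 b))
  e (just a) = combine {2} (suc zero) (enc c a)
  d : Fin 2 × Bits b → Maybe A
  d (zero  , _) = nothing
  d (suc _ , x) = just (dec c x)
  d-e : ∀ a → d (remQuot {2} (2 ^ b) (e a)) ≡ a
  d-e nothing  = cong d (remQuot-combine {2} zero (fromℕ< (m^n>0 2 b)))
  d-e (just a) = trans (cong d (remQuot-combine {2} (suc zero) (enc c a))) (cong just (dec-enc c a))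

_×ᶜ_ : ∀ {A B a b} → Code A a → Code B b → Code (A × B) (a + b)
_×ᶜ_ {A} {B} {a} {b} c d = record
  { enc     = λ (x , y) → cast (sym 2^a+b) (combine (enc c x) (enc d y))
  ; dec     = λ i → decode (remQuot (2 ^ b) (cast 2^a+b i))
  ; dec-enc = λ (x , y) → trans
      (cong (decode ∘ remQuot (2 ^ b)) (cast-involutive 2^a+b (sym 2^a+b) (combine (enc c x) (enc d y))))
      (trans (cong decode (remQuot-combine (enc c x) (enc d y))) (cong₂ _,_ (dec-enc c x) (dec-enc d y)))
  }
  where
  2^a+b : 2 ^ (a + b) ≡ 2 ^ a * 2 ^ b
  2^a+b = ^-distribˡ-+-* 2 a b
  decode : Bits a × Bits b → A × B
  decode (x , y) = dec c x , dec d y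

vecᶜ : ∀ {A b} → Code A b → ∀ k → Code (Vec A k) (k * b)
vecᶜ c zero    = record { enc = λ _ → zero ; dec = λ _ → [] ; dec-enc = λ { [] → refl } }
vecᶜ c (suc k) = record
  { enc     = λ v → enc cs (head v , tail v)
  ; dec     = λ i → proj₁ (dec cs i) ∷ proj₂ (dec cs i)
  ; dec-enc = λ { (x ∷ v) → cong (λ (y , ys) → y ∷ ys) (dec-enc cs (x , v)) }
  }
  where cs = c ×ᶜ vecᶜ c k

length-filter : ∀ {A : Set} {P : A → Set} (P? : ∀ x → Dec (P x)) xs →
                length (filter P? xs) ≡ ∑ xs (λ x → ⟦ does (P? x) ⟧)
length-filter P? []       = refl
length-filter P? (x ∷ xs) with does (P? x)
... | true  = cong suc (length-filter P? xs)
... | false = length-filter P? xs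

∑-pick : ∀ {n} (T : Subset n) (g : Subset n → ℕ) →
         ∑ (vecs bools n) (λ S → ⟦ does (T ≟ₛ S) ⟧ * g S) ≡ g T
∑-pick []           g = trans (+-identityʳ _) (+-identityʳ _)
∑-pick {suc n} (t ∷ T) g = trans (∑-vecs bools n _) (main t)
  where
  V = vecs bools n
  eq : Bool → Vec Bool n → ℕ
  eq b v = ⟦ does (T ≟ₛ v) ⟧ * g (b ∷ v)
  none : ∑ V (λ v → 0) ≡ 0
  none = ∑-zero V λ _ _ → refl
  main : ∀ t → ∑ bools (λ b → ∑ V (λ v → ⟦ does ((t ∷ T) ≟ₛ (b ∷ v)) ⟧ * g (b ∷ v))) ≡ g (t ∷ T)
  main true  = trans (cong₂ _+_ (∑-pick T (g ∘ (true ∷_))) (cong (_+ 0) none)) (+-identityʳ _)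
  main false = trans (cong₂ _+_ none (cong (_+ 0) (∑-pick T (g ∘ (false ∷_))))) (+-identityʳ _)

-- `Defines` speaks of one set at a time, whereas a counter adds up updates. Grouping the updates by
-- the 2ⁿ possible sets connects the two.
∑-by-set : ∀ {n} {B : Set} (xs : List B) (set : B → Subset n) (φ : Subset n → Bool) (wt : B → ℕ) →
  ∑ xs (λ x → ⟦ φ (set x) ⟧ * wt x) ≡
  ∑ (vecs bools n) (λ S → ⟦ φ S ⟧ * ∑ xs (λ x → ⟦ does (set x ≟ₛ S) ⟧ * wt x))
∑-by-set {n} xs set φ wt = begin
  ∑ xs (λ x → ⟦ φ (set x) ⟧ * wt x)
    ≡⟨ ∑-cong xs (λ x → ∑-pick (set x) (λ S → ⟦ φ S ⟧ * wt x)) ⟨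
  ∑ xs (λ x → ∑ V (λ S → ⟦ does (set x ≟ₛ S) ⟧ * (⟦ φ S ⟧ * wt x)))
    ≡⟨ ∑-swap xs V (λ x S → ⟦ does (set x ≟ₛ S) ⟧ * (⟦ φ S ⟧ * wt x)) ⟩
  ∑ V (λ S → ∑ xs (λ x → ⟦ does (set x ≟ₛ S) ⟧ * (⟦ φ S ⟧ * wt x)))
    ≡⟨ ∑-cong V (λ S → trans (∑-cong xs λ x → comm₃ ⟦ does (set x ≟ₛ S) ⟧ ⟦ φ S ⟧ (wt x)) (∑-* xs ⟦ φ S ⟧ _)) ⟩
  ∑ V (λ S → ⟦ φ S ⟧ * ∑ xs (λ x → ⟦ does (set x ≟ₛ S) ⟧ * wt x)) ∎
  where
  open ≡-Reasoning
  V = vecs bools n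
  comm₃ : ∀ a b c → a * (b * c) ≡ b * (a * c)
  comm₃ = solve-∀

inserted deleted : Sign → ℕ
inserted Sign.+ = 1
inserted Sign.- = 0
deleted  Sign.+ = 0
deleted  Sign.- = 1

-- Multiplicities are integers; carrying the deletions to the other side keeps the balance in ℕ,
-- where the counters live.
∑-inserted : ∀ {n} (a : Stream n) (𝒞 : Collection n) → a Defines 𝒞 → ∀ (φ : Subset n → Bool) →
  ∑ a (λ (S , s) → ⟦ φ S ⟧ * inserted s) ≡ ∑ 𝒞 (λ S → ⟦ φ S ⟧) + ∑ a (λ (S , s) → ⟦ φ S ⟧ * deleted s)
∑-inserted {n} a 𝒞 def φ = begin
  ∑ a (λ (S , s) → ⟦ φ S ⟧ * inserted s)
    ≡⟨ ∑-by-set a proj₁ φ (inserted ∘ proj₂) ⟩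
  ∑ V (λ S → ⟦ φ S ⟧ * ins a S)
    ≡⟨ ∑-cong V (λ S → trans (cong (⟦ φ S ⟧ *_) (balance S)) (*-distribˡ-+ ⟦ φ S ⟧ (mult S) (del a S))) ⟩
  ∑ V (λ S → ⟦ φ S ⟧ * mult S + ⟦ φ S ⟧ * del a S)
    ≡⟨ ∑-+ V _ _ ⟩
  ∑ V (λ S → ⟦ φ S ⟧ * mult S) + ∑ V (λ S → ⟦ φ S ⟧ * del a S)
    ≡⟨ cong₂ _+_ (∑-by-set 𝒞 id φ (λ _ → 1)) (∑-by-set a proj₁ φ (deleted ∘ proj₂)) ⟨
  ∑ 𝒞 (λ S → ⟦ φ S ⟧ * 1) + ∑ a (λ (S , s) → ⟦ φ S ⟧ * deleted s)
    ≡⟨ cong (_+ ∑ a (λ (S , s) → ⟦ φ S ⟧ * deleted s)) (∑-cong 𝒞 λ S → *-identityʳ ⟦ φ S ⟧) ⟩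
  ∑ 𝒞 (λ S → ⟦ φ S ⟧) + ∑ a (λ (S , s) → ⟦ φ S ⟧ * deleted s) ∎
  where
  open ≡-Reasoning
  V = vecs bools n
  ins del : Stream n → Subset n → ℕ
  ins a S = ∑ a (λ (T , s) → ⟦ does (T ≟ₛ S) ⟧ * inserted s)
  del a S = ∑ a (λ (T , s) → ⟦ does (T ≟ₛ S) ⟧ * deleted s)
  mult : Subset n → ℕ
  mult S = ∑ 𝒞 (λ T → ⟦ does (T ≟ₛ S) ⟧ * 1)
  multiplicity-balance : ∀ a S → multiplicity a S ℤ.+ pos (del a S) ≡ pos (ins a S)
  multiplicity-balance []            S = refl
  multiplicity-balance ((T , s) ∷ a) S with does (T ≟ₛ S) | s
  ... | false | _      = multiplicity-balance a S
  ... | true  | Sign.+ = trans (ℤ.+-assoc (pos 1) (multiplicity a S) (pos (del a S)))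
                           (cong (λ z → pos 1 ℤ.+ z) (multiplicity-balance a S))
  ... | true  | Sign.- = trans (regroup (multiplicity a S) (pos (del a S))) (multiplicity-balance a S)
    where
    regroup : ∀ x y → (ℤ.-[1+ 0 ] ℤ.+ x) ℤ.+ (pos 1 ℤ.+ y) ≡ x ℤ.+ y
    regroup x y = trans (cong (ℤ._+ (pos 1 ℤ.+ y)) (ℤ.+-comm ℤ.-[1+ 0 ] x))
      (trans (ℤ.+-assoc x ℤ.-[1+ 0 ] (pos 1 ℤ.+ y))
      (cong (λ z → x ℤ.+ z) (trans (sym (ℤ.+-assoc ℤ.-[1+ 0 ] (pos 1) y)) (ℤ.+-identityˡ y))))
  balance : ∀ S → ins a S ≡ mult S + del a S
  balance S = sym (ℤ.+-injective (trans (ℤ.pos-+ (mult S) (del a S))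
    (trans (cong (λ k → pos k ℤ.+ pos (del a S)) (sym count-mult))
    (trans (cong (ℤ._+ pos (del a S)) (sym (def S))) (multiplicity-balance a S)))))
    where
    count-mult : count S 𝒞 ≡ mult S
    count-mult = trans (length-filter (_≟ₛ S) 𝒞) (∑-cong 𝒞 λ T → sym (*-identityʳ _))

-- A pass evaluates q counters, each the number of sets of the final collection
-- with some property. They are kept modulo 2ʷ > m: the counts of a prefix of
-- the stream may be arbitrarily large, but the final ones are at most m.
module Sketch {n : ℕ} (w q : ℕ) {P : Set} {p : ℕ} (code : Code P p)
              (query : P → Fin q → Subset n → Bool) (step : P → Vec ℕ q → P) where

  M = 2 ^ w

  instance
    M≢0 : NonZero M
    M≢0 = m^n≢0 2 w

  -- M - 1 stands for -1 modulo M.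
  δ : Sign → ℕ
  δ Sign.+ = 1
  δ Sign.- = M ∸ 1

  bump : Sign → Fin M → Fin M
  bump s c = (toℕ c + δ s) mod M

  zeros : Vec (Fin M) q
  zeros = Vec.replicate q (fromℕ< (m^n>0 2 w))

  stateᶜ : Code (P × Vec (Fin M) q) (p + q * w)
  stateᶜ = code ×ᶜ vecᶜ bitsᶜ q

  count-one : P × Vec (Fin M) q → Update n → P × Vec (Fin M) q
  count-one (x , v) (S , s) = x , tabulate λ i → if query x i S then bump s (lookup v i) else lookup v i

  finish : P × Vec (Fin M) q → P × Vec (Fin M) q
  finish (x , v) = step x (Vec.map toℕ v) , zeros

  algorithm : (R coins : ℕ) (init : Bits coins → P) (select : P → Subset n → Bool) → StreamingAlgorithm n
  algorithm R coins init select = record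
    { space   = p + q * w
    ; passes  = R
    ; coins   = coins
    ; init    = λ ω → enc stateᶜ (init ω , zeros)
    ; update  = λ μ u → enc stateᶜ (count-one (dec stateᶜ μ) u)
    ; endPass = λ μ → enc stateᶜ (finish (dec stateᶜ μ))
    ; selects = λ μ → select (proj₁ (dec stateᶜ μ))
    }

  counts : Collection n → P → Vec ℕ q
  counts 𝒞 x = tabulate λ i → ∑ 𝒞 λ S → ⟦ query x i S ⟧

  weight : P → Fin q → Stream n → ℕ
  weight x i a = ∑ a λ (S , s) → ⟦ query x i S ⟧ * δ s

  -- Insertions exceed deletions by the final count K. With D deletions of weight M - 1 the total is
  -- K + D·M, and K ≤ |𝒞| < M survives the reduction.
  weight-% : ∀ a 𝒞 → a Defines 𝒞 → length 𝒞 < M → ∀ x i →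
             weight x i a % M ≡ ∑ 𝒞 λ S → ⟦ query x i S ⟧
  weight-% a 𝒞 def |𝒞|<M x i = begin
    weight x i a % M          ≡⟨ cong (_% M) (trans split (trans (cong (_+ (M ∸ 1) * D) (∑-inserted a 𝒞 def (query x i))) regroup)) ⟩
    (K + D * M) % M           ≡⟨ [m+kn]%n≡m%n K D M ⟩
    K % M                     ≡⟨ m<n⇒m%n≡m (≤-<-trans K≤ |𝒞|<M) ⟩
    K ∎
    where
    open ≡-Reasoning
    K = ∑ 𝒞 λ S → ⟦ query x i S ⟧
    I = ∑ a λ (S , s) → ⟦ query x i S ⟧ * inserted s
    D = ∑ a λ (S , s) → ⟦ query x i S ⟧ * deleted s
    K≤ : K ≤ length 𝒞
    K≤ = ≤-trans (∑-mono 𝒞 λ S → ⟦⟧≤1 (query x i S)) (≤-reflexive (sym (length-∑ 𝒞)))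
    δ-split : ∀ b s → b * δ s ≡ b * inserted s + (M ∸ 1) * (b * deleted s)
    δ-split b Sign.+ = sym (trans (cong (b * 1 +_) (trans (cong ((M ∸ 1) *_) (*-zeroʳ b)) (*-zeroʳ (M ∸ 1)))) (+-identityʳ _))
    δ-split b Sign.- = sym (trans (cong₂ _+_ (*-zeroʳ b) (cong ((M ∸ 1) *_) (*-identityʳ b))) (*-comm (M ∸ 1) b))
    split : weight x i a ≡ I + (M ∸ 1) * D
    split = trans (∑-cong a λ (S , s) → δ-split ⟦ query x i S ⟧ s)
                  (trans (∑-+ a _ _) (cong (I +_) (∑-* a (M ∸ 1) _)))
    regroup : K + D + (M ∸ 1) * D ≡ K + D * M
    regroup = trans (+-assoc K D _) (cong (K +_) (trans (cong (λ z → z * D) (m+[n∸m]≡n (m^n>0 2 w))) (*-comm M D)))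

  count-all : ∀ a x v → ∃[ v′ ]
    foldl (λ μ u → enc stateᶜ (count-one (dec stateᶜ μ) u)) (enc stateᶜ (x , v)) a ≡ enc stateᶜ (x , v′) ×
    (∀ i → toℕ (lookup v′ i) ≡ (toℕ (lookup v i) + weight x i a) % M)
  count-all [] x v = v , refl , λ i → sym (trans (cong (_% M) (+-identityʳ _)) (m<n⇒m%n≡m (toℕ<n (lookup v i))))
  count-all ((S , s) ∷ a) x v with count-all a x (proj₂ (count-one (x , v) (S , s)))
  ... | v′ , run , val = v′ , trans (cong (λ y → foldl _ (enc stateᶜ (count-one y (S , s))) a) (dec-enc stateᶜ (x , v))) run , λ i →
        trans (val i) (trans (cong (λ c → (toℕ c + weight x i a) % M) (lookup∘tabulate _ i)) (one i))
    where
    open ≡-Reasoning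
    one : ∀ i → (toℕ (if query x i S then bump s (lookup v i) else lookup v i) + weight x i a) % M ≡
                (toℕ (lookup v i) + weight x i ((S , s) ∷ a)) % M
    one i with query x i S
    ... | false = refl
    ... | true  = begin
      (toℕ (bump s (lookup v i)) + W) % M       ≡⟨ cong (λ z → (z + W) % M) (toℕ-fromℕ< _) ⟩
      ((c + δ s) % M + W) % M                   ≡⟨ %-distribˡ-+ ((c + δ s) % M) W M ⟩
      ((c + δ s) % M % M + W % M) % M           ≡⟨ cong (λ z → (z + W % M) % M) (m%n%n≡m%n (c + δ s) M) ⟩
      ((c + δ s) % M + W % M) % M               ≡⟨ %-distribˡ-+ (c + δ s) W M ⟨
      (c + δ s + W) % M                         ≡⟨ cong (_% M) (trans (+-assoc c (δ s) W) (cong (λ z → c + (z + W)) (sym (+-identityʳ (δ s))))) ⟩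
      (c + (1 * δ s + W)) % M                   ∎
      where
      c = toℕ (lookup v i)
      W = weight x i a

  module _ {R coins : ℕ} (init : Bits coins → P) (select : P → Subset n → Bool)
           {a : Stream n} {𝒞 : Collection n} (def : a Defines 𝒞) (|𝒞|<M : length 𝒞 < M) where

    open StreamingAlgorithm (algorithm R coins init select) using (pass; finalMemory)

    pass-step : ∀ x → pass a (enc stateᶜ (x , zeros)) ≡ enc stateᶜ (step x (counts 𝒞 x) , zeros)
    pass-step x with count-all a x zeros
    ... | v′ , run , val = cong (enc stateᶜ) (trans (cong (finish ∘ dec stateᶜ) run)
        (trans (cong finish (dec-enc stateᶜ (x , v′))) (cong (λ c → step x c , zeros) counted)))
      where
      zeros≡0 : ∀ i → toℕ (lookup zeros i) ≡ 0
      zeros≡0 i = trans (cong toℕ (lookup-replicate i _)) (toℕ-fromℕ< _)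
      counted : Vec.map toℕ v′ ≡ counts 𝒞 x
      counted = trans (sym (tabulate∘lookup (Vec.map toℕ v′))) (tabulate-cong λ i →
        trans (lookup-map i toℕ v′) (trans (val i)
        (trans (cong (λ z → (z + weight x i a) % M) (zeros≡0 i)) (weight-% a 𝒞 def |𝒞|<M x i))))

    final-state : ∀ ω → dec stateᶜ (finalMemory a ω) ≡ (fold (init ω) (λ x → step x (counts 𝒞 x)) R , zeros)
    final-state ω = trans (cong (dec stateᶜ) (iterated R)) (dec-enc stateᶜ _)
      where
      iterated : ∀ r → fold (enc stateᶜ (init ω , zeros)) (pass a) r ≡
                       enc stateᶜ (fold (init ω) (λ x → step x (counts 𝒞 x)) r , zeros)
      iterated zero    = refl
      iterated (suc r) = trans (cong (pass a) (iterated r)) (pass-step _)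

-- Rounds

∑-raise : ∀ {A : Set} {xs : List A} {f g x} c → (∀ y → f y ≤ g y) → x ∈ xs → c + f x ≤ g x → c + ∑ xs f ≤ ∑ xs g
∑-raise {xs = x ∷ xs} {f} c f≤g (here refl) c+fx≤gx = ≤-trans (≤-reflexive (sym (+-assoc c (f x) _)))
  (+-mono-≤ c+fx≤gx (∑-mono xs f≤g))
∑-raise {xs = x ∷ xs} {f} {g} c f≤g (there y∈) c+fy≤gy = ≤-trans (≤-reflexive (swap c (f x) (∑ xs f)))
  (+-mono-≤ (f≤g x) (∑-raise c f≤g y∈ c+fy≤gy))
  where
  swap : ∀ c x y → c + (x + y) ≡ x + (c + y)
  swap = solve-∀

∑-mono-< : ∀ {A : Set} {xs : List A} {f g x} → (∀ y → f y ≤ g y) → x ∈ xs → f x < g x → ∑ xs f < ∑ xs g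
∑-mono-< = ∑-raise 1

firstJust : ∀ {A : Set} {k} → (Fin k → Maybe A) → Maybe A
firstJust {k = zero}  f = nothing
firstJust {k = suc k} f = f zero <∣> firstJust (f ∘ suc)

firstJust-just : ∀ {A : Set} {k} (f : Fin k → Maybe A) {y} → firstJust f ≡ just y → ∃[ j ] f j ≡ just y
firstJust-just {k = suc k} f eq with f zero in f0
... | just _  = zero , trans f0 eq
... | nothing = let j , fj = firstJust-just (f ∘ suc) eq in suc j , fj

firstJust-≤ : ∀ {A : Set} {k} (f : Fin k → Maybe A) j {y} → f j ≡ just y →
              ∃[ i ] ∃[ z ] toℕ i ≤ toℕ j × f i ≡ just z × firstJust f ≡ just z
firstJust-≤ {k = suc _} f j       eq with f zero in f0
firstJust-≤ {k = suc _} f j       eq | just z  = zero , z , z≤n , f0 , refl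
firstJust-≤ {k = suc _} f zero    eq | nothing = contradiction (trans (sym f0) eq) λ ()
firstJust-≤ {k = suc _} f (suc j) eq | nothing = let i , z , i≤j , fi , first = firstJust-≤ (f ∘ suc) j eq in
                                     suc i , z , s≤s i≤j , fi , first

later : ∀ {k} → Bool → Maybe (Fin k) → Maybe (Fin (suc k))
later b     (just i) = just (suc i)
later true  nothing  = just zero
later false nothing  = nothing

lastTrue : ∀ {k} → (Fin k → Bool) → Maybe (Fin k)
lastTrue {zero}  p = nothing
lastTrue {suc k} p = later (p zero) (lastTrue (p ∘ suc))

lastTrue-nothing : ∀ {k} (p : Fin k → Bool) → lastTrue p ≡ nothing → ∀ i → p i ≡ false
lastTrue-nothing {suc k} p eq i with p zero in p0 | lastTrue (p ∘ suc) in rest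
lastTrue-nothing {suc k} p ()    i       | true  | nothing
lastTrue-nothing {suc k} p eq    zero    | false | nothing = p0
lastTrue-nothing {suc k} p eq    (suc i) | false | nothing = lastTrue-nothing (p ∘ suc) rest i

lastTrue-just : ∀ {k} (p : Fin k → Bool) {i} → lastTrue p ≡ just i →
                p i ≡ true × (∀ i′ → toℕ i < toℕ i′ → p i′ ≡ false)
lastTrue-just {suc k} p eq with p zero in p0 | lastTrue (p ∘ suc) in rest
lastTrue-just {suc k} p refl | _    | just i  =
  let pi , above = lastTrue-just (p ∘ suc) rest in pi , λ { (suc i′) (s≤s i<i′) → above i′ i<i′ }
lastTrue-just {suc k} p refl | true | nothing =
  p0 , λ { (suc i′) _ → lastTrue-nothing (p ∘ suc) rest i′ }

bitOf : ∀ {b} → Vec Bool b → Fin (suc b) → Bool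
bitOf y zero    = true
bitOf y (suc r) = lookup y r

-- κ zero is the number of voters, and κ (suc r) the number of those whose
-- identifier has bit r set. The vote is unanimous iff every bit is set by all
-- voters or by none.
consensus : ∀ {b} → (Fin (suc b) → ℕ) → Maybe (Vec Bool b)
consensus κ with κ zero ≟ 0 | Fin.all? (λ r → (κ (suc r) ≟ 0) ⊎-dec (κ (suc r) ≟ κ zero))
... | no _  | yes _ = just (tabulate λ r → not (isZero (κ (suc r))))
... | _     | _     = nothing

module _ {n b : ℕ} (ρ : Vec (Vec Bool n) b) (𝒞 : Collection n) (p : Subset n → Bool) where

  votes : Fin (suc b) → ℕ
  votes r = ∑ 𝒞 λ S → ⟦ p S ∧ bitOf (ident ρ S) r ⟧

  private
    vote-≤ : ∀ r S → ⟦ p S ∧ bitOf (ident ρ S) r ⟧ ≤ ⟦ p S ∧ true ⟧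
    vote-≤ r S with p S | bitOf (ident ρ S) r
    ... | false | _     = z≤n
    ... | true  | false = z≤n
    ... | true  | true  = ≤-refl

  -- The counter of a bit is bounded termwise by the counter of voters, so equality of the two
  -- forces every voter to have the bit. Copies of a set are counted separately but cast the same
  -- vote.
  consensus-sound : ∀ {y} → consensus votes ≡ just y →
                    (∃[ S ] S ∈ 𝒞 × p S ≡ true) × (∀ S → S ∈ 𝒞 → p S ≡ true → ident ρ S ≡ y)
  consensus-sound {y} eq with votes zero ≟ 0 | Fin.all? (λ r → (votes (suc r) ≟ 0) ⊎-dec (votes (suc r) ≟ votes zero))
  consensus-sound refl | no v≢0 | yes unanimous = voter , agree
    where
    voter : ∃[ S ] S ∈ 𝒞 × p S ≡ true
    voter = let S , S∈ , counted = ∑>0⇒ 𝒞 _ (n≢0⇒n>0 v≢0) in S , S∈ , positive S counted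
      where
      positive : ∀ S → 0 < ⟦ p S ∧ true ⟧ → p S ≡ true
      positive S h with p S
      ... | true = refl
    agree : ∀ S → S ∈ 𝒞 → p S ≡ true → ident ρ S ≡ tabulate λ r → not (isZero (votes (suc r)))
    agree S S∈ pS = trans (sym (tabulate∘lookup (ident ρ S))) (tabulate-cong bit)
      where
      bit : ∀ r → lookup (ident ρ S) r ≡ not (isZero (votes (suc r)))
      bit r with lookup (ident ρ S) r in eq
      ... | true  = positive (votes (suc r)) (≤-trans (≤-reflexive (cong ⟦_⟧ (sym (∧-true pS eq)))) (∑-∈ _ S∈))
        where
        positive : ∀ k → 1 ≤ k → true ≡ not (isZero k)
        positive (suc k) _ = refl
      ... | false with unanimous r
      ...   | inj₁ none = cong (not ∘ isZero) (sym none)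
      ...   | inj₂ all  = contradiction all (<⇒≢ (∑-mono-< (vote-≤ (suc r)) S∈ dissent))
        where
        dissent : ⟦ p S ∧ lookup (ident ρ S) r ⟧ < ⟦ p S ∧ true ⟧
        dissent rewrite pS | eq = s≤s z≤n

  consensus-complete : ∀ {y S} → S ∈ 𝒞 → p S ≡ true → (∀ T → T ∈ 𝒞 → p T ≡ true → ident ρ T ≡ y) →
                       consensus votes ≡ just y
  consensus-complete {y} {S} S∈ pS agree
    with votes zero ≟ 0 | Fin.all? (λ r → (votes (suc r) ≟ 0) ⊎-dec (votes (suc r) ≟ votes zero))
  ... | yes v≡0 | _      = contradiction (≤-trans (≤-reflexive (cong ⟦_⟧ (sym (∧-true pS refl)))) (∑-∈ _ S∈)) (<⇒≱ (s≤s (≤-reflexive v≡0)))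
  ... | no  v≢0 | no  ¬u = contradiction (λ r → unanimous r (lookup y r) refl) ¬u
    where
    none : ∀ r → lookup y r ≡ false → ∀ T → T ∈ 𝒞 → ⟦ p T ∧ lookup (ident ρ T) r ⟧ ≡ 0
    none r eq T T∈ with p T in pT
    ... | false = refl
    ... | true  rewrite agree T T∈ pT | eq = refl
    unanimous : ∀ r c → lookup y r ≡ c → votes (suc r) ≡ 0 ⊎ votes (suc r) ≡ votes zero
    unanimous r false eq = inj₁ (∑-zero 𝒞 (none r eq))
    unanimous r true  eq = inj₂ (≤-antisym (∑-mono 𝒞 (vote-≤ (suc r))) (∑-mono-∈ 𝒞 all))
      where
      all : ∀ T → T ∈ 𝒞 → ⟦ p T ∧ true ⟧ ≤ ⟦ p T ∧ lookup (ident ρ T) r ⟧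
      all T T∈ with p T in pT
      ... | false = z≤n
      ... | true  rewrite agree T T∈ pT | eq = ≤-refl
  ... | no  v≢0 | yes u  = cong just (trans (tabulate-cong bit) (tabulate∘lookup y))
    where
    bit : ∀ r → not (isZero (votes (suc r))) ≡ lookup y r
    bit r with lookup y r in eq
    ... | true  = positive (votes (suc r)) (≤-trans (≤-reflexive (cong ⟦_⟧ (sym (∧-true pS (trans (cong (λ z → lookup z r) (agree S S∈ pS)) eq))))) (∑-∈ _ S∈))
      where
      positive : ∀ k → 1 ≤ k → not (isZero k) ≡ true
      positive (suc k) _ = refl
    ... | false = cong (not ∘ isZero) (∑-zero 𝒞 none)
      where
      none : ∀ T → T ∈ 𝒞 → ⟦ p T ∧ lookup (ident ρ T) r ⟧ ≡ 0
      none T T∈ with p T in pT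
      ... | false = refl
      ... | true  rewrite agree T T∈ pT | eq = refl

consensus-cong : ∀ {b} {κ κ′ : Fin (suc b) → ℕ} → (∀ r → κ r ≡ κ′ r) → consensus κ ≡ consensus κ′
consensus-cong {κ = κ} {κ′} κ≗κ′
  with κ zero ≟ 0 | Fin.all? (λ r → (κ (suc r) ≟ 0) ⊎-dec (κ (suc r) ≟ κ zero))
     | κ′ zero ≟ 0 | Fin.all? (λ r → (κ′ (suc r) ≟ 0) ⊎-dec (κ′ (suc r) ≟ κ′ zero))
... | yes _ | _     | yes _ | _     = refl
... | yes p | _     | no ¬p | _     = contradiction (trans (sym (κ≗κ′ zero)) p) ¬p
... | no ¬p | _     | yes p | _     = contradiction (trans (κ≗κ′ zero) p) ¬p
... | no _  | no _  | no _  | no _  = refl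
... | no _  | yes _ | no _  | yes _ = cong just (tabulate-cong λ r → cong (not ∘ isZero) (κ≗κ′ (suc r)))
... | no _  | yes u | no _  | no ¬u = contradiction (λ r → Sum.map
  (trans (sym (κ≗κ′ (suc r)))) (λ eq → trans (sym (κ≗κ′ (suc r))) (trans eq (κ≗κ′ zero))) (u r)) ¬u
... | no _  | no ¬u | no _  | yes u = contradiction (λ r → Sum.map
  (trans (κ≗κ′ (suc r))) (λ eq → trans (κ≗κ′ (suc r)) (trans eq (sym (κ≗κ′ zero)))) (u r)) ¬u

-- An element is marked with the identifier of the chosen set that covered it.
Marks : ℕ → ℕ → Set
Marks n b = Vec (Maybe (Vec Bool b)) n

module _ {n b : ℕ} (X : Marks n b) where

  free : Fin n → Bool
  free e = is-nothing (lookup X e)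

  inc : Subset n → Fin n → Bool
  inc S e = lookup S e ∧ free e

  gain : Subset n → ℕ
  gain S = ∑ (allFin n) λ e → ⟦ inc S e ⟧

  gain≤n : ∀ S → gain S ≤ n
  gain≤n S = ≤-trans (∑-mono (allFin n) λ e → ⟦⟧≤1 (inc S e))
    (≤-reflexive (trans (sym (length-∑ (allFin n))) (List.length-tabulate id)))

names : ∀ {b} → Maybe (Vec Bool b) → Vec Bool b → Bool
names nothing  y = false
names (just z) y = does (z ≟ₛ y)

names-sound : ∀ {b} o {y : Vec Bool b} → names o y ≡ true → o ≡ just y
names-sound (just z) {y} h with z ≟ₛ y
... | yes refl = refl

names-refl : ∀ {b} (y : Vec Bool b) → names (just y) y ≡ true
names-refl y with y ≟ₛ y
... | yes _   = refl
... | no  y≢y = contradiction refl y≢y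

module Election {n b J L : ℕ} (ballot : Fin (suc L) → Fin n → Fin (suc J) → Maybe (Vec Bool b))
                (active : Fin (suc L) → Bool) (X : Marks n b) where

  owner : Fin (suc L) → Fin n → Maybe (Vec Bool b)
  owner i e = firstJust (ballot i e)

  followers : Fin (suc L) → Vec Bool b → ℕ
  followers i y = ∑ (allFin n) λ f → ⟦ names (owner i f) y ⟧

  strong : Fin (suc L) → Vec Bool b → Bool
  strong i y = 2 ^ toℕ i ≤ᵇ 4 * followers i y

  confirm : Fin (suc L) → Maybe (Vec Bool b) → Maybe (Vec Bool b)
  confirm i nothing  = nothing
  confirm i (just y) = if strong i y then just y else nothing

  elect : Fin (suc L) → Fin n → Maybe (Vec Bool b)
  elect i e = confirm i (owner i e)

  mark : Maybe (Fin (suc L)) → Marks n b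
  mark nothing  = X
  mark (just i) = tabulate λ e → lookup X e <∣> elect i e

  next : Marks n b
  next = mark (lastTrue active)

  elect-strong : ∀ {i e y} → owner i e ≡ just y → strong i y ≡ true → elect i e ≡ just y
  elect-strong own str rewrite own | str = refl

  elect-sound : ∀ {i e y} → elect i e ≡ just y → owner i e ≡ just y × strong i y ≡ true
  elect-sound {i} {e} eq = go (owner i e) refl eq
    where
    go : ∀ {y} o → owner i e ≡ o → confirm i o ≡ just y → owner i e ≡ just y × strong i y ≡ true
    go (just z) own eq with strong i z in str
    go (just z) own refl | true = own , str

  mark-kept : ∀ ph {e y} → lookup X e ≡ just y → lookup (mark ph) e ≡ just y
  mark-kept nothing          eq = eq
  mark-kept (just i) {e} {y} eq = trans (lookup∘tabulate _ e) (cong (_<∣> elect i e) eq)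

  mark-free : ∀ ph e → free (mark ph) e ≡ true → free X e ≡ true
  mark-free ph e h with lookup X e in eq
  ... | nothing = refl
  ... | just y  = trans (sym (cong is-nothing (mark-kept ph eq))) h

  mark-origin : ∀ ph {e y} → lookup (mark ph) e ≡ just y →
                lookup X e ≡ just y ⊎ (∃[ i ] owner i e ≡ just y)
  mark-origin nothing          eq = inj₁ eq
  mark-origin (just i) {e} {y} eq with lookup X e | trans (sym (lookup∘tabulate _ e)) eq
  ... | just z  | eq′ = inj₁ eq′
  ... | nothing | eq′ = inj₂ (i , proj₁ (elect-sound {i} {e} eq′))

  mark-elected : ∀ i {e y} → elect i e ≡ just y → free (mark (just i)) e ≡ false
  mark-elected i {e} {y} eq = cong is-nothing (trans (lookup∘tabulate _ e) (cong (lookup X e <∣>_) eq)) ∙ marked (lookup X e)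
    where
    _∙_ = trans
    marked : ∀ x → is-nothing (x <∣> just y) ≡ false
    marked nothing  = refl
    marked (just _) = refl

module _ {n b J : ℕ} (σ : Vec (Vec Bool (suc n)) J) where

  -- Depends on the set, the marks and the seed only, and these last two are fixed during a pass. It
  -- can thus be evaluated on each update in isolation, as a linear counter demands.
  voter : ∀ {L} → Marks n b → Fin (suc L) → Fin n → Fin (suc J) → Subset n → Bool
  voter X i e j S = (2 ^ toℕ i ≤ᵇ gain X S) ∧ (inc X S e ∧ level σ S (toℕ j))

module Large {n b : ℕ} (𝒞 : Collection n) (X : Marks n b) where

  -- Copies of a set are always sampled together, so pairwise independence is available for distinct
  -- sets only. The votes run over 𝒞 itself, where copies agree.
  D = deduplicate _≟ₛ_ 𝒞

  D! : Unique D
  D! = deduplicate-! _≟ₛ_ 𝒞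

  large : ∀ {L} → Fin (suc L) → List (Subset n)
  large i = filterᵇ (λ S → 2 ^ toℕ i ≤ᵇ gain X S) D

  large! : ∀ {L} (i : Fin (suc L)) → Unique (large i)
  large! i = Unique.filter⁺ _ D!

  ∈-large⁺ : ∀ {L} {i : Fin (suc L)} {S} → S ∈ 𝒞 → (2 ^ toℕ i ≤ᵇ gain X S) ≡ true → S ∈ large i
  ∈-large⁺ S∈ h = ∈-filterᵇ⁺ _ (∈.∈-deduplicate⁺ _≟ₛ_ S∈) h

  ∈-large⁻ : ∀ {L} {i : Fin (suc L)} {S} → S ∈ large i → S ∈ 𝒞 × (2 ^ toℕ i ≤ᵇ gain X S) ≡ true
  ∈-large⁻ S∈ = let S∈D , h = ∈-filterᵇ⁻ _ D S∈ in ∈.∈-deduplicate⁻ _≟ₛ_ 𝒞 S∈D , h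

module ElectionResult {n b J L : ℕ} (n≤2^L : n ≤ 2 ^ L)
  (𝒞 : Collection n) (ρ : Vec (Vec Bool n) b)
  (inj : ∀ {S T} → S ∈ 𝒞 → T ∈ 𝒞 → ident ρ S ≡ ident ρ T → S ≡ T)
  (σ : Vec (Vec Bool (suc n)) J) (X : Marks n b)
  (ballot : Fin (suc L) → Fin n → Fin (suc J) → Maybe (Vec Bool b)) (active : Fin (suc L) → Bool)
  (ballot-votes : ∀ i e j → ballot i e j ≡ consensus (votes ρ 𝒞 (voter σ X i e j)))
  (active-votes : ∀ i → active i ≡ not (isZero (∑ (allFin n) λ e → votes ρ 𝒞 (voter σ X i e zero) zero)))
  where

  open Election {L = L} ballot active X

  open Large 𝒞 X public

  E = allFin n

  owner-sound : ∀ {i e y} → owner i e ≡ just y →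
                ∃[ S ] S ∈ 𝒞 × ident ρ S ≡ y × inc X S e ≡ true
  owner-sound {i} {e} own =
    let j , bal = firstJust-just (ballot i e) own
        (S , S∈ , vS) , agree = consensus-sound ρ 𝒞 (voter σ X i e j) (trans (sym (ballot-votes i e j)) bal)
    in S , S∈ , agree S S∈ vS , ∧-trueˡ (∧-trueʳ {2 ^ toℕ i ≤ᵇ gain X S} vS)

  module _ (i : Fin (suc L)) where

    open Contraction J (large i) (large! i) (inc X) (2 ^ toℕ i) using (alone; alone-unique; wins)

    -- Samples shrink as the level grows. Hence `S` also votes at the lowest unanimous level k ≤ j,
    -- and the identifier agreed on there must be its own. No knowledge of the right level j is
    -- required to find it.
    owner-alone : ∀ {S e j} → S ∈ large i → j ≤ J → alone σ S j e ≡ true → owner i e ≡ just (ident ρ S)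
    owner-alone {S} {e} {j} S∈ j≤J al =
      let k , y , k≤j , bk , own = firstJust-≤ (ballot i e) j′ (trans (ballot-votes i e j′) unanimous)
          _ , agree = consensus-sound ρ 𝒞 (voter σ X i e k) (trans (sym (ballot-votes i e k)) bk)
      in trans own (cong just (sym (agree S S∈𝒞 (∧-true big (∧-true incS (level-antitone σ S k≤j votesS))))))
      where
      j′ : Fin (suc J)
      j′ = fromℕ< (s≤s j≤J)
      j′≡j : toℕ j′ ≡ j
      j′≡j = toℕ-fromℕ< (s≤s j≤J)
      S∈𝒞 = proj₁ (∈-large⁻ {i = i} S∈)
      big = proj₂ (∈-large⁻ {i = i} S∈)
      incS : inc X S e ≡ true
      incS = ∧-trueˡ (∧-trueʳ {level σ S j} al)
      votesS : level σ S (toℕ j′) ≡ true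
      votesS = trans (cong (level σ S) j′≡j) (∧-trueˡ al)
      unanimous : consensus (votes ρ 𝒞 (voter σ X i e j′)) ≡ just (ident ρ S)
      unanimous = consensus-complete ρ 𝒞 (voter σ X i e j′) S∈𝒞 (∧-true big (∧-true incS votesS)) λ T T∈ vT →
        cong (ident ρ) (alone-unique σ j e (∈-large⁺ {i = i} T∈ (∧-trueˡ vT)) al
          (trans (cong (level σ T) (sym j′≡j)) (∧-trueʳ {inc X T e} (∧-trueʳ {2 ^ toℕ i ≤ᵇ gain X T} vT)))
          (∧-trueˡ (∧-trueʳ {2 ^ toℕ i ≤ᵇ gain X T} vT)))

    -- All elements where `S` is alone on level j follow it by `owner-alone`. So `wins`, which
    -- speaks of the sample, implies `strong`, which is computed from the counters.
    elect-alone : ∀ {S e j} → S ∈ large i → j ≤ J → alone σ S j e ≡ true → wins σ S j ≡ true →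
                  elect i e ≡ just (ident ρ S)
    elect-alone {S} {e} {j} S∈ j≤J al won = elect-strong {i} {e} (owner-alone S∈ j≤J al)
      (≤ᵇ-complete {2 ^ toℕ i} {4 * followers i (ident ρ S)} (≤-trans wide (*-monoʳ-≤ 4 (∑-mono E follow))))
      where
      wide : 2 ^ toℕ i ≤ 4 * ∑ E (λ f → ⟦ alone σ S j f ⟧)
      wide = ≤ᵇ-sound {2 ^ toℕ i} {4 * ∑ E (λ f → ⟦ alone σ S j f ⟧)} won
      follow : ∀ f → ⟦ alone σ S j f ⟧ ≤ ⟦ names (owner i f) (ident ρ S) ⟧
      follow f = ⟦⟧-mono λ al′ →
        trans (cong (λ o → names o (ident ρ S)) (owner-alone S∈ j≤J al′)) (names-refl (ident ρ S))

  active-sound : ∀ {i} → active i ≡ true → ∃[ S ] S ∈ 𝒞 × 2 ^ toℕ i ≤ gain X S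
  active-sound {i} h =
    let e , _ , counted = ∑>0⇒ E _ (nonzero _ (trans (sym (active-votes i)) h))
        S , S∈ , vS = ∑>0⇒ 𝒞 _ counted
    in S , S∈ , ≤ᵇ-sound (∧-trueˡ (∧-trueˡ (positive _ vS)))
    where
    nonzero : ∀ k → not (isZero k) ≡ true → 0 < k
    nonzero (suc k) _ = z<s
    positive : ∀ c → 0 < ⟦ c ⟧ → c ≡ true
    positive true _ = refl

  active-complete : ∀ {i S} → S ∈ 𝒞 → 2 ^ toℕ i ≤ gain X S → active i ≡ true
  active-complete {i} {S} S∈ big =
    let e , e∈ , incS = ∑>0⇒ E (λ e → ⟦ inc X S e ⟧) (≤-trans (m^n>0 2 (toℕ i)) big)
    in trans (active-votes i) (nonzero (≤-trans (≤-trans (≤-reflexive (cong ⟦_⟧ (sym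
         (∧-true (∧-true (≤ᵇ-complete big) (∧-true (positive _ incS) refl)) refl)))) (∑-∈ _ S∈)) (∑-∈ _ e∈)))
    where
    nonzero : ∀ {k} → 0 < k → not (isZero k) ≡ true
    nonzero {suc k} _ = refl
    positive : ∀ c → 0 < ⟦ c ⟧ → c ≡ true
    positive true _ = refl

  phase-nothing : lastTrue active ≡ nothing → ∀ {S} → S ∈ 𝒞 → gain X S ≡ 0
  phase-nothing eq {S} S∈ = cases (gain X S) refl
    where
    cases : ∀ g → gain X S ≡ g → g ≡ 0
    cases zero    _  = refl
    cases (suc g) gX = contradiction
      (trans (sym (active-complete {zero} S∈ (≤-trans (s≤s z≤n) (≤-reflexive (sym gX))))) (lastTrue-nothing active eq zero)) λ ()

  phase-just : ∀ {i} → lastTrue active ≡ just i →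
               (∃[ S ] S ∈ 𝒞 × 2 ^ toℕ i ≤ gain X S) × (∀ {S} → S ∈ 𝒞 → gain X S < 2 ^ suc (toℕ i))
  phase-just {i} eq = active-sound (proj₁ top) , λ {S} S∈ → ≰⇒> (too-big S∈)
    where
    top = lastTrue-just active eq
    too-big : ∀ {S} → S ∈ 𝒞 → ¬ 2 ^ suc (toℕ i) ≤ gain X S
    too-big {S} S∈ big = contradiction
      (trans (sym (active-complete {i′} S∈ (≤-trans (≤-reflexive (cong (2 ^_) i′≡)) big)))
             (proj₂ top i′ (≤-reflexive (sym i′≡)))) λ ()
      where
      -- For i = L there is no higher threshold whose inactivity could be invoked; a gain of 2ᴸ⁺¹ is
      -- then excluded by n ≤ 2ᴸ.
      i<L : suc (toℕ i) < suc L
      i<L = s≤s (≮⇒≥ λ L<i → <⇒≱ (^-monoʳ-< 2 (s≤s (s≤s z≤n)) L<i) (≤-trans big (≤-trans (gain≤n X S) n≤2^L)))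
      i′ = fromℕ< i<L
      i′≡ : toℕ i′ ≡ suc (toℕ i)
      i′≡ = toℕ-fromℕ< i<L

  newly : Fin (suc L) → Fin n → Bool
  newly i f = free X f ∧ not (free (mark (just i)) f)

  elected : Fin (suc L) → List (Vec Bool b)
  elected i = filterᵇ (strong i) (deduplicate _≟ₛ_ (mapMaybe (owner i) E))

  elected-complete : ∀ {i e y} → elect i e ≡ just y → y ∈ elected i
  elected-complete {i} {e} el = let own , str = elect-sound {i} {e} el in
    ∈-filterᵇ⁺ (strong i) (∈.∈-deduplicate⁺ _≟ₛ_ (∈-mapMaybe (owner i) (∈.∈-allFin e) own)) str
    where
    ∈-mapMaybe : ∀ {A B : Set} (f : A → Maybe B) {xs x y} → x ∈ xs → f x ≡ just y → y ∈ mapMaybe f xs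
    ∈-mapMaybe f (here refl) eq rewrite eq = here refl
    ∈-mapMaybe f {x′ ∷ xs} (there x∈) eq with f x′
    ... | just _  = there (∈-mapMaybe f x∈ eq)
    ... | nothing = ∈-mapMaybe f x∈ eq

  -- The followers of distinct elected sets are disjoint, and become marked.
  elected-cost : ∀ i → 2 ^ toℕ i * length (elected i) ≤ 4 * ∑ E (λ f → ⟦ newly i f ⟧)
  elected-cost i = begin
    2 ^ toℕ i * length W              ≡⟨ *-comm (2 ^ toℕ i) (length W) ⟩
    length W * 2 ^ toℕ i              ≡⟨ ∑-const W (2 ^ toℕ i) ⟨
    ∑ W (λ _ → 2 ^ toℕ i)             ≤⟨ ∑-mono-∈ W (λ y y∈ → ≤ᵇ-sound {2 ^ toℕ i} {4 * followers i y} (strong-∈ y∈)) ⟩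
    ∑ W (λ y → 4 * followers i y)     ≡⟨ ∑-* W 4 (followers i) ⟩
    4 * ∑ W (followers i)             ≡⟨ cong (4 *_) (∑-swap W E (λ y f → ⟦ names (owner i f) y ⟧)) ⟩
    4 * ∑ E (λ f → ∑ W (λ y → ⟦ names (owner i f) y ⟧)) ≤⟨ *-monoʳ-≤ 4 (∑-mono E one-name) ⟩
    4 * ∑ E (λ f → ⟦ newly i f ⟧)     ∎
    where
    open ≤-Reasoning
    W = elected i
    strong-∈ : ∀ {y} → y ∈ W → strong i y ≡ true
    strong-∈ y∈ = proj₂ (∈-filterᵇ⁻ (strong i) (deduplicate _≟ₛ_ (mapMaybe (owner i) E)) y∈)
    W! : Unique W
    W! = Unique.filter⁺ _ (deduplicate-! _≟ₛ_ (mapMaybe (owner i) E))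
    newly-true : ∀ {f y} → y ∈ W → owner i f ≡ just y → newly i f ≡ true
    newly-true {f} y∈ own = let S , _ , _ , incS = owner-sound {i} {f} own in
      ∧-true (∧-trueʳ {lookup S f} incS) (cong not (mark-elected i {f} (elect-strong {i} {f} own (strong-∈ y∈))))
    one-name : ∀ f → ∑ W (λ y → ⟦ names (owner i f) y ⟧) ≤ ⟦ newly i f ⟧
    one-name f = cases (newly i f) refl
      where
      none : newly i f ≡ false → ∀ y → y ∈ W → ⟦ names (owner i f) y ⟧ ≡ 0
      none new y y∈ with names (owner i f) y in nm
      ... | false = refl
      ... | true  = contradiction (trans (sym (newly-true y∈ (names-sound (owner i f) nm))) new) λ ()
      cases : ∀ c → newly i f ≡ c → ∑ W (λ y → ⟦ names (owner i f) y ⟧) ≤ ⟦ c ⟧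
      cases true  _   = ∑-at-most-one (names (owner i f)) W! λ _ _ ny nz →
        just-injective (trans (sym (names-sound (owner i f) ny)) (names-sound (owner i f) nz))
      cases false new = ≤-reflexive (∑-zero W (none new))

lastTrue-cong : ∀ {k} {p p′ : Fin k → Bool} → (∀ i → p i ≡ p′ i) → lastTrue p ≡ lastTrue p′
lastTrue-cong {zero}  h = refl
lastTrue-cong {suc k} h = cong₂ later (h zero) (lastTrue-cong (h ∘ suc))

module Round (n b J L : ℕ) where

  q : ℕ
  q = suc L * (n * (suc J * suc b))

  index : Fin (suc L) → Fin n → Fin (suc J) → Fin (suc b) → Fin q
  index i e j r = combine i (combine e (combine j r))

  split₂ : Fin n × Fin (suc J * suc b) → Fin n × Fin (suc J) × Fin (suc b)
  split₂ (e , z) = e , remQuot (suc b) z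

  split₃ : Fin (suc L) × Fin (n * (suc J * suc b)) → Fin (suc L) × Fin n × Fin (suc J) × Fin (suc b)
  split₃ (i , y) = i , split₂ (remQuot (suc J * suc b) y)

  unindex : Fin q → Fin (suc L) × Fin n × Fin (suc J) × Fin (suc b)
  unindex x = split₃ (remQuot (n * (suc J * suc b)) x)

  unindex-index : ∀ i e j r → unindex (index i e j r) ≡ (i , e , j , r)
  unindex-index i e j r =
    trans (cong split₃ (remQuot-combine {suc L} i (combine e (combine {suc J} j r))))
    (cong (i ,_) (trans (cong split₂ (remQuot-combine {n} e (combine {suc J} j r)))
    (cong (e ,_) (remQuot-combine {suc J} j r))))

  query : Vec (Vec Bool n) b → Vec (Vec Bool (suc n)) J → Marks n b → Fin q → Subset n → Bool
  query ρ σ X x S = let i , e , j , r = unindex x in voter σ X i e j S ∧ bitOf (ident ρ S) r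

  ballots : Vec ℕ q → Fin (suc L) → Fin n → Fin (suc J) → Maybe (Vec Bool b)
  ballots c i e j = consensus λ r → lookup c (index i e j r)

  -- Level 0 keeps every set and counter 0 counts every voter, so the sum is the number of
  -- incidences of sets above the threshold, copies included. As 2ⁱ ≥ 1, it is positive as soon as
  -- one such set exists.
  active : Vec ℕ q → Fin (suc L) → Bool
  active c i = not (isZero (∑ (allFin n) λ e → lookup c (index i e zero zero)))

  opaque

    nextMarks : Vec ℕ q → Marks n b → Marks n b
    nextMarks c X = Election.next (ballots c) (active c) X

    nextMarks-mark : ∀ c X → nextMarks c X ≡ Election.mark (ballots c) (active c) X (lastTrue (active c))
    nextMarks-mark c X = refl

  module Tally (𝒞 : Collection n) (ρ : Vec (Vec Bool n) b) (σ : Vec (Vec Bool (suc n)) J) (X : Marks n b) where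

    tally : Vec ℕ q
    tally = tabulate λ x → ∑ 𝒞 λ S → ⟦ query ρ σ X x S ⟧

    tally-votes : ∀ i e j r → lookup tally (index i e j r) ≡ votes ρ 𝒞 (voter σ X i e j) r
    tally-votes i e j r = trans (lookup∘tabulate _ (index i e j r)) (∑-cong 𝒞 λ S →
      cong (λ (i , e , j , r) → ⟦ voter σ X i e j S ∧ bitOf (ident ρ S) r ⟧) (unindex-index i e j r))

    ballots-votes : ∀ i e j → ballots tally i e j ≡ consensus (votes ρ 𝒞 (voter σ X i e j))
    ballots-votes i e j = consensus-cong (tally-votes i e j)

    active-votes : ∀ i → active tally i ≡ not (isZero (∑ (allFin n) λ e → votes ρ 𝒞 (voter σ X i e zero) zero))
    active-votes i = cong (not ∘ isZero) (∑-cong (allFin n) λ e → tally-votes i e zero zero)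

-- The potential

module Progress {n b J L m : ℕ} (n≤2^L : n ≤ 2 ^ L) (8m≤2^J : 8 * m ≤ 2 ^ J)
  (𝒞 : Collection n) (|𝒞|≤m : length 𝒞 ≤ m) (ρ : Vec (Vec Bool n) b)
  (inj : ∀ {S T} → S ∈ 𝒞 → T ∈ 𝒞 → ident ρ S ≡ ident ρ T → S ≡ T) where

  open Round n b J L

  D = deduplicate _≟ₛ_ 𝒞
  E = allFin n
  Ω = seeds n J
  N = length Ω

  nextOf : Vec (Vec Bool (suc n)) J → Marks n b → Marks n b
  nextOf σ X = nextMarks (Tally.tally 𝒞 ρ σ X) X

  module Result σ X = ElectionResult {L = L} n≤2^L 𝒞 ρ inj σ X
    (ballots (Tally.tally 𝒞 ρ σ X)) (active (Tally.tally 𝒞 ρ σ X))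
    (Tally.ballots-votes 𝒞 ρ σ X) (Tally.active-votes 𝒞 ρ σ X)

  gain-mono : ∀ {X X′ : Marks n b} → (∀ e → free X′ e ≡ true → free X e ≡ true) → ∀ S → gain X′ S ≤ gain X S
  gain-mono {X} {X′} X′⊆X S = ∑-mono E λ e → ⟦⟧-mono {inc X′ S e} λ h →
    ∧-true (∧-trueˡ h) (X′⊆X e (∧-trueʳ {lookup S e} h))

  next-free : ∀ σ X e → free (nextOf σ X) e ≡ true → free X e ≡ true
  next-free σ X e h = Election.mark-free (ballots c) (active c) X (lastTrue (active c)) e
    (trans (cong (λ Y → free Y e) (sym (nextMarks-mark c X))) h)
    where c = Tally.tally 𝒞 ρ σ X

  -- If all gains are below 2ⁱ⁺¹, the phases below i contribute at most m · 2ⁱ⁺¹ · (1 + B + ... +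
  -- Bⁱ⁻¹) to `Ψ`. With B = 2m + 1 this is (Bⁱ - 1) · 2ⁱ, less than what one large set contributes
  -- to phase i.
  B : ℕ
  B = suc (2 * m)

  Φ : Marks n b → ℕ → ℕ
  Φ X k = ∑ D λ S → ⟦ 2 ^ k ≤ᵇ gain X S ⟧ * gain X S

  Ψ : Marks n b → ℕ → ℕ
  Ψ X zero    = 0
  Ψ X (suc k) = B ^ k * Φ X k + Ψ X k

  large-mono : ∀ τ {x y} → x ≤ y → ⟦ τ ≤ᵇ x ⟧ * x ≤ ⟦ τ ≤ᵇ y ⟧ * y
  large-mono τ {x} {y} x≤y = *-mono-≤ (⟦⟧-mono {τ ≤ᵇ x} λ h → ≤ᵇ-complete (≤-trans (≤ᵇ-sound {τ} {x} h) x≤y)) x≤y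

  Φ-mono : ∀ {X X′} → (∀ S → gain X′ S ≤ gain X S) → ∀ k → Φ X′ k ≤ Φ X k
  Φ-mono le k = ∑-mono D λ S → large-mono (2 ^ k) (le S)

  Ψ-mono : ∀ {X X′} → (∀ S → gain X′ S ≤ gain X S) → ∀ k → Ψ X′ k ≤ Ψ X k
  Ψ-mono le zero    = z≤n
  Ψ-mono {X} {X′} le (suc k) = +-mono-≤ (*-monoʳ-≤ (B ^ k) (Φ-mono {X} {X′} le k)) (Ψ-mono {X} {X′} le k)

  ∈D⇒∈𝒞 : ∀ {S} → S ∈ D → S ∈ 𝒞
  ∈D⇒∈𝒞 = ∈.∈-deduplicate⁻ _≟ₛ_ 𝒞

  |D|≤m : length D ≤ m
  |D|≤m = ≤-trans (List.length-deduplicate _≟ₛ_ 𝒞) |𝒞|≤m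

  Φ≤ : ∀ {X g} → (∀ {S} → S ∈ 𝒞 → gain X S ≤ g) → ∀ k → Φ X k ≤ m * g
  Φ≤ {X} {g} gain≤g k = begin
    Φ X k          ≤⟨ ∑-mono-∈ D (λ S S∈ → *-mono-≤ (⟦⟧≤1 (2 ^ k ≤ᵇ gain X S)) (gain≤g (∈D⇒∈𝒞 S∈))) ⟩
    ∑ D (λ _ → 1 * g) ≡⟨ ∑-const D (1 * g) ⟩
    length D * (1 * g) ≤⟨ *-mono-≤ |D|≤m (≤-reflexive (*-identityˡ g)) ⟩
    m * g          ∎
    where open ≤-Reasoning

  Φ≡0 : ∀ {X k} → (∀ {S} → S ∈ 𝒞 → gain X S < 2 ^ k) → Φ X k ≡ 0
  Φ≡0 {X} {k} small = ∑-zero D λ S S∈ → below (2 ^ k) (gain X S) (small (∈D⇒∈𝒞 S∈))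
    where
    below : ∀ τ g → g < τ → ⟦ τ ≤ᵇ g ⟧ * g ≡ 0
    below τ g g<τ with τ ≤ᵇ g in eq
    ... | false = refl
    ... | true  = contradiction (≤ᵇ-sound eq) (<⇒≱ g<τ)

  -- The geometric sum behind the choice of `B`. With k = i it compares the lower phases to the
  -- current one; with i = L and k = L + 1 it bounds the potential at the start.
  Ψ-below : ∀ {X i} → (∀ {S} → S ∈ 𝒞 → gain X S < 2 ^ suc i) → ∀ k → Ψ X k ≤ B ^ k * 2 ^ i
  Ψ-below {X} {i} small zero    = z≤n
  Ψ-below {X} {i} small (suc k) = begin
    B ^ k * Φ X k + Ψ X k                          ≤⟨ +-mono-≤ (*-monoʳ-≤ (B ^ k) (Φ≤ {X} (<⇒≤ ∘ small) k)) (Ψ-below {X} {i} small k) ⟩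
    B ^ k * (m * 2 ^ suc i) + B ^ k * 2 ^ i        ≡⟨ regroup (B ^ k) m (2 ^ i) ⟩
    suc (2 * m) * B ^ k * 2 ^ i                    ∎
    where
    open ≤-Reasoning
    regroup : ∀ x m y → x * (m * (2 * y)) + x * y ≡ suc (2 * m) * x * y
    regroup = solve-∀

  Ψ-above : ∀ {X i} → (∀ {S} → S ∈ 𝒞 → gain X S < 2 ^ suc i) → ∀ d → Ψ X (d + suc i) ≡ Ψ X (suc i)
  Ψ-above {X} {i} small zero    = refl
  Ψ-above {X} {i} small (suc d) = begin
    B ^ (d + suc i) * Φ X (d + suc i) + Ψ X (d + suc i)
      ≡⟨ cong₂ _+_ (trans (cong (B ^ (d + suc i) *_) (Φ≡0 {X} {d + suc i} λ S∈ →
           <-≤-trans (small S∈) (^-monoʳ-≤ 2 (m≤n+m (suc i) d)))) (*-zeroʳ (B ^ (d + suc i)))) (Ψ-above {X} {i} small d) ⟩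
    Ψ X (suc i) ∎
    where open ≡-Reasoning

  Ψ-top : ∀ {X i} → i ≤ L → (∀ {S} → S ∈ 𝒞 → gain X S < 2 ^ suc i) → Ψ X (suc L) ≡ B ^ i * Φ X i + Ψ X i
  Ψ-top {X} {i} i≤L small = trans (cong (Ψ X) (sym (m∸n+n≡m (s≤s i≤L)))) (Ψ-above {X} {i} small (L ∸ i))

  -- Phase 0 has threshold 1, so any uncovered element of any set makes the potential at least 1.
  -- This integrality lets the expectation of `Ψ` bound the probability of an incomplete cover.
  Ψ-positive : ∀ {X S} → S ∈ 𝒞 → 0 < gain X S → ∀ k → 0 < Ψ X (suc k)
  Ψ-positive {X} {S} S∈ gain>0 zero    = ≤-trans (≤-trans one (∑-∈ _ (∈.∈-deduplicate⁺ _≟ₛ_ S∈)))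
                                    (≤-trans (m≤n*m (Φ X 0) 1) (m≤m+n (1 * Φ X 0) 0))
    where
    one : 1 ≤ ⟦ 1 ≤ᵇ gain X S ⟧ * gain X S
    one = ≤-trans gain>0 (≤-reflexive (sym (trans (cong (λ c → ⟦ c ⟧ * gain X S) (≤ᵇ-complete gain>0)) (*-identityˡ (gain X S)))))
  Ψ-positive {X} S∈ gain>0 (suc k) = ≤-trans (Ψ-positive {X} S∈ gain>0 k) (m≤n+m _ (B ^ suc k * Φ X (suc k)))

  -- The phase written without the seed: level 0 contains all sets whatever σ is. A single case
  -- distinction on the phase therefore precedes the expectation over σ.
  top : Marks n b → Maybe (Fin (suc L))
  top X = lastTrue λ i → not (isZero (∑ E λ e → ∑ 𝒞 λ S →
            ⟦ ((2 ^ toℕ i ≤ᵇ gain X S) ∧ (inc X S e ∧ true)) ∧ true ⟧))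

  lastTrue-active : ∀ σ X → lastTrue (active (Tally.tally 𝒞 ρ σ X)) ≡ top X
  lastTrue-active σ X = lastTrue-cong (Tally.active-votes 𝒞 ρ σ X)

  -- The top phase i carries at least half of Ψ, and loses a 64th part of its
  -- own contribution in expectation.
  contraction-just : ∀ X i → top X ≡ just i →
    128 * ∑ Ω (λ σ → Ψ (nextOf σ X) (suc L)) ≤ 127 * (N * Ψ X (suc L))
  contraction-just X i top≡i = begin
    128 * ∑ Ω (λ σ → Ψ (nextOf σ X) (suc L))
      ≤⟨ *-monoʳ-≤ 128 (∑-mono Ω Ψ-next) ⟩
    128 * ∑ Ω (λ σ → B ^ k * Φ (nextOf σ X) k + Ψ X k)
      ≡⟨ cong (128 *_) (trans (∑-+ Ω _ _) (cong₂ _+_ (∑-* Ω (B ^ k) _) (∑-const Ω (Ψ X k)))) ⟩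
    128 * (B ^ k * Y + N * Ψ X k)
      ≡⟨ regroup₁ (B ^ k) Y (N * Ψ X k) ⟩
    2 * B ^ k * (64 * Y) + 128 * (N * Ψ X k)
      ≤⟨ +-monoˡ-≤ _ (*-monoʳ-≤ (2 * B ^ k) 64Y≤) ⟩
    2 * B ^ k * (63 * (N * Φ X k)) + 128 * (N * Ψ X k)
      ≡⟨ regroup₂ (B ^ k) N (Φ X k) (Ψ X k) ⟩
    127 * (N * Ψ X k) + 126 * (N * (B ^ k * Φ X k)) + N * Ψ X k
      ≤⟨ +-monoʳ-≤ _ (*-monoʳ-≤ N lower) ⟩
    127 * (N * Ψ X k) + 126 * (N * (B ^ k * Φ X k)) + N * (B ^ k * Φ X k)
      ≡⟨ regroup₃ (B ^ k * Φ X k) N (Ψ X k) ⟩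
    127 * (N * (B ^ k * Φ X k + Ψ X k))
      ≡⟨ cong (λ z → 127 * (N * z)) (Ψ-top {X} i≤L small) ⟨
    127 * (N * Ψ X (suc L)) ∎
    where
    open ≤-Reasoning
    k = toℕ i
    Y = ∑ Ω (λ σ → Φ (nextOf σ X) k)
    i≤L : k ≤ L
    i≤L = s≤s⁻¹ (toℕ<n i)
    regroup₁ : ∀ x y z → 128 * (x * y + z) ≡ 2 * x * (64 * y) + 128 * z
    regroup₁ = solve-∀
    regroup₂ : ∀ x n p z → 2 * x * (63 * (n * p)) + 128 * (n * z) ≡ 127 * (n * z) + 126 * (n * (x * p)) + n * z
    regroup₂ = solve-∀
    regroup₃ : ∀ x n z → 127 * (n * z) + 126 * (n * x) + n * x ≡ 127 * (n * (x + z))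
    regroup₃ = solve-∀
    open Large 𝒞 X using (large; large!; ∈-large⁻)
    F = large i
    open Contraction J F (large! i) (inc X) (2 ^ k) using (deg; contraction)
    act≡ : ∀ σ → lastTrue (active (Tally.tally 𝒞 ρ σ X)) ≡ just i
    act≡ σ = trans (lastTrue-active σ X) top≡i
    -- An arbitrary seed: the bounds on the gains concern `X` alone but are obtained through the
    -- counters of some sample.
    σ₀ : Vec (Vec Bool (suc n)) J
    σ₀ = Vec.replicate J (Vec.replicate (suc n) false)
    small : ∀ {S} → S ∈ 𝒞 → gain X S < 2 ^ suc k
    small = proj₂ (Result.phase-just σ₀ X (act≡ σ₀))
    Ψ-next : ∀ σ → Ψ (nextOf σ X) (suc L) ≤ B ^ k * Φ (nextOf σ X) k + Ψ X k
    Ψ-next σ = ≤-trans (≤-reflexive (Ψ-top {nextOf σ X} i≤L λ {S} S∈ → ≤-<-trans (shrinks S) (small S∈)))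
                       (+-monoʳ-≤ (B ^ k * Φ (nextOf σ X) k) (Ψ-mono {X} {nextOf σ X} shrinks k))
      where
      shrinks : ∀ S → gain (nextOf σ X) S ≤ gain X S
      shrinks = gain-mono {X} {nextOf σ X} (next-free σ X)
    -- One large set already gives `Φ X k` ≥ 2ᵏ, which is the factor in the bound of `Ψ-below`.
    lower : Ψ X k ≤ B ^ k * Φ X k
    lower = let S , S∈ , big = proj₁ (Result.phase-just σ₀ X (act≡ σ₀)) in
      ≤-trans (Ψ-below {X} {k} small k) (*-monoʳ-≤ (B ^ k) (≤-trans big (≤-trans
        (≤-reflexive (sym (trans (cong (λ c → ⟦ c ⟧ * gain X S) (≤ᵇ-complete big)) (*-identityˡ (gain X S)))))
        (∑-∈ _ (∈.∈-deduplicate⁺ _≟ₛ_ S∈)))))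
    removed : Vec (Vec Bool (suc n)) J → Fin n → Bool
    removed σ e = not (free (nextOf σ X) e)
    lost : Vec (Vec Bool (suc n)) J → ℕ
    lost σ = ∑ E (λ e → deg e * ⟦ removed σ e ⟧)
    ∑-deg : ∑ E deg ≡ Φ X k
    ∑-deg = trans (∑-swap E F (λ e S → ⟦ inc X S e ⟧)) (∑-filterᵇ _ D (gain X))
    deg≤m : ∀ e → 8 * deg e ≤ 2 ^ J
    deg≤m e = ≤-trans (*-monoʳ-≤ 8 (≤-trans (∑-mono F λ S → ⟦⟧≤1 (inc X S e))
      (≤-trans (≤-reflexive (sym (length-∑ F))) (≤-trans (List.length-filter _ D) |D|≤m)))) 8m≤2^J
    contracted : N * Φ X k ≤ 64 * ∑ Ω lost
    contracted = subst (λ z → N * z ≤ 64 * ∑ Ω lost) ∑-deg (contraction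
      (λ S∈ → ≤ᵇ-sound {2 ^ k} (proj₂ (∈-large⁻ {i = i} S∈))) deg≤m removed λ σ j e S∈ j≤J al won →
        cong not (trans (cong (λ Y → free Y e) (nextMarks-mark (Tally.tally 𝒞 ρ σ X) X))
          (trans (cong (λ ph → free (Election.mark (ballots (Tally.tally 𝒞 ρ σ X)) (active (Tally.tally 𝒞 ρ σ X)) X ph) e) (act≡ σ))
          (Election.mark-elected (ballots (Tally.tally 𝒞 ρ σ X)) (active (Tally.tally 𝒞 ρ σ X)) X i {e}
            (Result.elect-alone σ X i S∈ j≤J al won)))))
    -- Not an equality: a set whose gain falls below 2ᵏ leaves this phase together with its
    -- remaining elements.
    Φ-loss : ∀ σ → Φ (nextOf σ X) k + lost σ ≤ Φ X k
    Φ-loss σ = begin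
      Φ X′ k + lost σ
        ≤⟨ +-mono-≤ (∑-mono D kept) (≤-reflexive lost≡) ⟩
      ∑ D (λ S → ⟦ 2 ^ k ≤ᵇ gain X S ⟧ * gain X′ S) + ∑ D (λ S → ⟦ 2 ^ k ≤ᵇ gain X S ⟧ * away S)
        ≡⟨ ∑-+ D _ _ ⟨
      ∑ D (λ S → ⟦ 2 ^ k ≤ᵇ gain X S ⟧ * gain X′ S + ⟦ 2 ^ k ≤ᵇ gain X S ⟧ * away S)
        ≤⟨ ∑-mono D (λ S → ≤-trans (≤-reflexive (sym (*-distribˡ-+ ⟦ 2 ^ k ≤ᵇ gain X S ⟧ (gain X′ S) (away S))))
             (*-monoʳ-≤ ⟦ 2 ^ k ≤ᵇ gain X S ⟧ (split S))) ⟩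
      Φ X k ∎
      where
      X′ = nextOf σ X
      away : Subset n → ℕ
      away S = ∑ E λ e → ⟦ inc X S e ⟧ * ⟦ removed σ e ⟧
      kept : ∀ S → ⟦ 2 ^ k ≤ᵇ gain X′ S ⟧ * gain X′ S ≤ ⟦ 2 ^ k ≤ᵇ gain X S ⟧ * gain X′ S
      kept S = *-monoˡ-≤ (gain X′ S) (⟦⟧-mono {2 ^ k ≤ᵇ gain X′ S} λ h →
        ≤ᵇ-complete (≤-trans (≤ᵇ-sound {2 ^ k} {gain X′ S} h) (gain-mono {X} {X′} (next-free σ X) S)))
      lost≡ : lost σ ≡ ∑ D (λ S → ⟦ 2 ^ k ≤ᵇ gain X S ⟧ * away S)
      lost≡ = trans (∑-cong E λ e → trans (*-comm (deg e) ⟦ removed σ e ⟧) (trans (sym (∑-* F ⟦ removed σ e ⟧ _))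
          (∑-cong F λ S → *-comm ⟦ removed σ e ⟧ ⟦ inc X S e ⟧)))
        (trans (∑-swap E F (λ e S → ⟦ inc X S e ⟧ * ⟦ removed σ e ⟧)) (∑-filterᵇ _ D away))
      pointwise : ∀ s x x′ → (x′ ≡ true → x ≡ true) → ⟦ s ∧ x′ ⟧ + ⟦ s ∧ x ⟧ * ⟦ not x′ ⟧ ≤ ⟦ s ∧ x ⟧
      pointwise false _     _     _ = z≤n
      pointwise true  true  true  _ = ≤-refl
      pointwise true  true  false _ = ≤-refl
      pointwise true  false true  h = contradiction (h refl) λ ()
      pointwise true  false false _ = ≤-refl
      split : ∀ S → gain X′ S + away S ≤ gain X S
      split S = ≤-trans (≤-reflexive (sym (∑-+ E _ _)))
        (∑-mono E λ e → pointwise (lookup S e) (free X e) (free X′ e) (next-free σ X e))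
    64Y≤ : 64 * Y ≤ 63 * (N * Φ X k)
    64Y≤ = +-cancelʳ-≤ (N * Φ X k) (64 * Y) (63 * (N * Φ X k)) (begin
      64 * Y + N * Φ X k                  ≤⟨ +-monoʳ-≤ (64 * Y) contracted ⟩
      64 * Y + 64 * ∑ Ω lost              ≡⟨ *-distribˡ-+ 64 Y (∑ Ω lost) ⟨
      64 * (Y + ∑ Ω lost)                 ≡⟨ cong (64 *_) (∑-+ Ω _ lost) ⟨
      64 * ∑ Ω (λ σ → Φ (nextOf σ X) k + lost σ)  ≤⟨ *-monoʳ-≤ 64 (∑-mono Ω Φ-loss) ⟩
      64 * ∑ Ω (λ _ → Φ X k)              ≡⟨ cong (64 *_) (∑-const Ω (Φ X k)) ⟩
      64 * (N * Φ X k)                    ≡⟨ regroup₄ (N * Φ X k) ⟩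
      63 * (N * Φ X k) + N * Φ X k        ∎)
      where
      regroup₄ : ∀ x → 64 * x ≡ 63 * x + x
      regroup₄ = solve-∀

  contraction-nothing : ∀ X → top X ≡ nothing → ∀ σ → Ψ (nextOf σ X) (suc L) ≡ 0
  contraction-nothing X top≡ σ = Ψ≡0 (suc L)
    where
    gain≡0 : ∀ {S} → S ∈ 𝒞 → gain (nextOf σ X) S ≡ 0
    gain≡0 {S} S∈ = n≤0⇒n≡0 (≤-trans (gain-mono {X} {nextOf σ X} (next-free σ X) S)
      (≤-reflexive (Result.phase-nothing σ X (trans (lastTrue-active σ X) top≡) S∈)))
    Ψ≡0 : ∀ k → Ψ (nextOf σ X) k ≡ 0
    Ψ≡0 zero    = refl
    Ψ≡0 (suc k) = cong₂ _+_ (trans (cong (B ^ k *_) (Φ≡0 {nextOf σ X} {k} λ S∈ →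
      ≤-<-trans (≤-reflexive (gain≡0 S∈)) (m^n>0 2 k))) (*-zeroʳ (B ^ k))) (Ψ≡0 k)

  step-contraction : ∀ X → 128 * ∑ Ω (λ σ → Ψ (nextOf σ X) (suc L)) ≤ 127 * (N * Ψ X (suc L))
  step-contraction X = cases (top X) refl
    where
    cases : ∀ t → top X ≡ t → 128 * ∑ Ω (λ σ → Ψ (nextOf σ X) (suc L)) ≤ 127 * (N * Ψ X (suc L))
    cases (just i) eq = contraction-just X i eq
    cases nothing  eq = ≤-trans (≤-reflexive (trans
      (cong (128 *_) (∑-zero Ω λ σ _ → contraction-nothing X eq σ)) (*-zeroʳ 128))) z≤n

  run : ∀ {R} → Vec (Vec (Vec Bool (suc n)) J) R → Marks n b → Marks n b
  run []       X = X
  run (σ ∷ σs) X = run σs (nextOf σ X)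

  -- The seeds of different rounds are independent and `step-contraction` holds from every state,
  -- hence also conditionally on the rounds before.
  run-contraction : ∀ R X → 128 ^ R * ∑ (vecs Ω R) (λ σs → Ψ (run σs X) (suc L)) ≤
                            127 ^ R * (N ^ R * Ψ X (suc L))
  run-contraction zero    X = ≤-reflexive (cong (_+ 0) (trans (+-identityʳ _) (sym (*-identityˡ (Ψ X (suc L))))))
  run-contraction (suc R) X = begin
    128 ^ suc R * ∑ (vecs Ω (suc R)) (λ σs → Ψ (run σs X) (suc L))
      ≡⟨ cong (128 ^ suc R *_) (∑-vecs Ω R _) ⟩
    128 ^ suc R * ∑ Ω (λ σ → A σ)
      ≡⟨ trans (*-assoc 128 (128 ^ R) _) (cong (128 *_) (sym (∑-* Ω (128 ^ R) A))) ⟩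
    128 * ∑ Ω (λ σ → 128 ^ R * A σ)
      ≤⟨ *-monoʳ-≤ 128 (∑-mono Ω λ σ → run-contraction R (nextOf σ X)) ⟩
    128 * ∑ Ω (λ σ → 127 ^ R * (N ^ R * Ψ (nextOf σ X) (suc L)))
      ≡⟨ cong (128 *_) (trans (∑-* Ω (127 ^ R) _) (cong (127 ^ R *_) (∑-* Ω (N ^ R) _))) ⟩
    128 * (127 ^ R * (N ^ R * ∑ Ω (λ σ → Ψ (nextOf σ X) (suc L))))
      ≡⟨ pull 128 (127 ^ R) (N ^ R) _ ⟩
    127 ^ R * (N ^ R * (128 * ∑ Ω (λ σ → Ψ (nextOf σ X) (suc L))))
      ≤⟨ *-monoʳ-≤ (127 ^ R) (*-monoʳ-≤ (N ^ R) (step-contraction X)) ⟩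
    127 ^ R * (N ^ R * (127 * (N * Ψ X (suc L))))
      ≡⟨ push 127 (127 ^ R) (N ^ R) N (Ψ X (suc L)) ⟩
    127 ^ suc R * (N ^ suc R * Ψ X (suc L)) ∎
    where
    open ≤-Reasoning
    A : Vec (Vec Bool (suc n)) J → ℕ
    A σ = ∑ (vecs Ω R) (λ σs → Ψ (run σs (nextOf σ X)) (suc L))
    pull : ∀ a x y z → a * (x * (y * z)) ≡ x * (y * (a * z))
    pull = solve-∀
    push : ∀ a x y n z → x * (y * (a * (n * z))) ≡ a * x * (n * y * z)
    push = solve-∀

-- The cost of the chosen sets

length-≤-injection : ∀ {A : Set} {b} (f : A → Vec Bool b) {xs : List A} {ys} → Unique xs →
  (∀ {x} → x ∈ xs → f x ∈ ys) → (∀ {x y} → x ∈ xs → y ∈ xs → f x ≡ f y → x ≡ y) → length xs ≤ length ys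
length-≤-injection f {xs} {ys} xs! into inj = begin
  length xs                                               ≡⟨ length-∑ xs ⟩
  ∑ xs (λ _ → 1)                                          ≤⟨ ∑-mono-∈ xs hit ⟩
  ∑ xs (λ x → ∑ ys (λ y → ⟦ names (just (f x)) y ⟧))      ≡⟨ ∑-swap xs ys (λ x y → ⟦ names (just (f x)) y ⟧) ⟩
  ∑ ys (λ y → ∑ xs (λ x → ⟦ names (just (f x)) y ⟧))      ≤⟨ ∑-mono ys once ⟩
  ∑ ys (λ _ → 1)                                          ≡⟨ length-∑ ys ⟨
  length ys                                               ∎
  where
  open ≤-Reasoning
  hit : ∀ x → x ∈ xs → 1 ≤ ∑ ys (λ y → ⟦ names (just (f x)) y ⟧)
  hit x x∈ = ≤-trans (≤-reflexive (cong ⟦_⟧ (sym (names-refl (f x))))) (∑-∈ _ (into x∈))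
  once : ∀ y → ∑ xs (λ x → ⟦ names (just (f x)) y ⟧) ≤ 1
  once y = ∑-at-most-one (λ x → names (just (f x)) y) xs! λ {x} {x′} x∈ x′∈ nx nx′ →
    inj x∈ x′∈ (just-injective (trans (names-sound (just (f x)) nx) (sym (names-sound (just (f x′)) nx′))))

lookup-⋃⁺ : ∀ {n} {𝒯 : Collection n} {S} e → S ∈ 𝒯 → lookup S e ≡ true → lookup (⋃ 𝒯) e ≡ true
lookup-⋃⁺ {𝒯 = T ∷ 𝒯} e (here refl) h = trans (lookup-zipWith _∨_ e T (⋃ 𝒯)) (cong (_∨ lookup (⋃ 𝒯) e) h)
lookup-⋃⁺ {𝒯 = T ∷ 𝒯} e (there S∈)  h = trans (lookup-zipWith _∨_ e T (⋃ 𝒯))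
  (trans (cong (lookup T e ∨_) (lookup-⋃⁺ e S∈ h)) (∨-true (lookup T e)))
  where
  ∨-true : ∀ a → a ∨ true ≡ true
  ∨-true true  = refl
  ∨-true false = refl

lookup-⋃⁻ : ∀ {n} (𝒯 : Collection n) e → lookup (⋃ 𝒯) e ≡ true → ∃[ S ] S ∈ 𝒯 × lookup S e ≡ true
lookup-⋃⁻ []      e h = contradiction (trans (sym (lookup-replicate e false)) h) λ ()
lookup-⋃⁻ (T ∷ 𝒯) e h = cases (lookup T e) refl
  where
  cases : ∀ c → lookup T e ≡ c → ∃[ S ] S ∈ T ∷ 𝒯 × lookup S e ≡ true
  cases true  eq = T , here refl , eq
  cases false eq = let S , S∈ , eS = lookup-⋃⁻ 𝒯 e (trans (sym (cong (_∨ lookup (⋃ 𝒯) e) eq))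
                                        (trans (sym (lookup-zipWith _∨_ e T (⋃ 𝒯))) h)) in S , there S∈ , eS

covers : ∀ {n} (𝒯 : Collection n) → ⋃ 𝒯 ≡ ⊤ → ∀ e → ∃[ S ] S ∈ 𝒯 × lookup S e ≡ true
covers 𝒯 eq e = lookup-⋃⁻ 𝒯 e (trans (cong (λ V → lookup V e) eq) (lookup-replicate e true))

-- The harmonic price of a set with s uncovered elements, scaled by 2ᴸ: an
-- element marked while all sets have fewer than 2ⁱ⁺¹ uncovered ones costs 2⁻ⁱ.
module Price (L : ℕ) where

  price : ℕ → ℕ
  price s = ∑ (allFin (suc L)) λ i → 2 ^ (L ∸ toℕ i) * (s ⊓ 2 ^ suc (toℕ i))

  -- Summand i is linear up to its cap, so it pays in full for the r elements; the other summands
  -- are monotone and cannot rise.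
  price-drop : ∀ (i : Fin (suc L)) r s → r + s ≤ 2 ^ suc (toℕ i) → 2 ^ (L ∸ toℕ i) * r + price s ≤ price (r + s)
  price-drop i r s small = ∑-raise (2 ^ (L ∸ toℕ i) * r)
    (λ j → *-monoʳ-≤ (2 ^ (L ∸ toℕ j)) (⊓-monoˡ-≤ (2 ^ suc (toℕ j)) (m≤n+m s r))) (∈.∈-allFin i) (begin
      2 ^ (L ∸ toℕ i) * r + 2 ^ (L ∸ toℕ i) * (s ⊓ 2 ^ suc (toℕ i)) ≡⟨ *-distribˡ-+ (2 ^ (L ∸ toℕ i)) r _ ⟨
      2 ^ (L ∸ toℕ i) * (r + s ⊓ 2 ^ suc (toℕ i))  ≤⟨ *-monoʳ-≤ (2 ^ (L ∸ toℕ i)) (+-monoʳ-≤ r (m⊓n≤m s _)) ⟩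
      2 ^ (L ∸ toℕ i) * (r + s)                    ≡⟨ cong (2 ^ (L ∸ toℕ i) *_) (m≤n⇒m⊓n≡m small) ⟨
      2 ^ (L ∸ toℕ i) * ((r + s) ⊓ 2 ^ suc (toℕ i)) ∎)
    where open ≤-Reasoning

  -- The cap 2ⁱ⁺¹ cancels the rate 2ᴸ⁻ⁱ, so each phase costs at most the constant 2ᴸ⁺¹. The number L
  -- + 1 of phases becomes the logarithm in the approximation ratio.
  price-bound : ∀ s → price s ≤ suc L * 2 ^ suc L
  price-bound s = begin
    price s                              ≤⟨ ∑-mono (allFin (suc L)) term ⟩
    ∑ (allFin (suc L)) (λ _ → 2 ^ suc L) ≡⟨ ∑-const (allFin (suc L)) (2 ^ suc L) ⟩
    length (allFin (suc L)) * 2 ^ suc L  ≡⟨ cong (_* 2 ^ suc L) (List.length-tabulate {n = suc L} id) ⟩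
    suc L * 2 ^ suc L                    ∎
    where
    open ≤-Reasoning
    term : ∀ i → 2 ^ (L ∸ toℕ i) * (s ⊓ 2 ^ suc (toℕ i)) ≤ 2 ^ suc L
    term i = begin
      2 ^ (L ∸ toℕ i) * (s ⊓ 2 ^ suc (toℕ i))  ≤⟨ *-monoʳ-≤ (2 ^ (L ∸ toℕ i)) (m⊓n≤n s _) ⟩
      2 ^ (L ∸ toℕ i) * 2 ^ suc (toℕ i)        ≡⟨ ^-distribˡ-+-* 2 (L ∸ toℕ i) (suc (toℕ i)) ⟨
      2 ^ (L ∸ toℕ i + suc (toℕ i))            ≡⟨ cong (2 ^_) (trans (+-suc (L ∸ toℕ i) (toℕ i)) (cong suc (m∸n+n≡m (s≤s⁻¹ (toℕ<n i))))) ⟩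
      2 ^ suc L                                ∎

selected : ∀ {n b} → Vec (Vec Bool n) b → Marks n b → Subset n → Bool
selected {n} ρ X S = not (isZero (∑ (allFin n) λ e → ⟦ names (lookup X e) (ident ρ S) ⟧))

module Cost {n b J L m : ℕ} (n≤2^L : n ≤ 2 ^ L) (8m≤2^J : 8 * m ≤ 2 ^ J)
  (𝒞 : Collection n) (|𝒞|≤m : length 𝒞 ≤ m) (ρ : Vec (Vec Bool n) b)
  (inj : ∀ {S T} → S ∈ 𝒞 → T ∈ 𝒞 → ident ρ S ≡ ident ρ T → S ≡ T)
  (𝒪 : Collection n) (𝒪⊆𝒞 : ∀ {S} → S ∈ 𝒪 → S ∈ 𝒞) (⋃𝒪 : ⋃ 𝒪 ≡ ⊤) where

  open Round n b J L
  open Progress {J = J} {L} n≤2^L 8m≤2^J 𝒞 |𝒞|≤m ρ inj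
  open Price L

  -- An amortised account: the sets of 𝒪 start with their full price, and chosen identifiers are
  -- paid for from what this price loses. The list `chosen` exists only in the analysis; the
  -- algorithm stores nothing but the marks.
  record Invariant (X : Marks n b) : Set where
    field
      origin : ∀ {e y} → lookup X e ≡ just y → ∃[ S ] S ∈ 𝒞 × ident ρ S ≡ y × lookup S e ≡ true
      chosen : List (Vec Bool b)
      marked : ∀ {e y} → lookup X e ≡ just y → y ∈ chosen
      paid   : 2 ^ L * length chosen + 4 * ∑ 𝒪 (price ∘ gain X) ≤ 4 * (length 𝒪 * (suc L * 2 ^ suc L))

  unmarked : Marks n b
  unmarked = Vec.replicate n nothing

  invariant-start : Invariant unmarked
  invariant-start = record
    { origin = λ {e} eq → contradiction (trans (sym (lookup-replicate e nothing)) eq) λ ()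
    ; chosen = []
    ; marked = λ {e} eq → contradiction (trans (sym (lookup-replicate e nothing)) eq) λ ()
    ; paid   = begin
        2 ^ L * 0 + 4 * ∑ 𝒪 (price ∘ gain unmarked)   ≡⟨ cong (_+ 4 * ∑ 𝒪 (price ∘ gain unmarked)) (*-zeroʳ (2 ^ L)) ⟩
        4 * ∑ 𝒪 (price ∘ gain unmarked)               ≤⟨ *-monoʳ-≤ 4 (∑-mono 𝒪 λ S → price-bound (gain unmarked S)) ⟩
        4 * ∑ 𝒪 (λ _ → suc L * 2 ^ suc L)             ≡⟨ cong (4 *_) (∑-const 𝒪 (suc L * 2 ^ suc L)) ⟩
        4 * (length 𝒪 * (suc L * 2 ^ suc L))          ∎
    }
    where open ≤-Reasoning

  module _ (σ : Vec (Vec Bool (suc n)) J) {X : Marks n b} (inv : Invariant X) where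

    open Invariant inv
    private c = Tally.tally 𝒞 ρ σ X
    open Election (ballots c) (active c) X
    module R = Result σ X
    open R using (newly; elected)

    origin′ : ∀ ph {e y} → lookup (mark ph) e ≡ just y → ∃[ S ] S ∈ 𝒞 × ident ρ S ≡ y × lookup S e ≡ true
    origin′ ph {e} eq with mark-origin ph eq
    ... | inj₁ old       = origin old
    ... | inj₂ (i , own) = let S , S∈ , id≡ , incS = R.owner-sound {i} {e} own in S , S∈ , id≡ , ∧-trueˡ incS

    -- Every newly marked element lies in some set of the cover 𝒪, so the bill of `elected-cost` can
    -- be passed on to 𝒪. By `phase-just` the gains of its sets are under the cap that `price-drop`
    -- requires.
    paid′ : ∀ i → lastTrue (active c) ≡ just i →
            2 ^ L * length (elected i ++ chosen) + 4 * ∑ 𝒪 (price ∘ gain (mark (just i))) ≤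
            4 * (length 𝒪 * (suc L * 2 ^ suc L))
    paid′ i ph≡ = begin
      2 ^ L * length (elected i ++ chosen) + 4 * P′
        ≡⟨ cong (λ z → 2 ^ L * z + 4 * P′) (List.length-++ (elected i)) ⟩
      2 ^ L * (length (elected i) + length chosen) + 4 * P′
        ≡⟨ regroup₁ (2 ^ L) (length (elected i)) (length chosen) P′ ⟩
      2 ^ L * length chosen + (2 ^ L * length (elected i) + 4 * P′)
        ≤⟨ +-monoʳ-≤ (2 ^ L * length chosen) (≤-trans (+-monoˡ-≤ (4 * P′) charge) (≤-reflexive (sym (*-distribˡ-+ 4 (2 ^ (L ∸ toℕ i) * ∑ 𝒪 fresh) P′)))) ⟩
      2 ^ L * length chosen + 4 * (2 ^ (L ∸ toℕ i) * ∑ 𝒪 fresh + P′)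
        ≤⟨ +-monoʳ-≤ (2 ^ L * length chosen) (*-monoʳ-≤ 4 drop) ⟩
      2 ^ L * length chosen + 4 * ∑ 𝒪 (price ∘ gain X)
        ≤⟨ paid ⟩
      4 * (length 𝒪 * (suc L * 2 ^ suc L)) ∎
      where
      open ≤-Reasoning
      X′ = mark (just i)
      P′ = ∑ 𝒪 (price ∘ gain X′)
      fresh : Subset n → ℕ
      fresh S = ∑ E λ f → ⟦ lookup S f ∧ newly i f ⟧
      regroup₁ : ∀ x a b p → x * (a + b) + 4 * p ≡ x * b + (x * a + 4 * p)
      regroup₁ = solve-∀
      regroup₂ : ∀ x y → x * (4 * y) ≡ 4 * (x * y)
      regroup₂ = solve-∀
      charge : 2 ^ L * length (elected i) ≤ 4 * (2 ^ (L ∸ toℕ i) * ∑ 𝒪 fresh)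
      charge = begin
        2 ^ L * length (elected i)
          ≡⟨ cong (λ z → 2 ^ z * length (elected i)) (m∸n+n≡m (s≤s⁻¹ (toℕ<n i))) ⟨
        2 ^ (L ∸ toℕ i + toℕ i) * length (elected i)
          ≡⟨ trans (cong (_* length (elected i)) (^-distribˡ-+-* 2 (L ∸ toℕ i) (toℕ i))) (*-assoc (2 ^ (L ∸ toℕ i)) _ _) ⟩
        2 ^ (L ∸ toℕ i) * (2 ^ toℕ i * length (elected i))
          ≤⟨ *-monoʳ-≤ (2 ^ (L ∸ toℕ i)) (R.elected-cost i) ⟩
        2 ^ (L ∸ toℕ i) * (4 * ∑ E (λ f → ⟦ newly i f ⟧))
          ≡⟨ regroup₂ (2 ^ (L ∸ toℕ i)) _ ⟩
        4 * (2 ^ (L ∸ toℕ i) * ∑ E (λ f → ⟦ newly i f ⟧))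
          ≤⟨ *-monoʳ-≤ 4 (*-monoʳ-≤ (2 ^ (L ∸ toℕ i)) (≤-trans (∑-mono E in-optimum) (≤-reflexive (∑-swap E 𝒪 (λ f S → ⟦ lookup S f ∧ newly i f ⟧))))) ⟩
        4 * (2 ^ (L ∸ toℕ i) * ∑ 𝒪 fresh) ∎
        where
        in-optimum : ∀ f → ⟦ newly i f ⟧ ≤ ∑ 𝒪 (λ S → ⟦ lookup S f ∧ newly i f ⟧)
        in-optimum f = let S , S∈ , Sf = covers 𝒪 ⋃𝒪 f in
          ≤-trans (≤-reflexive (cong (λ z → ⟦ z ∧ newly i f ⟧) (sym Sf))) (∑-∈ (λ S → ⟦ lookup S f ∧ newly i f ⟧) S∈)
      pointwise : ∀ s x x′ → (x′ ≡ true → x ≡ true) → ⟦ s ∧ x ⟧ ≡ ⟦ s ∧ (x ∧ not x′) ⟧ + ⟦ s ∧ x′ ⟧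
      pointwise false _     _     _ = refl
      pointwise true  true  true  _ = refl
      pointwise true  true  false _ = refl
      pointwise true  false true  h = contradiction (h refl) λ ()
      pointwise true  false false _ = refl
      gain-split : ∀ S → gain X S ≡ fresh S + gain X′ S
      gain-split S = trans (∑-cong E λ f → pointwise (lookup S f) (free X f) (free X′ f) (mark-free (just i) f)) (∑-+ E _ _)
      drop : 2 ^ (L ∸ toℕ i) * ∑ 𝒪 fresh + P′ ≤ ∑ 𝒪 (price ∘ gain X)
      drop = begin
        2 ^ (L ∸ toℕ i) * ∑ 𝒪 fresh + P′
          ≡⟨ trans (cong (_+ P′) (sym (∑-* 𝒪 (2 ^ (L ∸ toℕ i)) fresh))) (sym (∑-+ 𝒪 _ _)) ⟩
        ∑ 𝒪 (λ S → 2 ^ (L ∸ toℕ i) * fresh S + price (gain X′ S))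
          ≤⟨ ∑-mono-∈ 𝒪 (λ S S∈ → ≤-trans (price-drop i (fresh S) (gain X′ S)
               (subst (_≤ 2 ^ suc (toℕ i)) (gain-split S) (<⇒≤ (proj₂ (R.phase-just ph≡) (𝒪⊆𝒞 S∈)))))
               (≤-reflexive (cong price (sym (gain-split S))))) ⟩
        ∑ 𝒪 (price ∘ gain X) ∎

    invariant-mark : ∀ ph → lastTrue (active c) ≡ ph → Invariant (mark ph)
    invariant-mark nothing  _   = inv
    invariant-mark (just i) ph≡ = record
      { origin = origin′ (just i)
      ; chosen = elected i ++ chosen
      ; marked = λ {e} {y} eq → marked′ e y eq (lookup X e) refl
      ; paid   = paid′ i ph≡
      }
      where
      marked′ : ∀ e y → lookup (mark (just i)) e ≡ just y → ∀ x → lookup X e ≡ x → y ∈ elected i ++ chosen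
      marked′ e y eq x Xe = cases x Xe (trans (sym (trans (lookup∘tabulate _ e) (cong (_<∣> elect i e) Xe))) eq)
        where
        cases : ∀ x → lookup X e ≡ x → (x <∣> elect i e) ≡ just y → y ∈ elected i ++ chosen
        cases (just _) Xe refl = ∈.∈-++⁺ʳ (elected i) (marked Xe)
        cases nothing  Xe el   = ∈.∈-++⁺ˡ (R.elected-complete {i} {e} el)

  invariant-run : ∀ {R} (σs : Vec (Vec (Vec Bool (suc n)) J) R) {X} → Invariant X → Invariant (run σs X)
  invariant-run []       inv = inv
  invariant-run (σ ∷ σs) {X} inv = invariant-run σs
    (subst Invariant (sym (nextMarks-mark (Tally.tally 𝒞 ρ σ X) X)) (invariant-mark σ inv _ refl))

  approximation : ⋃ 𝒞 ≡ ⊤ → ∀ {X} → Invariant X → Ψ X (suc L) ≡ 0 →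
    IsApproximation (8 * suc L) 𝒞 𝒪 (deduplicate _≟ₛ_ (filterᵇ (selected ρ X) 𝒞))
  approximation ⋃𝒞 {X} inv Ψ≡0 = (⊆𝒞 , ⊤-ext covered) , size-bound
    where
    open Invariant inv
    𝒯 = deduplicate _≟ₛ_ (filterᵇ (selected ρ X) 𝒞)
    𝒯⁻ : ∀ {S} → S ∈ 𝒯 → S ∈ 𝒞 × selected ρ X S ≡ true
    𝒯⁻ S∈ = ∈-filterᵇ⁻ (selected ρ X) 𝒞 (∈.∈-deduplicate⁻ _≟ₛ_ (filterᵇ (selected ρ X) 𝒞) S∈)
    ⊆𝒞 : ∀ {S} → S ∈ 𝒯 → S ∈ 𝒞
    ⊆𝒞 S∈ = proj₁ (𝒯⁻ S∈)
    ⊤-ext : ∀ {k} {V : Subset k} → (∀ e → lookup V e ≡ true) → V ≡ ⊤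
    ⊤-ext {V = V} h = trans (sym (tabulate∘lookup V)) (trans
      (tabulate-cong λ e → trans (h e) (sym (lookup-replicate e true))) (tabulate∘lookup ⊤))
    covered : ∀ e → lookup (⋃ 𝒯) e ≡ true
    covered e = cases (lookup X e) refl
      where
      cases : ∀ x → lookup X e ≡ x → lookup (⋃ 𝒯) e ≡ true
      cases nothing  eq = let S , S∈ , Se = covers 𝒞 ⋃𝒞 e in contradiction Ψ≡0 (n>0⇒n≢0 (Ψ-positive {X} S∈
        (≤-trans (≤-reflexive (cong ⟦_⟧ (sym (∧-true {lookup S e} Se (cong is-nothing eq))))) (∑-∈ (λ f → ⟦ inc X S f ⟧) (∈.∈-allFin e))) L))
      cases (just y) eq = let S , S∈ , id≡ , Se = origin eq in
        lookup-⋃⁺ e (∈.∈-deduplicate⁺ _≟ₛ_ (∈-filterᵇ⁺ (selected ρ X) S∈ (positive (≤-trans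
          (≤-reflexive (cong ⟦_⟧ (sym (trans (cong₂ names eq id≡) (names-refl y)))))
          (∑-∈ (λ f → ⟦ names (lookup X f) (ident ρ S) ⟧) (∈.∈-allFin e)))))) Se
        where
        positive : ∀ {k} → 1 ≤ k → not (isZero k) ≡ true
        positive {suc k} _ = refl
    known : ∀ {S} → S ∈ 𝒯 → ident ρ S ∈ chosen
    known {S} S∈ = let e , _ , named = ∑>0⇒ E (λ f → ⟦ names (lookup X f) (ident ρ S) ⟧) (nonzero (proj₂ (𝒯⁻ S∈)))
                   in marked {e} (names-sound (lookup X e) (positive _ named))
      where
      nonzero : ∀ {k} → not (isZero k) ≡ true → 0 < k
      nonzero {suc k} _ = z<s
      positive : ∀ c → 0 < ⟦ c ⟧ → c ≡ true
      positive true _ = refl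
    -- 8 = 4 · 2: the 4 comes from the follower threshold 2ⁱ/4, the 2 from the cap 2ⁱ⁺¹ on the gains
    -- in phase i.
    chosen-bound : length chosen ≤ 8 * suc L * length 𝒪
    chosen-bound = *-cancelˡ-≤ (2 ^ L) ⦃ m^n≢0 2 L ⦄ (≤-trans (m≤m+n _ _) (≤-trans paid
      (≤-reflexive (regroup (length 𝒪) (suc L) (2 ^ L)))))
      where
      regroup : ∀ o l x → 4 * (o * (l * (2 * x))) ≡ x * (8 * l * o)
      regroup = solve-∀
    -- Recognising sets by their identifiers selects no stray ones: distinct selected sets have
    -- distinct identifiers, all of which are in `chosen`.
    size-bound : length 𝒯 ≤ 8 * suc L * length 𝒪
    size-bound = ≤-trans (length-≤-injection (ident ρ) (deduplicate-! _≟ₛ_ (filterᵇ (selected ρ X) 𝒞)) known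
      λ S∈ T∈ → inj (⊆𝒞 S∈) (⊆𝒞 T∈)) chosen-bound

-- Coins and the failure probability

∑-allFin-suc : ∀ {k} (h : Fin (suc k) → ℕ) → ∑ (allFin (suc k)) h ≡ h zero + ∑ (allFin k) (h ∘ suc)
∑-allFin-suc {k} h = cong (h zero +_) (trans (cong (λ xs → ∑ xs h) (sym (List.map-tabulate id suc))) (∑-map suc (allFin k) h))

∑-allFin-+ : ∀ j k (h : Fin (j + k) → ℕ) →
             ∑ (allFin (j + k)) h ≡ ∑ (allFin j) (h ∘ (_↑ˡ k)) + ∑ (allFin k) (h ∘ (j ↑ʳ_))
∑-allFin-+ zero    k h = refl
∑-allFin-+ (suc j) k h = trans (∑-allFin-suc h) (trans (cong (h zero +_) (∑-allFin-+ j k (h ∘ suc)))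
  (trans (sym (+-assoc (h zero) _ _)) (cong (_+ ∑ (allFin k) (h ∘ (suc j ↑ʳ_))) (sym (∑-allFin-suc (h ∘ (_↑ˡ k)))))))

∑-allFin-* : ∀ j k (h : Fin (j * k) → ℕ) → ∑ (allFin (j * k)) h ≡ ∑ (allFin j) λ x → ∑ (allFin k) λ y → h (combine x y)
∑-allFin-* zero    k h = refl
∑-allFin-* (suc j) k h = trans (∑-allFin-+ k (j * k) h) (trans
  (cong (∑ (allFin k) (h ∘ (_↑ˡ (j * k))) +_) (∑-allFin-* j k (h ∘ (k ↑ʳ_))))
  (sym (∑-allFin-suc {j} (λ x → ∑ (allFin k) λ y → h (combine x y)))))

∑-cast : ∀ {j k} (eq : j ≡ k) (h : Fin k → ℕ) → ∑ (allFin j) (h ∘ cast eq) ≡ ∑ (allFin k) h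
∑-cast refl h = ∑-cong (allFin _) λ i → cong h (Fin.cast-is-id refl i)

-- Decoded fair bits have the counting measure on `xs` as their distribution, so `Pr` over the coins
-- becomes a sum over seeds.
Uniform : ∀ {A b} → Code A b → List A → Set
Uniform {b = b} c xs = ∀ f → ∑ (allFin (2 ^ b)) (f ∘ dec c) ≡ ∑ xs f

uniform-bool : Uniform boolᶜ bools
uniform-bool f = trans (cong (f false +_) (+-identityʳ (f true)))
  (trans (+-comm (f false) (f true)) (cong (f true +_) (sym (+-identityʳ (f false)))))

uniform-× : ∀ {A B a b} (c : Code A a) (d : Code B b) xs ys → Uniform c xs → Uniform d ys →
            ∀ f → ∑ (allFin (2 ^ (a + b))) (f ∘ dec (c ×ᶜ d)) ≡ ∑ xs λ x → ∑ ys λ y → f (x , y)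
uniform-× {A} {B} {a} {b} c d xs ys uc ud f = begin
  ∑ (allFin (2 ^ (a + b))) (f ∘ dec (c ×ᶜ d))
    ≡⟨ ∑-cast (^-distribˡ-+-* 2 a b) (g ∘ remQuot (2 ^ b)) ⟩
  ∑ (allFin (2 ^ a * 2 ^ b)) (g ∘ remQuot (2 ^ b))
    ≡⟨ ∑-allFin-* (2 ^ a) (2 ^ b) _ ⟩
  ∑ (allFin (2 ^ a)) (λ i → ∑ (allFin (2 ^ b)) λ j → g (remQuot (2 ^ b) (combine i j)))
    ≡⟨ ∑-cong (allFin (2 ^ a)) (λ i → trans (∑-cong (allFin (2 ^ b)) λ j → cong g (remQuot-combine i j))
         (ud (λ y → f (dec c i , y)))) ⟩
  ∑ (allFin (2 ^ a)) (λ i → ∑ ys λ y → f (dec c i , y))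
    ≡⟨ uc (λ x → ∑ ys λ y → f (x , y)) ⟩
  ∑ xs (λ x → ∑ ys λ y → f (x , y)) ∎
  where
  open ≡-Reasoning
  g : Bits a × Bits b → ℕ
  g (i , j) = f (dec c i , dec d j)

uniform-vec : ∀ {A b} (c : Code A b) xs → Uniform c xs → ∀ k → Uniform (vecᶜ c k) (vecs xs k)
uniform-vec c xs uc zero    f = refl
uniform-vec c xs uc (suc k) f =
  trans (uniform-× c (vecᶜ c k) xs (vecs xs k) uc (uniform-vec c xs uc k) (λ (x , v) → f (x ∷ v))) (sym (∑-vecs xs k f))

module _ {A : Set} (default : A) where

  at : ∀ {k} → Vec A k → ℕ → A
  at []       _       = default
  at (x ∷ xs) zero    = x
  at (x ∷ xs) (suc t) = at xs t

  -- Dropping the used seed and padding at the end keeps the memory format fixed and replaces a pass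
  -- counter: the current seed is always at position 0.
  shift : ∀ {k} → Vec A k → Vec A k
  shift []       = []
  shift (x ∷ xs) = xs Vec.∷ʳ default

  at-∷ʳ : ∀ {k} (xs : Vec A k) t → at (xs Vec.∷ʳ default) t ≡ at xs t
  at-∷ʳ []       zero    = refl
  at-∷ʳ []       (suc t) = refl
  at-∷ʳ (x ∷ xs) zero    = refl
  at-∷ʳ (x ∷ xs) (suc t) = at-∷ʳ xs t

  at-shift : ∀ {k} (xs : Vec A k) t → at (shift xs) t ≡ at xs (suc t)
  at-shift []       t = refl
  at-shift (x ∷ xs) t = at-∷ʳ xs t

n≤2^⌈log₂n⌉ : ∀ n → n ≤ 2 ^ ⌈log₂ n ⌉
n≤2^⌈log₂n⌉ = <-rec _ λ
  { zero          _   → z≤n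
  ; (suc zero)    _   → s≤s z≤n
  ; (suc (suc n)) rec → halve (suc (suc n)) (s≤s (s≤s z≤n)) (rec (⌈n/2⌉<n n))
  }
  where
  open ≤-Reasoning
  halve : ∀ n → 2 ≤ n → ⌈ n /2⌉ ≤ 2 ^ ⌈log₂ ⌈ n /2⌉ ⌉ → n ≤ 2 ^ ⌈log₂ n ⌉
  halve n 2≤n half = begin
    n                              ≡⟨ ⌊n/2⌋+⌈n/2⌉≡n n ⟨
    ⌊ n /2⌋ + ⌈ n /2⌉              ≤⟨ +-mono-≤ (⌊n/2⌋≤⌈n/2⌉ n) (≤-reflexive (sym (+-identityʳ _))) ⟩
    2 * ⌈ n /2⌉                    ≤⟨ *-monoʳ-≤ 2 half ⟩
    2 ^ suc ⌈log₂ ⌈ n /2⌉ ⌉        ≡⟨ cong (λ z → 2 ^ suc z) (⌈log₂⌈n/2⌉⌉≡⌈log₂n⌉∸1 n) ⟩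
    2 ^ suc (⌈log₂ n ⌉ ∸ 1)        ≡⟨ cong (2 ^_) (m+[n∸m]≡n {1} (⌈log₂⌉-mono-≤ 2≤n)) ⟩
    2 ^ ⌈log₂ n ⌉                  ∎

-- (128/127)⁸⁹ ≥ 2.
rounds-suffice : ∀ E → 127 ^ (89 * E) * 2 ^ E ≤ 128 ^ (89 * E)
rounds-suffice E = begin
  127 ^ (89 * E) * 2 ^ E     ≡⟨ cong (_* 2 ^ E) (sym (^-*-assoc 127 89 E)) ⟩
  (127 ^ 89) ^ E * 2 ^ E     ≡⟨ power-* (127 ^ 89) 2 E ⟨
  (127 ^ 89 * 2) ^ E         ≤⟨ ^-monoˡ-≤ E (≤ᵇ⇒≤ (127 ^ 89 * 2) (128 ^ 89) _) ⟩
  (128 ^ 89) ^ E             ≡⟨ ^-*-assoc 128 89 E ⟩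
  128 ^ (89 * E)             ∎
  where
  open ≤-Reasoning
  power-* : ∀ x y E → (x * y) ^ E ≡ x ^ E * y ^ E
  power-* x y zero    = refl
  power-* x y (suc E) = trans (cong (x * y *_) (power-* x y E)) (interchange x y (x ^ E) (y ^ E))
    where
    interchange : ∀ a b c d → a * b * (c * d) ≡ a * c * (b * d)
    interchange = solve-∀

module FailureProbability {n J L m b R Q : ℕ} (n≤2^L : n ≤ 2 ^ L) (8m≤2^J : 8 * m ≤ 2 ^ J)
  (Qm²≤2^b : 2 * Q * (m * m) ≤ 2 ^ b)
  (rounds : 127 ^ R * (2 * Q * (suc (2 * m) ^ suc L * 2 ^ L)) ≤ 128 ^ R)
  (𝒞 : Collection n) (|𝒞|≤m : length 𝒞 ≤ m) where

  D = deduplicate _≟ₛ_ 𝒞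
  Ω₀ = vecs (vecs bools n) b
  Ω = vecs (seeds n J) R
  N₀ = length Ω₀
  N = length Ω

  unmarked : Marks n b
  unmarked = Vec.replicate n nothing

  collisions : Vec (Vec Bool n) b → ℕ
  collisions ρ = ∑ D λ S → ∑ D λ T → ⟦ distinct S T ∧ sameIdent S T ρ ⟧

  collisions≡0⇒injective : ∀ {ρ} → collisions ρ ≡ 0 → ∀ {S T} → S ∈ 𝒞 → T ∈ 𝒞 → ident ρ S ≡ ident ρ T → S ≡ T
  collisions≡0⇒injective {ρ} none {S} {T} S∈ T∈ id≡ with S ≟ₛ T
  ... | yes S≡T = S≡T
  ... | no  S≢T = contradiction (trans (sym (cong ⟦_⟧ (∧-true (distinct-≢ S≢T) (ident-≡⇒sameIdent ρ id≡))))
    (∑≡0⇒ (λ T → ⟦ distinct S T ∧ sameIdent S T ρ ⟧)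
      (∑≡0⇒ (λ S → ∑ D λ T → ⟦ distinct S T ∧ sameIdent S T ρ ⟧) none (∈.∈-deduplicate⁺ _≟ₛ_ S∈)) (∈.∈-deduplicate⁺ _≟ₛ_ T∈))) λ ()

  |D|≤m : length D ≤ m
  |D|≤m = ≤-trans (List.length-deduplicate _≟ₛ_ 𝒞) |𝒞|≤m

  ∑-collisions : 2 ^ b * ∑ Ω₀ collisions ≤ m * m * N₀
  ∑-collisions = begin
    2 ^ b * ∑ Ω₀ collisions
      ≡⟨ cong (2 ^ b *_) (trans (∑-swap Ω₀ D _) (∑-cong D λ S → ∑-swap Ω₀ D _)) ⟩
    2 ^ b * ∑ D (λ S → ∑ D λ T → ∑ Ω₀ (λ ρ → ⟦ distinct S T ∧ sameIdent S T ρ ⟧))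
      ≡⟨ trans (sym (∑-* D (2 ^ b) _)) (∑-cong D λ S → sym (∑-* D (2 ^ b) _)) ⟩
    ∑ D (λ S → ∑ D λ T → 2 ^ b * ∑ Ω₀ (λ ρ → ⟦ distinct S T ∧ sameIdent S T ρ ⟧))
      ≤⟨ ∑-mono D (λ S → ∑-mono D λ T → pair S T (S ≟ₛ T)) ⟩
    ∑ D (λ S → ∑ D λ T → N₀)
      ≡⟨ trans (∑-const D _) (cong (length D *_) (∑-const D N₀)) ⟩
    length D * (length D * N₀)
      ≤⟨ *-mono-≤ |D|≤m (*-monoˡ-≤ N₀ |D|≤m) ⟩
    m * (m * N₀)
      ≡⟨ *-assoc m m N₀ ⟨
    m * m * N₀ ∎
    where
    open ≤-Reasoning
    pair : ∀ S T → Dec (S ≡ T) → 2 ^ b * ∑ Ω₀ (λ ρ → ⟦ distinct S T ∧ sameIdent S T ρ ⟧) ≤ N₀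
    pair S T (yes S≡T) = ≤-trans (≤-reflexive (trans (cong (2 ^ b *_) (∑-zero Ω₀ λ ρ _ →
      cong (λ c → ⟦ c ∧ sameIdent S T ρ ⟧) (distinct-≡ S≡T))) (*-zeroʳ (2 ^ b)))) z≤n
    pair S T (no  S≢T) = ≤-reflexive (trans (cong (2 ^ b *_) (∑-cong Ω₀ λ ρ →
      cong (λ c → ⟦ c ∧ sameIdent S T ρ ⟧) (distinct-≢ S≢T)))
      (trans (ident-collision b S≢T) (sym (trans (length-vecs (vecs bools n) b) (cong (_^ b) (length-vecs bools n))))))

  module Run ρ (none : collisions ρ ≡ 0) = Progress {J = J} {L} n≤2^L 8m≤2^J 𝒞 |𝒞|≤m ρ (collisions≡0⇒injective none)

  -- A number that bounds the failure indicator from above: 1 after a collision, otherwise the final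
  -- potential. The decision is an argument because the run is analysed only under injective
  -- identifiers.
  remaining : ∀ ρ → Dec (collisions ρ ≡ 0) → Vec (Vec (Vec Bool (suc n)) J) R → ℕ
  remaining ρ (yes none) σs = Run.Ψ ρ none (Run.run ρ none σs unmarked) (suc L)
  remaining ρ (no  _)    σs = 1

  failures : Vec (Vec Bool n) b × Vec (Vec (Vec Bool (suc n)) J) R → ℕ
  failures (ρ , σs) = remaining ρ (collisions ρ ≟ 0) σs

  -- The two kinds of failure are charged to different summands. A collision makes `collisions ρ` at
  -- least 1; without one, `rounds` says that the decay over `R` rounds brings the expected
  -- potential down to 1/(2Q).
  ∑-remaining : ∀ ρ d → 2 * Q * ∑ Ω (remaining ρ d) ≤ 2 * Q * (N * collisions ρ) + N
  ∑-remaining ρ (no some) = ≤-trans (*-monoʳ-≤ (2 * Q) (≤-trans (≤-reflexive (∑-const Ω 1))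
    (*-monoʳ-≤ N (n≢0⇒n>0 some)))) (m≤m+n (2 * Q * (N * collisions ρ)) N)
  ∑-remaining ρ (yes none) = ≤-trans (*-cancelˡ-≤ (128 ^ R) ⦃ m^n≢0 128 R ⦄ (begin
    128 ^ R * (2 * Q * Y)                            ≡⟨ regroup₁ (128 ^ R) (2 * Q) Y ⟩
    2 * Q * (128 ^ R * Y)                            ≤⟨ *-monoʳ-≤ (2 * Q) (run-contraction R unmarked) ⟩
    2 * Q * (127 ^ R * (length (seeds n J) ^ R * Ψ unmarked (suc L)))
      ≡⟨ cong (λ z → 2 * Q * (127 ^ R * (z * Ψ unmarked (suc L)))) (length-vecs (seeds n J) R) ⟨
    2 * Q * (127 ^ R * (N * Ψ unmarked (suc L)))
      ≤⟨ *-monoʳ-≤ (2 * Q) (*-monoʳ-≤ (127 ^ R) (*-monoʳ-≤ N (Ψ-below {unmarked} {L}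
           (λ {S} _ → ≤-<-trans (≤-trans (gain≤n unmarked S) n≤2^L) (^-monoʳ-< 2 (s≤s (s≤s z≤n)) (n<1+n L))) (suc L)))) ⟩
    2 * Q * (127 ^ R * (N * (suc (2 * m) ^ suc L * 2 ^ L)))
      ≡⟨ regroup₂ (2 * Q) (127 ^ R) N (suc (2 * m) ^ suc L * 2 ^ L) ⟩
    127 ^ R * (2 * Q * (suc (2 * m) ^ suc L * 2 ^ L)) * N
      ≤⟨ *-monoˡ-≤ N rounds ⟩
    128 ^ R * N                                      ∎)) (m≤n+m N (2 * Q * (N * collisions ρ)))
    where
    open ≤-Reasoning
    open Run ρ none using (Ψ; run-contraction; Ψ-below)
    Y = ∑ Ω (remaining ρ (yes none))
    regroup₁ : ∀ x y z → x * (y * z) ≡ y * (x * z)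
    regroup₁ = solve-∀
    regroup₂ : ∀ x y n z → x * (y * (n * z)) ≡ y * (x * z) * n
    regroup₂ = solve-∀

  -- The failure budget 1/Q is split evenly between a union bound over ordered pairs of sets, for
  -- the identifiers, and the expected final potential, for the rounds.
  ∑-failures : Q * ∑ Ω₀ (λ ρ → ∑ Ω λ σs → failures (ρ , σs)) ≤ N₀ * N
  ∑-failures = *-cancelˡ-≤ 2 (begin
    2 * (Q * F)                                         ≡⟨ *-assoc 2 Q F ⟨
    2 * Q * F                                           ≡⟨ ∑-* Ω₀ (2 * Q) _ ⟨
    ∑ Ω₀ (λ ρ → 2 * Q * ∑ Ω λ σs → failures (ρ , σs))   ≤⟨ ∑-mono Ω₀ (λ ρ → ∑-remaining ρ (collisions ρ ≟ 0)) ⟩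
    ∑ Ω₀ (λ ρ → 2 * Q * (N * collisions ρ) + N)
      ≡⟨ trans (∑-+ Ω₀ _ _) (cong₂ _+_ (trans (∑-* Ω₀ (2 * Q) _) (cong (2 * Q *_) (∑-* Ω₀ N collisions))) (∑-const Ω₀ N)) ⟩
    2 * Q * (N * ∑ Ω₀ collisions) + N₀ * N
      ≡⟨ cong (_+ N₀ * N) (regroup₁ (2 * Q) N (∑ Ω₀ collisions)) ⟩
    2 * Q * ∑ Ω₀ collisions * N + N₀ * N
      ≤⟨ +-monoˡ-≤ (N₀ * N) (*-monoˡ-≤ N few) ⟩
    N₀ * N + N₀ * N                                     ≡⟨ cong (N₀ * N +_) (+-identityʳ (N₀ * N)) ⟨
    2 * (N₀ * N)                                        ∎)
    where
    open ≤-Reasoning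
    F = ∑ Ω₀ (λ ρ → ∑ Ω λ σs → failures (ρ , σs))
    regroup₁ : ∀ x y z → x * (y * z) ≡ x * z * y
    regroup₁ = solve-∀
    regroup₂ : ∀ x y z → x * (y * z) ≡ y * (x * z)
    regroup₂ = solve-∀
    few : 2 * Q * ∑ Ω₀ collisions ≤ N₀
    few = *-cancelˡ-≤ (2 ^ b) ⦃ m^n≢0 2 b ⦄ (begin
      2 ^ b * (2 * Q * ∑ Ω₀ collisions)   ≡⟨ regroup₂ (2 ^ b) (2 * Q) (∑ Ω₀ collisions) ⟩
      2 * Q * (2 ^ b * ∑ Ω₀ collisions)   ≤⟨ *-monoʳ-≤ (2 * Q) ∑-collisions ⟩
      2 * Q * (m * m * N₀)                ≡⟨ *-assoc (2 * Q) (m * m) N₀ ⟨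
      2 * Q * (m * m) * N₀                ≤⟨ *-monoˡ-≤ N₀ Qm²≤2^b ⟩
      2 ^ b * N₀                          ∎)

-- The algorithm

module Protocol (n b J L R w : ℕ) where

  open Round n b J L

  Seed : Set
  Seed = Vec (Vec Bool (suc n)) J

  noSeed : Seed
  noSeed = Vec.replicate J (Vec.replicate (suc n) false)

  unmarked : Marks n b
  unmarked = Vec.replicate n nothing

  coins : ℕ
  coins = b * (n * 1) + R * (J * (suc n * 1))

  identᶜ : Code (Vec (Vec Bool n) b) (b * (n * 1))
  identᶜ = vecᶜ (vecᶜ boolᶜ n) b

  seedsᶜ : Code (Vec Seed R) (R * (J * (suc n * 1)))
  seedsᶜ = vecᶜ (vecᶜ (vecᶜ boolᶜ (suc n)) J) R

  coinsᶜ : Code (Vec (Vec Bool n) b × Vec Seed R) coins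
  coinsᶜ = identᶜ ×ᶜ seedsᶜ

  -- The seeds of all rounds are carried along from the first pass on. This is affordable because
  -- pairwise independence needs only R · J · (n + 1) bits.
  Memory : Set
  Memory = (Vec (Vec Bool n) b × Vec Seed R) × Marks n b

  memoryᶜ : Code Memory (coins + n * suc (b * 1))
  memoryᶜ = coinsᶜ ×ᶜ vecᶜ (maybeᶜ (vecᶜ boolᶜ b)) n

  ask : Memory → Fin q → Subset n → Bool
  ask ((ρ , σs) , X) = query ρ (at noSeed σs 0) X

  advance : Memory → Vec ℕ q → Memory
  advance ((ρ , σs) , X) c = (ρ , shift noSeed σs) , nextMarks c X

  start : Bits coins → Memory
  start ω = dec coinsᶜ ω , unmarked

  select : Memory → Subset n → Bool
  select ((ρ , _) , X) = selected ρ X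

  module S = Sketch w q memoryᶜ ask advance

  algorithm : StreamingAlgorithm n
  algorithm = S.algorithm R coins start select

  module _ (𝒞 : Collection n) (ρ : Vec (Vec Bool n) b) where

    next : Seed → Marks n b → Marks n b
    next σ X = nextMarks (Tally.tally 𝒞 ρ σ X) X

    -- The algorithm's `fold` has the last round outermost, whereas `run` peels off the first seed.
    -- Indexing seeds by the round number lets `trajectory-first` reconcile the two.
    trajectory : (ℕ → Seed) → Marks n b → ℕ → Marks n b
    trajectory s X zero    = X
    trajectory s X (suc t) = next (s t) (trajectory s X t)

    trajectory-first : ∀ s X t → trajectory s X (suc t) ≡ trajectory (s ∘ suc) (next (s 0) X) t
    trajectory-first s X zero    = refl
    trajectory-first s X (suc t) = cong (next (s (suc t))) (trajectory-first s X t)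

    counts-tally : ∀ σs X → S.counts 𝒞 ((ρ , σs) , X) ≡ Tally.tally 𝒞 ρ (at noSeed σs 0) X
    counts-tally σs X = refl

    advance-next : ∀ σs X → advance ((ρ , σs) , X) (S.counts 𝒞 ((ρ , σs) , X)) ≡
                            ((ρ , shift noSeed σs) , next (at noSeed σs 0) X)
    advance-next σs X = cong (λ c → (ρ , shift noSeed σs) , nextMarks c X) (counts-tally σs X)

    shifts : ∀ {r} → ℕ → Vec Seed r → Vec Seed r
    shifts zero    σs = σs
    shifts (suc t) σs = shift noSeed (shifts t σs)

    at-shifts : ∀ {r} t (σs : Vec Seed r) u → at noSeed (shifts t σs) u ≡ at noSeed σs (t + u)
    at-shifts zero    σs u = refl
    at-shifts (suc t) σs u = trans (at-shift noSeed (shifts t σs) u)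
      (trans (at-shifts t σs (suc u)) (cong (at noSeed σs) (+-suc t u)))

    fold-trajectory : ∀ σs X t → fold ((ρ , σs) , X) (λ x → advance x (S.counts 𝒞 x)) t ≡
                                 ((ρ , shifts t σs) , trajectory (at noSeed σs) X t)
    fold-trajectory σs X zero    = refl
    fold-trajectory σs X (suc t) =
      trans (cong (λ x → advance x (S.counts 𝒞 x)) (fold-trajectory σs X t))
      (trans (advance-next (shifts t σs) (trajectory (at noSeed σs) X t))
      (cong (λ σ → (ρ , shifts (suc t) σs) , next σ (trajectory (at noSeed σs) X t))
            (trans (at-shifts t σs 0) (cong (at noSeed σs) (+-identityʳ t)))))

  module _ {m Q : ℕ} (n≤2^L : n ≤ 2 ^ L) (8m≤2^J : 8 * m ≤ 2 ^ J) (m<2^w : m < 2 ^ w)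
    (Qm²≤2^b : 2 * Q * (m * m) ≤ 2 ^ b)
    (rounds : 127 ^ R * (2 * Q * (suc (2 * m) ^ suc L * 2 ^ L)) ≤ 128 ^ R)
    {a : Stream n} {𝒞 𝒪 : Collection n} (def : a Defines 𝒞) (|𝒞|≤m : length 𝒞 ≤ m) (⋃𝒞 : ⋃ 𝒞 ≡ ⊤)
    (𝒪⊆𝒞 : ∀ {S} → S ∈ 𝒪 → S ∈ 𝒞) (⋃𝒪 : ⋃ 𝒪 ≡ ⊤) {α : ℕ} (8L≤α : 8 * suc L ≤ α)
    where

    open StreamingAlgorithm algorithm using (solution; Pr[_]≥1-1/_)
    open FailureProbability {n} {J} {L} {m} {b} {R} {Q} n≤2^L 8m≤2^J Qm²≤2^b rounds 𝒞 |𝒞|≤m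
      hiding (unmarked)

    success? : ∀ ω → Dec (IsApproximation α 𝒞 𝒪 (solution a 𝒞 ω))
    success? ω = isApproximation? α 𝒞 𝒪 (solution a 𝒞 ω)

    run-trajectory : ∀ ρ none {r} (σs : Vec Seed r) X →
                     Run.run ρ none σs X ≡ trajectory 𝒞 ρ (at noSeed σs) X r
    run-trajectory ρ none []       X = refl
    run-trajectory ρ none {suc r} (σ ∷ σs) X =
      trans (run-trajectory ρ none σs (next 𝒞 ρ σ X)) (sym (trajectory-first 𝒞 ρ (at noSeed (σ ∷ σs)) X r))

    solution-run : ∀ ω (none : collisions (proj₁ (dec coinsᶜ ω)) ≡ 0) → let ρ , σs = dec coinsᶜ ω in
      solution a 𝒞 ω ≡ deduplicate _≟ₛ_ (filterᵇ (selected ρ (Run.run ρ none σs unmarked)) 𝒞)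
    solution-run ω none =
      let ρ , σs = dec coinsᶜ ω
      in trans (cong (λ x → deduplicate _≟ₛ_ (filterᵇ (select (proj₁ x)) 𝒞))
                 (S.final-state {R} {coins} start select {a} {𝒞} def (≤-<-trans |𝒞|≤m m<2^w) ω))
         (trans (cong (λ x → deduplicate _≟ₛ_ (filterᵇ (select x) 𝒞)) (fold-trajectory 𝒞 ρ σs unmarked R))
         (cong (λ X → deduplicate _≟ₛ_ (filterᵇ (selected ρ X) 𝒞)) (sym (run-trajectory ρ none σs unmarked))))

    succeeds : ∀ ω → failures (dec coinsᶜ ω) ≡ 0 → IsApproximation α 𝒞 𝒪 (solution a 𝒞 ω)
    succeeds ω no-failure = cases (collisions ρ ≟ 0) no-failure
      where
      ρ = proj₁ (dec coinsᶜ ω)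
      σs = proj₂ (dec coinsᶜ ω)
      cases : ∀ d → remaining ρ d σs ≡ 0 → IsApproximation α 𝒞 𝒪 (solution a 𝒞 ω)
      cases (yes none) Ψ≡0 =
        let open Cost {J = J} {L} n≤2^L 8m≤2^J 𝒞 |𝒞|≤m ρ (collisions≡0⇒injective none) 𝒪 𝒪⊆𝒞 ⋃𝒪
              using (approximation; invariant-run; invariant-start)
            cover , size = approximation ⋃𝒞 (invariant-run σs invariant-start) Ψ≡0
        in subst (IsApproximation α 𝒞 𝒪) (sym (solution-run ω none))
             (cover , ≤-trans size (*-monoˡ-≤ (length 𝒪) 8L≤α))

    success-probability : Pr[ success? ]≥1-1/ Q
    success-probability = begin
      length (filter (¬? ∘ success?) (allFin (2 ^ coins))) * Q
        ≡⟨ trans (*-comm _ Q) (cong (Q *_) (length-filter (¬? ∘ success?) (allFin (2 ^ coins)))) ⟩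
      Q * ∑ (allFin (2 ^ coins)) (λ ω → ⟦ does (¬? (success? ω)) ⟧)
        ≤⟨ *-monoʳ-≤ Q (∑-mono (allFin (2 ^ coins)) (λ ω → failure ω (success? ω))) ⟩
      Q * ∑ (allFin (2 ^ coins)) (λ ω → failures (dec coinsᶜ ω))
        ≡⟨ cong (Q *_) (uniform failures) ⟩
      Q * ∑ Ω₀ (λ ρ → ∑ Ω λ σs → failures (ρ , σs))
        ≤⟨ ∑-failures ⟩
      N₀ * N
        ≡⟨ trans (cong (N₀ *_) (length-∑ Ω)) (sym (∑-const Ω₀ _)) ⟩
      ∑ Ω₀ (λ ρ → ∑ Ω λ σs → 1)
        ≡⟨ uniform (λ _ → 1) ⟨
      ∑ (allFin (2 ^ coins)) (λ _ → 1)
        ≡⟨ trans (sym (length-∑ (allFin (2 ^ coins)))) (List.length-tabulate {n = 2 ^ coins} id) ⟩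
      2 ^ coins ∎
      where
      open ≤-Reasoning
      uniform : ∀ f → ∑ (allFin (2 ^ coins)) (f ∘ dec coinsᶜ) ≡ ∑ Ω₀ λ ρ → ∑ Ω λ σs → f (ρ , σs)
      uniform = uniform-× identᶜ seedsᶜ Ω₀ Ω
        (uniform-vec (vecᶜ boolᶜ n) (vecs bools n) (uniform-vec boolᶜ bools uniform-bool n) b)
        (uniform-vec (vecᶜ (vecᶜ boolᶜ (suc n)) J) (seeds n J)
          (uniform-vec (vecᶜ boolᶜ (suc n)) (rows n) (uniform-vec boolᶜ bools uniform-bool (suc n)) J) R)
      failure : ∀ ω → (d : Dec (IsApproximation α 𝒞 𝒪 (solution a 𝒞 ω))) → ⟦ does (¬? d) ⟧ ≤ failures (dec coinsᶜ ω)
      failure ω (yes _)  = z≤n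
      failure ω (no bad) = n≢0⇒n>0 (bad ∘ succeeds ω)

-- Choice of the parameters and resource bounds

module Parameters (k n m : ℕ) where

  -- `E` bounds the logarithms of both quantities to be beaten: 2Qm² for the identifiers and 2Q
  -- times the initial potential for the rounds, where Q = (nm)ᵏ. In κ, 1 comes from the factor 2,
  -- 2k from Q, and 7 from the potential. Each halving takes 89 rounds.
  lm ln ℓ κ E R : ℕ
  lm = ⌈log₂ m ⌉
  ln = ⌈log₂ n ⌉
  ℓ  = lm * ln
  κ  = 2 * k + 8
  E  = κ * ℓ
  R  = 89 * E

  -- Sampling rates go down to 1/(8m), hence 3 + `lm` levels. The counters have 1 + `lm` bits since
  -- 2ʷ must exceed m even if m is a power of two.
  algorithm : StreamingAlgorithm n
  algorithm = Protocol.algorithm n E (3 + lm) ln R (suc lm)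

  m<2^1+lm : m < 2 ^ suc lm
  m<2^1+lm = ≤-<-trans (n≤2^⌈log₂n⌉ m) (^-monoʳ-< 2 (s≤s (s≤s z≤n)) (n<1+n lm))

  8m≤2^3+lm : 8 * m ≤ 2 ^ (3 + lm)
  8m≤2^3+lm = ≤-trans (*-monoʳ-≤ 8 (n≤2^⌈log₂n⌉ m)) (≤-reflexive (sym (^-distribˡ-+-* 2 3 lm)))

  module _ (2≤n : 2 ≤ n) (2≤m : 2 ≤ m) where

    1≤ln : 1 ≤ ln
    1≤ln = ⌈log₂⌉-mono-≤ 2≤n

    1≤lm : 1 ≤ lm
    1≤lm = ⌈log₂⌉-mono-≤ 2≤m

    lm≤ℓ : lm ≤ ℓ
    lm≤ℓ = m≤m*n lm ln ⦃ >-nonZero 1≤ln ⦄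

    ln≤ℓ : ln ≤ ℓ
    ln≤ℓ = m≤n*m ln lm ⦃ >-nonZero 1≤lm ⦄

    1≤ℓ : 1 ≤ ℓ
    1≤ℓ = ≤-trans 1≤lm lm≤ℓ

    Q≤ : (n * m) ^ k ≤ 2 ^ ((ln + lm) * k)
    Q≤ = begin
      (n * m) ^ k              ≤⟨ ^-monoˡ-≤ k (*-mono-≤ (n≤2^⌈log₂n⌉ n) (n≤2^⌈log₂n⌉ m)) ⟩
      (2 ^ ln * 2 ^ lm) ^ k    ≡⟨ cong (_^ k) (^-distribˡ-+-* 2 ln lm) ⟨
      (2 ^ (ln + lm)) ^ k      ≡⟨ ^-*-assoc 2 (ln + lm) k ⟩
      2 ^ ((ln + lm) * k)      ∎
      where open ≤-Reasoning

    2Q* : ∀ {x y} → x ≤ 2 ^ y → 1 + (ln + lm) * k + y ≤ E → 2 * (n * m) ^ k * x ≤ 2 ^ E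
    2Q* {x} {y} x≤ le = begin
      2 * (n * m) ^ k * x                   ≤⟨ *-mono-≤ (*-monoʳ-≤ 2 Q≤) x≤ ⟩
      2 ^ (1 + (ln + lm) * k) * 2 ^ y       ≡⟨ ^-distribˡ-+-* 2 (1 + (ln + lm) * k) y ⟨
      2 ^ (1 + (ln + lm) * k + y)           ≤⟨ ^-monoʳ-≤ 2 le ⟩
      2 ^ E                                 ∎
      where open ≤-Reasoning

    exponent : ∀ {y} → y ≤ 7 * ℓ → 1 + (ln + lm) * k + y ≤ E
    exponent {y} y≤ = begin
      1 + (ln + lm) * k + y          ≤⟨ +-mono-≤ (+-mono-≤ 1≤ℓ (*-monoˡ-≤ k (+-mono-≤ ln≤ℓ lm≤ℓ))) y≤ ⟩
      ℓ + (ℓ + ℓ) * k + 7 * ℓ        ≡⟨ collect ℓ k ⟩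
      E                              ∎
      where
      open ≤-Reasoning
      collect : ∀ l k → l + (l + l) * k + 7 * l ≡ (2 * k + 8) * l
      collect = solve-∀

    few-collisions : 2 * (n * m) ^ k * (m * m) ≤ 2 ^ E
    few-collisions = 2Q* {y = lm + lm} (≤-trans (*-mono-≤ (n≤2^⌈log₂n⌉ m) (n≤2^⌈log₂n⌉ m))
      (≤-reflexive (sym (^-distribˡ-+-* 2 lm lm)))) (exponent (≤-trans (+-mono-≤ lm≤ℓ lm≤ℓ)
      (≤-trans (≤-reflexive (cong (ℓ +_) (sym (+-identityʳ ℓ)))) (*-monoˡ-≤ ℓ {2} {7} (s≤s (s≤s z≤n))))))

    enough-rounds : 127 ^ R * (2 * (n * m) ^ k * (suc (2 * m) ^ suc ln * 2 ^ ln)) ≤ 128 ^ R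
    enough-rounds = ≤-trans (*-monoʳ-≤ (127 ^ R) (2Q* {y = (2 + lm) * suc ln + ln} potential (exponent small))) (rounds-suffice E)
      where
      open ≤-Reasoning
      B≤ : suc (2 * m) ≤ 2 ^ (2 + lm)
      B≤ = begin
        1 + 2 * m             ≤⟨ +-monoˡ-≤ (2 * m) (≤-trans (≤-trans (s≤s z≤n) 2≤m) (m≤n*m m 2)) ⟩
        2 * m + 2 * m         ≡⟨ double m ⟩
        4 * m                 ≤⟨ *-monoʳ-≤ 4 (n≤2^⌈log₂n⌉ m) ⟩
        4 * 2 ^ lm            ≡⟨ ^-distribˡ-+-* 2 2 lm ⟨
        2 ^ (2 + lm)          ∎
        where
        double : ∀ m → 2 * m + 2 * m ≡ 4 * m
        double = solve-∀
      potential : suc (2 * m) ^ suc ln * 2 ^ ln ≤ 2 ^ ((2 + lm) * suc ln + ln)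
      potential = begin
        suc (2 * m) ^ suc ln * 2 ^ ln            ≤⟨ *-monoˡ-≤ (2 ^ ln) (^-monoˡ-≤ (suc ln) B≤) ⟩
        (2 ^ (2 + lm)) ^ suc ln * 2 ^ ln         ≡⟨ cong (_* 2 ^ ln) (^-*-assoc 2 (2 + lm) (suc ln)) ⟩
        2 ^ ((2 + lm) * suc ln) * 2 ^ ln         ≡⟨ ^-distribˡ-+-* 2 ((2 + lm) * suc ln) ln ⟨
        2 ^ ((2 + lm) * suc ln + ln)             ∎
      small : (2 + lm) * suc ln + ln ≤ 7 * ℓ
      small = begin
        (2 + lm) * suc ln + ln                   ≡⟨ expand lm ln ⟩
        2 * 1 + 3 * ln + lm + lm * ln            ≤⟨ +-monoˡ-≤ ℓ (+-mono-≤ (+-mono-≤ (*-monoʳ-≤ 2 1≤ℓ) (*-monoʳ-≤ 3 ln≤ℓ)) lm≤ℓ) ⟩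
        2 * ℓ + 3 * ℓ + ℓ + ℓ                    ≡⟨ collect ℓ ⟩
        7 * ℓ                                    ∎
        where
        expand : ∀ x y → (2 + x) * suc y + y ≡ 2 * 1 + 3 * y + x + x * y
        expand = solve-∀
        collect : ∀ l → 2 * l + 3 * l + l + l ≡ 7 * l
        collect = solve-∀

    module _ {c : ℕ} (1000κ≤c : 1000 * κ ≤ c) where

      open StreamingAlgorithm algorithm using (space; passes)

      8≤κ : 8 ≤ κ
      8≤κ = m≤n+m 8 (2 * k)

      8000≤c : 8000 ≤ c
      8000≤c = ≤-trans (*-monoʳ-≤ 1000 8≤κ) 1000κ≤c

      passes≤ : passes ≤ c * ℓ
      passes≤ = ≤-trans (≤-reflexive (sym (*-assoc 89 κ ℓ)))
        (*-monoˡ-≤ ℓ (≤-trans (*-monoˡ-≤ κ {89} {1000} (≤ᵇ⇒≤ 89 1000 _)) 1000κ≤c))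

      approximation≤ : 8 * suc ln ≤ c * ln
      approximation≤ = begin
        8 * suc ln         ≤⟨ *-monoʳ-≤ 8 (+-monoˡ-≤ ln 1≤ln) ⟩
        8 * (ln + ln)      ≡⟨ collect ln ⟩
        16 * ln            ≤⟨ *-monoˡ-≤ ln (≤-trans (≤ᵇ⇒≤ 16 8000 _) 8000≤c) ⟩
        c * ln             ∎
        where
        open ≤-Reasoning
        collect : ∀ l → 8 * (l + l) ≡ 16 * l
        collect = solve-∀

      -- The fourth power of ℓ, unfolded. The counters need all four factors: thresholds, levels,
      -- identifier bits, and the width of a counter.
      Z : ℕ
      Z = ℓ * (ℓ * (ℓ * (ℓ * 1)))

      grow : ∀ x → x ≤ ℓ * x
      grow x = m≤n*m x ℓ ⦃ >-nonZero 1≤ℓ ⦄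

      ℓ²≤Z : ℓ * (ℓ * 1) ≤ Z
      ℓ²≤Z = ≤-trans (grow (ℓ * (ℓ * 1))) (grow (ℓ * (ℓ * (ℓ * 1))))

      ℓ≤Z : ℓ ≤ Z
      ℓ≤Z = ≤-trans (≤-trans (≤-reflexive (sym (*-identityʳ ℓ))) (grow (ℓ * 1))) ℓ²≤Z

      1≤n : 1 ≤ n
      1≤n = ≤-trans (s≤s z≤n) 2≤n

      suc≤2* : ∀ {x y} → 1 ≤ y → x ≤ y → suc x ≤ 2 * y
      suc≤2* {x} {y} 1≤y x≤y = +-mono-≤ 1≤y (≤-trans x≤y (≤-reflexive (sym (+-identityʳ y))))

      sucE≤ : suc E ≤ suc κ * ℓ
      sucE≤ = +-monoˡ-≤ E 1≤ℓ

      J≤ : 3 + lm ≤ 4 * ℓ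
      J≤ = ≤-trans (+-mono-≤ (*-monoʳ-≤ 3 1≤ℓ) lm≤ℓ) (≤-reflexive (collect ℓ))
        where
        collect : ∀ l → 3 * l + l ≡ 4 * l
        collect = solve-∀

      sucJ≤ : suc (3 + lm) ≤ 5 * ℓ
      sucJ≤ = +-mono-≤ 1≤ℓ J≤

      ident-space : E * (n * 1) ≤ κ * (n * Z)
      ident-space = ≤-trans (≤-reflexive (regroup κ ℓ n)) (*-monoʳ-≤ κ (*-monoʳ-≤ n ℓ≤Z))
        where
        regroup : ∀ κ l n → κ * l * (n * 1) ≡ κ * (n * l)
        regroup = solve-∀

      seeds-space : R * ((3 + lm) * (suc n * 1)) ≤ 712 * κ * (n * Z)
      seeds-space = begin
        R * ((3 + lm) * (suc n * 1))            ≤⟨ *-monoʳ-≤ R (*-mono-≤ J≤ (*-monoˡ-≤ 1 (suc≤2* 1≤n ≤-refl))) ⟩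
        89 * (κ * ℓ) * (4 * ℓ * (2 * n * 1))    ≡⟨ regroup κ ℓ n ⟩
        712 * κ * (n * (ℓ * (ℓ * 1)))           ≤⟨ *-monoʳ-≤ (712 * κ) (*-monoʳ-≤ n ℓ²≤Z) ⟩
        712 * κ * (n * Z)                       ∎
        where
        open ≤-Reasoning
        regroup : ∀ κ l n → 89 * (κ * l) * (4 * l * (2 * n * 1)) ≡ 712 * κ * (n * (l * (l * 1)))
        regroup = solve-∀

      marks-space : n * suc (E * 1) ≤ suc κ * (n * Z)
      marks-space = begin
        n * suc (E * 1)        ≡⟨ cong (λ z → n * suc z) (*-identityʳ E) ⟩
        n * suc E              ≤⟨ *-monoʳ-≤ n sucE≤ ⟩
        n * (suc κ * ℓ)        ≡⟨ regroup n (suc κ) ℓ ⟩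
        suc κ * (n * ℓ)        ≤⟨ *-monoʳ-≤ (suc κ) (*-monoʳ-≤ n ℓ≤Z) ⟩
        suc κ * (n * Z)        ∎
        where
        open ≤-Reasoning
        regroup : ∀ x y z → x * (y * z) ≡ y * (x * z)
        regroup = solve-∀

      counter-space : suc ln * (n * (suc (3 + lm) * suc E)) * suc lm ≤ 20 * suc κ * (n * Z)
      counter-space = begin
        suc ln * (n * (suc (3 + lm) * suc E)) * suc lm
          ≤⟨ *-mono-≤ (*-mono-≤ (suc≤2* 1≤ℓ ln≤ℓ) (*-monoʳ-≤ n (*-mono-≤ sucJ≤ sucE≤))) (suc≤2* 1≤ℓ lm≤ℓ) ⟩
        2 * ℓ * (n * (5 * ℓ * (suc κ * ℓ))) * (2 * ℓ)
          ≡⟨ regroup ℓ n (suc κ) ⟩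
        20 * suc κ * (n * Z) ∎
        where
        open ≤-Reasoning
        regroup : ∀ l n k → 2 * l * (n * (5 * l * (k * l))) * (2 * l) ≡ 20 * k * (n * (l * (l * (l * (l * 1)))))
        regroup = solve-∀

      space≤ : space ≤ c * (n * ℓ ^ c)
      space≤ = begin
        space
          ≤⟨ +-mono-≤ (+-mono-≤ (+-mono-≤ ident-space seeds-space) marks-space) counter-space ⟩
        κ * (n * Z) + 712 * κ * (n * Z) + suc κ * (n * Z) + 20 * suc κ * (n * Z)
          ≡⟨ collect κ (n * Z) ⟩
        (734 * κ + 21) * (n * Z)
          -- The constant 1000 is 734 rounded up generously; the surplus 266κ absorbs the 21 because
          -- κ ≥ 8.
          ≤⟨ *-monoˡ-≤ (n * Z) (+-monoʳ-≤ (734 * κ) (≤-trans (≤ᵇ⇒≤ 21 (266 * 8) _) (*-monoʳ-≤ 266 8≤κ))) ⟩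
        (734 * κ + 266 * κ) * (n * Z)
          ≡⟨ cong (_* (n * Z)) (*-distribʳ-+ κ 734 266) ⟨
        1000 * κ * (n * Z)
          ≤⟨ *-mono-≤ 1000κ≤c (*-monoʳ-≤ n (^-monoʳ-≤ ℓ ⦃ >-nonZero 1≤ℓ ⦄ (≤-trans (≤ᵇ⇒≤ 4 8000 _) 8000≤c))) ⟩
        c * (n * ℓ ^ c) ∎
        where
        open ≤-Reasoning
        collect : ∀ κ z → κ * z + 712 * κ * z + suc κ * z + 20 * suc κ * z ≡ (734 * κ + 21) * z
        collect = solve-∀

      open StreamingAlgorithm algorithm using (solution; Pr[_]≥1-1/_)

      correct : ∀ (a : Stream n) (𝒞 𝒪 : Collection n) → a Defines 𝒞 → length 𝒞 ≤ m → ⋃ 𝒞 ≡ ⊤ → IsMinimumCover 𝒞 𝒪 →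
                Pr[ (λ ω → isApproximation? (c * ln) 𝒞 𝒪 (solution a 𝒞 ω)) ]≥1-1/ ((n * m) ^ k)
      correct a 𝒞 𝒪 def |𝒞|≤m ⋃𝒞 ((𝒪⊆𝒞 , ⋃𝒪) , _) =
        Protocol.success-probability n E (3 + lm) ln R (suc lm) {m} {(n * m) ^ k}
          (n≤2^⌈log₂n⌉ n) 8m≤2^3+lm m<2^1+lm few-collisions enough-rounds
          {a} {𝒞} {𝒪} def |𝒞|≤m ⋃𝒞 𝒪⊆𝒞 ⋃𝒪 {c * ln} approximation≤

opaque

  factor : ℕ → ℕ
  factor k = 1000 * (2 * k + 8)

  factor-≥ : ∀ k → 1000 * (2 * k + 8) ≤ factor k
  factor-≥ k = ≤-refl

corollary8 : ∀ (k : ℕ) →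
    ∃[ c ] Σ[ A ∈ ((n m : ℕ) → StreamingAlgorithm n) ]
    ∀ (n m : ℕ) → 2 ≤ n → 2 ≤ m →
    let open StreamingAlgorithm (A n m) in
    space ≤ c * (n * (⌈log₂ m ⌉ * ⌈log₂ n ⌉) ^ c) ×
    passes ≤ c * (⌈log₂ m ⌉ * ⌈log₂ n ⌉) ×
    (∀ (a : Stream n) (𝒞 𝒪 : Collection n) →
    IsDynamic a →
    a Defines 𝒞 →
    length 𝒞 ≤ m →
    ⋃ 𝒞 ≡ ⊤ →
    IsMinimumCover 𝒞 𝒪 →
    Pr[ (λ ω → isApproximation? (c * ⌈log₂ n ⌉) 𝒞 𝒪 (solution a 𝒞 ω)) ]≥1-1/ ((n * m) ^ k))
corollary8 k = factor k , Parameters.algorithm k , λ n m 2≤n 2≤m →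
  Parameters.space≤ k n m 2≤n 2≤m {factor k} (factor-≥ k) ,
  Parameters.passes≤ k n m 2≤n 2≤m {factor k} (factor-≥ k) ,
  λ a 𝒞 𝒪 _ → Parameters.correct k n m 2≤n 2≤m {factor k} (factor-≥ k) a 𝒞 𝒪
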